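{- The following problem (EL-k Transition Persistence Problem) is decidable: given a place/transition net $\mathrm{S}=(P,T,F,M_0)$, an ordered pair $(a,b)\in T\times T$ with $b\neq a$, and $\mathrm{k}\in\mathbb{N}$, decide whether there exists a reachable marking $M\in[M_0\rangle$ such that $Ma\wedge Mb\wedge\neg[\exists w\in T^*\ (|w|\le\mathrm{k}\wedge Mawb)]$.
   Context: A place/transition net (p/t-net) is $\mathrm{S}=(P,T,F,M_0)$ where $P$ (places) and $T$ (transitions) are finite disjoint sets, $F\subseteq P\times T\cup T\times P$ is the flow relation, and $M_0\in\mathbb{N}^P$ is the initial marking. Markings are vectors in $\mathbb{N}^P$, ordered and added componentwise. For $a\in T$, ${}^\bullet a\in\mathbb{N}^P$ is the vector with $1$ at places $p$ with $(p,a)\in F$ and $0$ elsewhere; $a^\bullet$ is the vector with $1$ at places $p$ with $(a,p)\in F$ and $0$ elsewhere. A transition $a$ is enabled in $M$ (written $Ma$) iff ${}^\bullet a\le M$; then firing $a$ yields $M'=(M-{}^\bullet a)+a^\bullet$ (written $MaM'$). This is extended to strings $w\in T^*$: $M\varepsilon M$, and $MvaM''$ iff $MvM'$ and $M'aM''$ for some $M'$; $Mw$ means $MwM'$ for some $M'$. The set $[M_0\rangle$ of reachable markings consists of all $M'$ with $M_0wM'$ for some $w\in T^*$. -}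

module Defs where

open import Data.Nat using (ℕ; _≤_; _∸_; _+_)
open import Data.Bool using (Bool; true; false)
open import Data.Fin using (Fin)
open import Data.Vec using (Vec; lookup; tabulate)
open import Data.List using (List; []; _∷_)
open import Data.Product using (Σ; ∃; _×_)
open import Relation.Binary.PropositionalEquality using (_≡_)

-- A place/transition net S = (P, T, F, M₀) with P = Fin nP, T = Fin nT.
-- The flow relation F ⊆ P×T ∪ T×P is given by its two parts:
--   inF t p = true  iff (p , t) ∈ F
--   outF t p = true iff (t , p) ∈ F
record Net : Set where
  field
    nP   : ℕ
    nT   : ℕ
    inF  : Fin nT → Fin nP → Bool
    outF : Fin nT → Fin nP → Bool
    M₀   : Vec ℕ nP

open Net public

χ : Bool → ℕ
χ true  = 1
χ false = 0

Marking : Net → Set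
Marking S = Vec ℕ (nP S)

Trans : Net → Set
Trans S = Fin (nT S)

pre : (S : Net) → Trans S → Marking S
pre S a = tabulate (λ p → χ (inF S a p))

post : (S : Net) → Trans S → Marking S
post S a = tabulate (λ p → χ (outF S a p))

Enabled : (S : Net) → Trans S → Marking S → Set
Enabled S a M = ∀ p → lookup (pre S a) p ≤ lookup M p

fireMarking : (S : Net) → Trans S → Marking S → Marking S
fireMarking S a M = tabulate (λ p → (lookup M p ∸ lookup (pre S a) p) + lookup (post S a) p)

Step : (S : Net) → Marking S → Trans S → Marking S → Set
Step S M a M' = Enabled S a M × M' ≡ fireMarking S a M

data Fires (S : Net) : Marking S → List (Trans S) → Marking S → Set where
  fires-ε : ∀ {M} → Fires S M [] M
  fires-∷ : ∀ {M M' M'' a w} → Step S M a M' → Fires S M' w M'' → Fires S M (a ∷ w) M''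

Firable : (S : Net) → Marking S → List (Trans S) → Set
Firable S M w = ∃ λ M' → Fires S M w M'

Reachable : (S : Net) → Marking S → Set
Reachable S M = ∃ λ w → Fires S (M₀ S) w M

{-# OPTIONS --safe #-}
-- The condition on M depends only on the entries of M cut off at k + 2, so it suffices to decide finitely many
-- questions of the form: is a marking reachable whose entries are prescribed at some places and at least
-- k + 2 at the others?  These are reachability problems, decided by the decomposition of Mayr, Kosaraju and
-- Lambert.  A chain of components (graphs over net actions, with partially specified entry and exit markings)
-- determines a linear system over ℕ satisfied by the arc counts and intermediate markings of every run.  If
-- the system is unsolvable there is no run.  If its homogeneous part has a solution that is positive on every
-- arc and every unspecified entry or exit value, and in each component the specified values can be pumped up
-- at the entry and down at the exit, then adding a large multiple of that solution yields a run.  Otherwise an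
-- arc count, an unspecified value or, by Rackoff's argument, some coordinate along every run is bounded, and
-- the component can be replaced by finitely many chains of components that are smaller in the lexicographic
-- order of the number of non-rigid coordinates, of arcs and of unspecified values.
module Submission where

open import Defs
open import Data.Nat using (ℕ; zero; suc; _≤_; _<_; _+_; _*_; _∸_; _⊓_; z≤n; s≤s; _≤?_; _<?_; _≟_)
open import Data.List using (List; []; _∷_; _++_; length)
open import Data.Product using (Σ; ∃; _×_; _,_; proj₁; proj₂)
open import Relation.Nullary using (Dec; yes; no; ¬_; does)
open import Relation.Binary.PropositionalEquality using (_≢_; _≡_; refl; sym; trans; cong; cong₂; subst; subst₂; _≗_; module ≡-Reasoning)
open import Relation.Nullary.Decidable using (_×-dec_; _⊎-dec_; ¬?; map′)
open import Relation.Nullary.Negation using (contradiction)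
open import Data.Nat.Properties
open import Data.Nat.DivMod using (_/_; _%_; m≡m%n+[m/n]*n; m%n<n)
open import Data.Nat.Tactic.RingSolver using (solve-∀)
open import Data.Bool using (Bool; true; false; if_then_else_)
open import Data.Maybe using (Maybe; just; nothing)
open import Data.Unit using (⊤; tt)
open import Data.Empty using (⊥-elim)
open import Data.Sum using (_⊎_; inj₁; inj₂; [_,_]′)
open import Data.Fin using (Fin; zero; suc; toℕ; fromℕ<; punchIn; punchOut; combine; remQuot)
import Data.Fin.Properties as F
import Data.List as L
import Data.List.Properties as L
open import Data.List.Relation.Unary.All as All using (All; []; _∷_)
open import Data.List.Relation.Unary.Any as Any using (Any; here; there)
import Data.List.Relation.Unary.All.Properties as All
import Data.List.Relation.Unary.Any.Properties as Any
open import Data.List.Membership.Propositional using (_∈_; lose; find)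
open import Data.List.Membership.Propositional.Properties using (∈-filter⁺; ∈-filter⁻; ∈-allFin; ∈-map⁺; ∈-++⁺ˡ; ∈-++⁺ʳ; ∈-cartesianProduct⁺; ∈-lookup; ∈-upTo⁺)
open import Data.Vec using (Vec; []; _∷_; lookup; tabulate)
import Data.Vec.Properties as V
open import Function using (_∘_; id; case_of_)
open import Induction.WellFounded using (Acc; acc; WellFounded)
open import Algebra.Properties.Semiring.Sum +-*-semiring using (sum; sum-cong-≗; ∑-distrib-+; sum-replicate-zero)
open import Relation.Binary.Definitions using (tri<; tri≈; tri>)
import Data.Sum as Sum
import Data.Sum.Properties as Sum
import Data.Bool.Properties as B
open import Data.Product.Relation.Binary.Lex.Strict using (×-Lex; ×-wellFounded)
open import Data.Nat.Induction using (<-wellFounded)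

-- Exact values prescribed at some places make this a reachability question; covering alone would
-- not do. The linear system is necessary for a run but not sufficient: a solution fixes how often
-- arcs are used, not in which order, and intermediate values may become negative. Pumping closes
-- this gap and needs quantities that can grow, so a component is refined exactly when something
-- that would have to grow is bounded. All bounds must therefore be computable. The solutions of a
-- linear system lie in finitely many linear sets, found by eliminating one equation after another,
-- and a variable on which all periods vanish is bounded by the bases. Covering is decided through
-- Rackoff's length bound rather than a coverability tree: the search is finite, and its failure
-- yields the bound on a coordinate. The bounds on arc counts and open values come from the system
-- of the whole chain, so they may be used in one component even where its own equations allow
-- larger values.

sum-mono : ∀ {n} {f g : Fin n → ℕ} → (∀ i → f i ≤ g i) → sum f ≤ sum g
sum-mono {zero}  f≤g = z≤n
sum-mono {suc n} f≤g = +-mono-≤ (f≤g zero) (sum-mono (f≤g ∘ suc))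

sum-mono-< : ∀ {n} {f g : Fin n → ℕ} → (∀ i → f i ≤ g i) → ∀ i → f i < g i → sum f < sum g
sum-mono-< f≤g zero    fi<gi = +-mono-<-≤ fi<gi (sum-mono (f≤g ∘ suc))
sum-mono-< f≤g (suc i) fi<gi = +-mono-≤-< (f≤g zero) (sum-mono-< (f≤g ∘ suc) i fi<gi)

≤-sum : ∀ {n} (f : Fin n → ℕ) i → f i ≤ sum f
≤-sum f zero    = m≤m+n _ _
≤-sum f (suc i) = ≤-trans (≤-sum (f ∘ suc) i) (m≤n+m _ _)

sum-pos : ∀ {n} (f : Fin n → ℕ) → 0 < sum f → ∃ λ i → 0 < f i
sum-pos {suc n} f 0<s with f zero in eq
... | suc _ = zero , subst (0 <_) (sym eq) (s≤s z≤n)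
... | zero  = let i , p = sum-pos (f ∘ suc) 0<s in suc i , p

sum-zero : ∀ {n} {f : Fin n → ℕ} → (∀ i → f i ≡ 0) → sum f ≡ 0
sum-zero {n} f≡0 = trans (sum-cong-≗ f≡0) (sum-replicate-zero n)

-- Systems of linear equations over ℕ

Asg : Set → Set
Asg I = I → ℕ

infixl 6 _⊞_
infixl 7 _⊡_

_⊞_ : {I : Set} → Asg I → Asg I → Asg I
(x ⊞ y) i = x i + y i

_⊡_ : {I : Set} → ℕ → Asg I → Asg I
(c ⊡ x) i = c * x i

-- Linear forms are additive functions rather than coefficient vectors: over ℕ additivity already
-- gives homogeneity, and elimination only evaluates a form at bases and periods.
record Lin (I : Set) : Set where
  field
    fun      : Asg I → ℕ
    fun-cong : ∀ {x y} → x ≗ y → fun x ≡ fun y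
    fun-⊞    : ∀ x y → fun (x ⊞ y) ≡ fun x + fun y

  fun-0 : fun (λ _ → 0) ≡ 0
  fun-0 = +-cancelˡ-≡ (fun (λ _ → 0)) _ _
    (trans (sym (fun-⊞ (λ _ → 0) (λ _ → 0))) (sym (+-identityʳ _)))

  fun-⊡ : ∀ c x → fun (c ⊡ x) ≡ c * fun x
  fun-⊡ zero    x = fun-0
  fun-⊡ (suc c) x = trans (fun-⊞ x (c ⊡ x)) (cong (fun x +_) (fun-⊡ c x))

open Lin

varL : ∀ {I} → I → Lin I
varL i = record { fun = λ x → x i ; fun-cong = λ e → e i ; fun-⊞ = λ _ _ → refl }

zeroL : ∀ {I} → Lin I
zeroL = record { fun = λ _ → 0 ; fun-cong = λ _ → refl ; fun-⊞ = λ _ _ → refl }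

_⊕_ : ∀ {I} → Lin I → Lin I → Lin I
f ⊕ g = record
  { fun      = λ x → fun f x + fun g x
  ; fun-cong = λ e → cong₂ _+_ (fun-cong f e) (fun-cong g e)
  ; fun-⊞    = λ x y → trans (cong₂ _+_ (fun-⊞ f x y) (fun-⊞ g x y)) (shuffle (fun f x) _ _ _)
  }
  where
  shuffle : ∀ a b c d → a + b + (c + d) ≡ a + c + (b + d)
  shuffle = solve-∀

weighL : ∀ {I n} → (Fin n → I) → (Fin n → ℕ) → Lin I
weighL ι w = record
  { fun      = λ x → sum (λ j → x (ι j) * w j)
  ; fun-cong = λ e → sum-cong-≗ (λ j → cong (_* w j) (e (ι j)))
  ; fun-⊞    = λ x y → trans (sum-cong-≗ (λ j → *-distribʳ-+ (w j) (x (ι j)) (y (ι j))))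
                             (∑-distrib-+ (λ j → x (ι j) * w j) (λ j → y (ι j) * w j))
  }

pullL : ∀ {I J} → (J → I) → Lin J → Lin I
pullL ι f = record
  { fun      = λ x → fun f (x ∘ ι)
  ; fun-cong = λ e → fun-cong f (e ∘ ι)
  ; fun-⊞    = λ x y → fun-⊞ f (x ∘ ι) (y ∘ ι)
  }

-- Equations carry constants on both sides because there is no subtraction. `viaS` embeds the
-- variables of a component into those of a chain, so that its system is reused unchanged.
data Sys (I : Set) : Set₁ where
  eqS  : Lin I → ℕ → Lin I → ℕ → Sys I
  topS : Sys I
  andS : Sys I → Sys I → Sys I
  allS : ∀ {n} → (Fin n → Sys I) → Sys I
  viaS : ∀ {J} → (J → I) → Sys J → Sys I

⟦_⟧ : ∀ {I} → Sys I → Asg I → Set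
⟦ eqS f a g b ⟧ x = fun f x + a ≡ fun g x + b
⟦ topS ⟧        x = ⊤
⟦ andS S T ⟧    x = ⟦ S ⟧ x × ⟦ T ⟧ x
⟦ allS S ⟧      x = ∀ i → ⟦ S i ⟧ x
⟦ viaS ι S ⟧    x = ⟦ S ⟧ (x ∘ ι)

⟦_⟧₀ : ∀ {I} → Sys I → Asg I → Set
⟦ eqS f a g b ⟧₀ x = fun f x ≡ fun g x
⟦ topS ⟧₀        x = ⊤
⟦ andS S T ⟧₀    x = ⟦ S ⟧₀ x × ⟦ T ⟧₀ x
⟦ allS S ⟧₀      x = ∀ i → ⟦ S i ⟧₀ x
⟦ viaS ι S ⟧₀    x = ⟦ S ⟧₀ (x ∘ ι)

-- Abstracts a solution set and its homogeneous companion, so that eliminating an equation preserves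
-- the equations already imposed without knowing them.
record Closed {I : Set} (A A₀ : Asg I → Set) : Set where
  field
    shift : ∀ {x g} → A x → A₀ g → A (x ⊞ g)
    plus  : ∀ {g h} → A₀ g → A₀ h → A₀ (g ⊞ h)
    zer   : A₀ (λ _ → 0)

  times : ∀ c {g} → A₀ g → A₀ (c ⊡ g)
  times zero    a = zer
  times (suc c) a = plus a (times c a)

open Closed

⟦⟧-closed : ∀ {I} (S : Sys I) → Closed ⟦ S ⟧ ⟦ S ⟧₀
⟦⟧-closed (eqS f a g b) = record
  { shift = λ {x} {y} p q → begin
      fun f (x ⊞ y) + a       ≡⟨ cong (_+ a) (fun-⊞ f x y) ⟩
      fun f x + fun f y + a   ≡⟨ swap (fun f x) _ _ ⟩
      fun f x + a + fun f y   ≡⟨ cong₂ _+_ p q ⟩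
      fun g x + b + fun g y   ≡⟨ swap (fun g x) _ _ ⟩
      fun g x + fun g y + b   ≡⟨ cong (_+ b) (sym (fun-⊞ g x y)) ⟩
      fun g (x ⊞ y) + b       ∎
  ; plus  = λ {x} {y} p q → trans (fun-⊞ f x y) (trans (cong₂ _+_ p q) (sym (fun-⊞ g x y)))
  ; zer   = trans (fun-0 f) (sym (fun-0 g))
  }
  where
  open ≡-Reasoning
  swap : ∀ m n o → m + n + o ≡ m + o + n
  swap = solve-∀
⟦⟧-closed topS = record { shift = λ _ _ → tt ; plus = λ _ _ → tt ; zer = tt }
⟦⟧-closed (andS S T) = record
  { shift = λ (p , q) (p₀ , q₀) → shift (⟦⟧-closed S) p p₀ , shift (⟦⟧-closed T) q q₀
  ; plus  = λ (p , q) (p₀ , q₀) → plus (⟦⟧-closed S) p p₀ , plus (⟦⟧-closed T) q q₀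
  ; zer   = zer (⟦⟧-closed S) , zer (⟦⟧-closed T)
  }
⟦⟧-closed (allS S) = record
  { shift = λ p p₀ i → shift (⟦⟧-closed (S i)) (p i) (p₀ i)
  ; plus  = λ p p₀ i → plus (⟦⟧-closed (S i)) (p i) (p₀ i)
  ; zer   = λ i → zer (⟦⟧-closed (S i))
  }
⟦⟧-closed (viaS ι S) = record
  { shift = shift (⟦⟧-closed S) ; plus = plus (⟦⟧-closed S) ; zer = zer (⟦⟧-closed S) }

-- Semilinear covers

cone : ∀ {I} → List (Asg I) → Asg I → Set
cone []       x = ∀ i → x i ≡ 0
cone (g ∷ gs) x = ∃ λ c → ∃ λ y → cone gs y × (∀ i → x i ≡ c * g i + y i)

LinearSet : Set → Set
LinearSet I = Asg I × List (Asg I)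

_∈Λ_ : ∀ {I} → Asg I → LinearSet I → Set
x ∈Λ (s , gs) = ∃ λ y → cone gs y × (∀ i → x i ≡ s i + y i)

-- The linear sets need not be contained in X: only their bases and periods are controlled, by A and A₀.
Cover : ∀ {I} (A A₀ X : Asg I → Set) → Set
Cover A A₀ X = ∃ λ ls → All (λ (s , gs) → A s × All A₀ gs) ls × (∀ x → X x → Any (x ∈Λ_) ls)

module _ {I : Set} {A A₀ : Asg I → Set} where

  cover-⊆ : ∀ {X Y : Asg I → Set} → (∀ x → Y x → X x) → Cover A A₀ X → Cover A A₀ Y
  cover-⊆ Y⊆X (ls , good , complete) = ls , good , λ x y → complete x (Y⊆X x y)

  cover-∪ : ∀ {X Y : Asg I → Set} → Cover A A₀ X → Cover A A₀ Y → Cover A A₀ (λ x → X x ⊎ Y x)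
  cover-∪ (ls , good , complete) (ls′ , good′ , complete′) =
    ls ++ ls′ , All.++⁺ good good′ ,
    λ { x (inj₁ p) → Any.++⁺ˡ (complete x p) ; x (inj₂ p) → Any.++⁺ʳ ls (complete′ x p) }

  cover-⋃ : ∀ N {X : ℕ → Asg I → Set} → (∀ i → Cover A A₀ (X i)) →
            Cover A A₀ (λ x → ∃ λ i → i < N × X i x)
  cover-⋃ zero    c = [] , [] , λ { x (i , () , _) }
  cover-⋃ (suc N) {X} c = cover-⊆ split (cover-∪ (c N) (cover-⋃ N c))
    where
    split : ∀ x → (∃ λ i → i < suc N × X i x) → X N x ⊎ (∃ λ i → i < N × X i x)
    split x (i , i<1+N , p) with m≤n⇒m<n∨m≡n i<1+N
    ... | inj₁ (s≤s i<N) = inj₂ (i , i<N , p)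
    ... | inj₂ refl      = inj₁ p

cover-map : ∀ {I} {A A₀ B B₀ X : Asg I → Set} → (∀ {x} → A x → B x) → (∀ {x} → A₀ x → B₀ x) →
            Cover A A₀ X → Cover B B₀ X
cover-map f f₀ (ls , good , complete) = ls , All.map (λ (a , a₀) → f a , All.map f₀ a₀) good , complete

-- Eliminating one equation

common-multiple : ∀ k l P Q →
  (∃ λ j → ∃ λ i → ∃ λ r → i < suc Q × k ≡ j * suc Q + i × l ≡ j * suc P + r) ⊎
  (∃ λ j → ∃ λ i → ∃ λ r → i < suc P × l ≡ j * suc P + i × k ≡ j * suc Q + r)
-- `j` is the smaller of the two quotients: its coefficient keeps only a remainder, the other
-- absorbs the difference of the quotients in `r`.
common-multiple k l P Q = case ≤-total (k / suc Q) (l / suc P) of λ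
  { (inj₁ le) → inj₁ (k / suc Q , k % suc Q , (l / suc P ∸ k / suc Q) * suc P + l % suc P , m%n<n k (suc Q) ,
                      trans (m≡m%n+[m/n]*n k (suc Q)) (+-comm (k % suc Q) _) ,
                      trans (m≡m%n+[m/n]*n l (suc P)) (split (l / suc P) (k / suc Q) (l % suc P) (suc P) le))
  ; (inj₂ le) → inj₂ (l / suc P , l % suc P , (k / suc Q ∸ l / suc P) * suc Q + k % suc Q , m%n<n l (suc P) ,
                      trans (m≡m%n+[m/n]*n l (suc P)) (+-comm (l % suc P) _) ,
                      trans (m≡m%n+[m/n]*n k (suc Q)) (split (k / suc Q) (l / suc P) (k % suc Q) (suc Q) le))
  }
  where
  ring : ∀ b c r w → r + (b + c) * w ≡ b * w + (c * w + r)
  ring = solve-∀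
  split : ∀ a b r w → b ≤ a → r + a * w ≡ b * w + ((a ∸ b) * w + r)
  split a b r w b≤a = trans (cong (λ t → r + t * w) (sym (m+[n∸m]≡n b≤a))) (ring b (a ∸ b) r w)

-- The sign of `fun f g` minus `fun h g` sorts the periods. The difference is stored through its
-- predecessor `w`, which makes it nonzero by construction.
module Elim {I : Set} {A A₀ : Asg I → Set} (cl : Closed A A₀) (f h : Lin I) (a b : ℕ) where

  Holds Zero Positive Negative : Asg I → Set
  Holds x    = fun f x + a ≡ fun h x + b
  Zero g     = A₀ g × fun f g ≡ fun h g
  Positive g = A₀ g × ∃ λ w → fun f g ≡ fun h g + suc w
  Negative g = A₀ g × ∃ λ w → fun h g ≡ fun f g + suc w

  Mem : Asg I → List (Asg I) → List (Asg I) → List (Asg I) → Asg I → Set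
  Mem s zs ps ns x = ∃ λ α → ∃ λ β → ∃ λ γ → cone zs α × cone ps β × cone ns γ ×
                     (∀ i → x i ≡ s i + (α i + (β i + γ i)))

  Goal : (Asg I → Set) → Set
  Goal X = Cover (λ x → A x × Holds x) Zero (λ x → X x × Holds x)

  fun-cone : ∀ (e : Lin I) {x} c g y → (∀ i → x i ≡ c * g i + y i) → fun e x ≡ c * fun e g + fun e y
  fun-cone e c g y eq = trans (fun-cong e eq) (trans (fun-⊞ e (c ⊡ g) y) (cong (_+ fun e y) (fun-⊡ e c g)))

  fun-[] : ∀ (e : Lin I) {x : Asg I} → (∀ i → x i ≡ 0) → fun e x ≡ 0
  fun-[] e eq = trans (fun-cong e eq) (fun-0 e)

  zero-cone : ∀ {zs x} → All Zero zs → cone zs x → fun f x ≡ fun h x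
  zero-cone [] c = trans (fun-[] f c) (sym (fun-[] h c))
  zero-cone {g ∷ _} ((_ , z) ∷ zz) (c , y , m , eq) = begin
    _                     ≡⟨ fun-cone f c g y eq ⟩
    c * fun f g + fun f y ≡⟨ cong₂ (λ u v → c * u + v) z (zero-cone zz m) ⟩
    c * fun h g + fun h y ≡⟨ fun-cone h c g y eq ⟨
    _                     ∎
    where open ≡-Reasoning

  positive-cone : ∀ {ps x} → All Positive ps → cone ps x → fun h x ≤ fun f x
  positive-cone [] c = ≤-reflexive (trans (fun-[] h c) (sym (fun-[] f c)))
  positive-cone {g ∷ _} ((_ , w , p) ∷ pp) (c , y , m , eq) = begin
    _                     ≡⟨ fun-cone h c g y eq ⟩
    c * fun h g + fun h y ≤⟨ +-mono-≤ (*-monoʳ-≤ c (≤-trans (m≤m+n _ _) (≤-reflexive (sym p)))) (positive-cone pp m) ⟩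
    c * fun f g + fun f y ≡⟨ fun-cone f c g y eq ⟨
    _                     ∎
    where open ≤-Reasoning

  Mem⁺ : Asg I → List (Asg I) → List (Asg I) → Asg I → Set
  Mem⁺ s zs ps x = ∃ λ α → ∃ λ β → cone zs α × cone ps β × (∀ i → x i ≡ s i + (α i + β i))

  -- Each copy of `p` raises the left side by at least one more than the right, and no other period
  -- works against it. So `k` is at most the deficit at the base, which is at most `fun h s + b`.
  positive-bound : ∀ {p ps x k β zs s α} → Positive p → All Positive ps → All Zero zs → cone zs α → cone ps β →
    (∀ i → x i ≡ s i + (α i + (k * p i + β i))) → Holds x → k < suc (fun h s + b)
  positive-bound {p} {ps} {x} {k} {β} {zs} {s} {α} (_ , w , e) pp zz mα mβ eq holds = s≤s (+-cancelʳ-≤ rest k _ (begin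
    k + (fun h α + (k * fun h p + fun h β))
      ≤⟨ +-monoˡ-≤ _ (m≤n⇒m≤o+n (fun f s + a) (m≤m*n k (suc w))) ⟩
    fun f s + a + k * suc w + (fun h α + (k * fun h p + fun h β))
      ≤⟨ +-monoʳ-≤ (fun f s + a + k * suc w) (+-monoʳ-≤ (fun h α) (+-monoʳ-≤ (k * fun h p) (positive-cone pp mβ))) ⟩
    fun f s + a + k * suc w + (fun h α + (k * fun h p + fun f β))
      ≡⟨ ring₁ (fun f s) a k (suc w) (fun h α) (fun h p) (fun f β) ⟩
    fun f s + (fun h α + (k * (fun h p + suc w) + fun f β)) + a
      ≡⟨ cong₂ (λ u v → fun f s + (u + (k * v + fun f β)) + a) (sym (zero-cone zz mα)) (sym e) ⟩
    fun f s + (fun f α + (k * fun f p + fun f β)) + a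
      ≡⟨ cong (_+ a) (expand f) ⟨
    fun f x + a
      ≡⟨ holds ⟩
    fun h x + b
      ≡⟨ cong (_+ b) (expand h) ⟩
    fun h s + (fun h α + (k * fun h p + fun h β)) + b
      ≡⟨ ring₂ (fun h s) (fun h α) (k * fun h p) (fun h β) b ⟩
    fun h s + b + (fun h α + (k * fun h p + fun h β)) ∎))
    where
    open ≤-Reasoning
    rest = fun h α + (k * fun h p + fun h β)
    expand : ∀ (e : Lin I) → fun e x ≡ fun e s + (fun e α + (k * fun e p + fun e β))
    expand e = trans (fun-cong e eq) (trans (fun-⊞ e s _) (cong (fun e s +_) (trans (fun-⊞ e α _)
      (cong (fun e α +_) (fun-cone e k p β (λ _ → refl))))))
    ring₁ : ∀ s a k w α p β → s + a + k * w + (α + (k * p + β)) ≡ s + (α + (k * (p + w) + β)) + a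
    ring₁ = solve-∀
    ring₂ : ∀ s α p β b → s + (α + (p + β)) + b ≡ s + b + (α + (p + β))
    ring₂ = solve-∀

  -- Without negative periods the coefficients of positive ones are bounded; each possible value is
  -- moved into the base, until the equation only concerns the base itself.
  eliminate⁺ : ∀ s zs ps → A s → All Zero zs → All Positive ps → Goal (Mem⁺ s zs ps)
  eliminate⁺ s zs [] as zz [] with fun f s + a ≟ fun h s + b
  ... | yes e = (s , zs) ∷ [] , ((as , e) , zz) ∷ [] ,
        λ x ((α , β , mα , mβ , eq) , _) → here (α , mα , λ i →
          trans (eq i) (cong (s i +_) (trans (cong (α i +_) (mβ i)) (+-identityʳ _))))
  ... | no ¬e = [] , [] , λ x ((α , β , mα , mβ , eq) , holds) → ⊥-elim (¬e (+-cancelʳ-≡ (fun h α) _ _ (begin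
        fun f s + a + fun h α           ≡⟨ cong (fun f s + a +_) (sym (zero-cone zz mα)) ⟩
        fun f s + a + fun f α           ≡⟨ expand f α β a mβ eq ⟨
        fun f x + a                     ≡⟨ holds ⟩
        fun h x + b                     ≡⟨ expand h α β b mβ eq ⟩
        fun h s + b + fun h α           ∎)))
    where
    open ≡-Reasoning
    ring : ∀ s α c → s + (α + 0) + c ≡ s + c + α
    ring = solve-∀
    expand : ∀ (e : Lin I) {x} α β c → (∀ i → β i ≡ 0) → (∀ i → x i ≡ s i + (α i + β i)) →
             fun e x + c ≡ fun e s + c + fun e α
    expand e α β c mβ eq = trans (cong (_+ c) (trans (fun-cong e eq) (trans (fun-⊞ e s _)
      (cong (fun e s +_) (trans (fun-⊞ e α β) (cong (fun e α +_) (fun-[] e mβ))))))) (ring (fun e s) (fun e α) c)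
  eliminate⁺ s zs (p ∷ ps) as zz (pp ∷ pps) =
    cover-⊆ split (cover-⋃ (suc (fun h s + b)) (λ k → eliminate⁺ (s ⊞ (k ⊡ p)) zs ps (shift cl as (times cl k (proj₁ pp))) zz pps))
    where
    ring : ∀ s α kp β → s + (α + (kp + β)) ≡ s + kp + (α + β)
    ring = solve-∀
    split : ∀ x → Mem⁺ s zs (p ∷ ps) x × Holds x →
            ∃ λ k → k < suc (fun h s + b) × Mem⁺ (s ⊞ (k ⊡ p)) zs ps x × Holds x
    split x ((α , β , mα , (k , β′ , mβ , eqβ) , eq) , holds) =
      k , positive-bound pp pps zz mα mβ eq′ holds ,
      (α , β′ , mα , mβ , λ i → trans (eq′ i) (ring (s i) (α i) (k * p i) (β′ i))) , holds
      where
      eq′ : ∀ i → x i ≡ s i + (α i + (k * p i + β′ i))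
      eq′ i = trans (eq i) (cong (λ t → s i + (α i + t)) (eqβ i))

  -- Each period is taken as often as the other one is out of balance, so the two imbalances cancel.
  pair : ∀ {p n} → (P : Positive p) (N : Negative n) → Zero ((suc (proj₁ (proj₂ N)) ⊡ p) ⊞ (suc (proj₁ (proj₂ P)) ⊡ n))
  pair {p} {n} (ap , P , ep) (an , Q , en) = plus cl (times cl (suc Q) ap) (times cl (suc P) an) , (begin
    fun f ((suc Q ⊡ p) ⊞ (suc P ⊡ n))                 ≡⟨ fun-cone f (suc Q) p (suc P ⊡ n) (λ _ → refl) ⟩
    suc Q * fun f p + fun f (suc P ⊡ n)               ≡⟨ cong₂ (λ u v → suc Q * u + v) ep (fun-⊡ f (suc P) n) ⟩
    suc Q * (fun h p + suc P) + suc P * fun f n       ≡⟨ ring (suc Q) (suc P) (fun h p) (fun f n) ⟩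
    suc Q * fun h p + suc P * (fun f n + suc Q)       ≡⟨ cong₂ (λ u v → suc Q * fun h p + v) en (trans (cong (suc P *_) (sym en)) (sym (fun-⊡ h (suc P) n))) ⟩
    suc Q * fun h p + fun h (suc P ⊡ n)               ≡⟨ fun-cone h (suc Q) p (suc P ⊡ n) (λ _ → refl) ⟨
    fun h ((suc Q ⊡ p) ⊞ (suc P ⊡ n))                 ∎)
    where
    open ≡-Reasoning
    ring : ∀ Q P p n → Q * (p + P) + P * n ≡ Q * p + P * (n + Q)
    ring = solve-∀

module _ {I : Set} {A A₀ : Asg I → Set} (cl : Closed A A₀) (f h : Lin I) (a b : ℕ) where

  open Elim cl f h a b

  -- A combination k p + l n of a positive and a negative period contains j copies of the period Q p + P n,
  -- where P and Q are the weights of p and n, such that the rest has k < Q or l < P.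
  eliminate± : ∀ s zs ps ns → A s → All Zero zs → All Positive ps → All Negative ns → Goal (Mem s zs ps ns)
  eliminate± s zs ps [] as zz pp [] = cover-⊆ forget (eliminate⁺ s zs ps as zz pp)
    where
    forget : ∀ x → Mem s zs ps [] x × Holds x → Mem⁺ s zs ps x × Holds x
    forget x ((α , β , γ , mα , mβ , mγ , eq) , holds) = (α , β , mα , mβ , λ i →
      trans (eq i) (cong (λ t → s i + (α i + t)) (trans (cong (β i +_) (mγ i)) (+-identityʳ _)))) , holds
  eliminate± s zs [] ns@(_ ∷ _) as zz [] nn =
    -- With its two sides exchanged, the equation has only zero and positive periods.
    cover-map (λ (a , e) → a , sym e) (λ (a , e) → a , sym e)
      (cover-⊆ forget (Elim.eliminate⁺ cl h f b a s zs ns as (All.map (λ (a , e) → a , sym e) zz) nn))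
    where
    forget : ∀ x → Mem s zs [] ns x × Holds x → Elim.Mem⁺ cl h f b a s zs ns x × Elim.Holds cl h f b a x
    forget x ((α , β , γ , mα , mβ , mγ , eq) , holds) = (α , γ , mα , mγ , λ i →
      trans (eq i) (cong (λ t → s i + (α i + (t + γ i))) (mβ i))) , sym holds
  eliminate± s zs (p ∷ ps) (n ∷ ns) as zz (pp ∷ pps) (nn ∷ nns) =
    cover-⊆ split (cover-∪
      (cover-⋃ (suc Q) (λ i → eliminate± (s ⊞ (i ⊡ p)) (z ∷ zs) ps (n ∷ ns)
                                 (shift cl as (times cl i (proj₁ pp))) (pair pp nn ∷ zz) pps (nn ∷ nns)))
      (cover-⋃ (suc P) (λ i → eliminate± (s ⊞ (i ⊡ n)) (z ∷ zs) (p ∷ ps) ns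
                                 (shift cl as (times cl i (proj₁ nn))) (pair pp nn ∷ zz) (pp ∷ pps) nns)))
    where
    P = proj₁ (proj₂ pp)
    Q = proj₁ (proj₂ nn)
    z = (suc Q ⊡ p) ⊞ (suc P ⊡ n)
    ring₁ : ∀ s α β γ Q P p n i j r → s + (α + (((j * Q + i) * p + β) + ((j * P + r) * n + γ))) ≡
                                      s + i * p + ((j * (Q * p + P * n) + α) + (β + (r * n + γ)))
    ring₁ = solve-∀
    ring₂ : ∀ s α β γ Q P p n i j r → s + (α + (((j * Q + r) * p + β) + ((j * P + i) * n + γ))) ≡
                                      s + i * n + ((j * (Q * p + P * n) + α) + ((r * p + β) + γ))
    ring₂ = solve-∀
    split : ∀ x → Mem s zs (p ∷ ps) (n ∷ ns) x × Holds x →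
      (∃ λ i → i < suc Q × Mem (s ⊞ (i ⊡ p)) (z ∷ zs) ps (n ∷ ns) x × Holds x) ⊎
      (∃ λ i → i < suc P × Mem (s ⊞ (i ⊡ n)) (z ∷ zs) (p ∷ ps) ns x × Holds x)
    split x ((α , β , γ , mα , (k , β′ , mβ , eqβ) , (l , γ′ , mγ , eqγ) , eq) , holds)
      with common-multiple k l P Q
    ... | inj₁ (j , i , r , i< , refl , refl) = inj₁ (i , i< ,
          (_ , β′ , _ , (j , α , mα , λ _ → refl) , mβ , (r , γ′ , mγ , λ _ → refl) , λ v →
            trans (eq v) (trans (cong₂ (λ t u → s v + (α v + (t + u))) (eqβ v) (eqγ v))
              (ring₁ (s v) (α v) (β′ v) (γ′ v) (suc Q) (suc P) (p v) (n v) i j r))) , holds)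
    ... | inj₂ (j , i , r , i< , refl , refl) = inj₂ (i , i< ,
          (_ , _ , γ′ , (j , α , mα , λ _ → refl) , (r , β′ , mβ , λ _ → refl) , mγ , λ v →
            trans (eq v) (trans (cong₂ (λ t u → s v + (α v + (t + u))) (eqβ v) (eqγ v))
              (ring₂ (s v) (α v) (β′ v) (γ′ v) (suc Q) (suc P) (p v) (n v) i j r))) , holds)

  excess : ∀ {m n} → m < n → n ≡ m + suc (n ∸ suc m)
  excess {m} m<n = trans (sym (m+[n∸m]≡n m<n)) (sym (+-suc m _))

  classify : ∀ s gs zs ps ns → A s → All A₀ gs → All Zero zs → All Positive ps → All Negative ns →
    Goal (λ x → ∃ λ y → cone gs y × ∃ λ x′ → Mem s zs ps ns x′ × (∀ i → x i ≡ x′ i + y i))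
  classify s [] zs ps ns as [] zz pp nn = cover-⊆ forget (eliminate± s zs ps ns as zz pp nn)
    where
    forget : ∀ x → (∃ λ y → (∀ i → y i ≡ 0) × ∃ λ x′ → Mem s zs ps ns x′ × (∀ i → x i ≡ x′ i + y i)) × Holds x →
             Mem s zs ps ns x × Holds x
    forget x ((y , y≡0 , x′ , (α , β , γ , mα , mβ , mγ , eq) , eq′) , holds) = (α , β , γ , mα , mβ , mγ , λ i →
      trans (eq′ i) (trans (trans (cong (x′ i +_) (y≡0 i)) (+-identityʳ _)) (eq i))) , holds
  classify s (g ∷ gs) zs ps ns as (ag ∷ ags) zz pp nn with <-cmp (fun f g) (fun h g)
  ... | tri≈ _ e _ = cover-⊆ move (classify s gs (g ∷ zs) ps ns as ags ((ag , e) ∷ zz) pp nn)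
    where
    ring : ∀ s α β γ g y → s + (α + (β + γ)) + (g + y) ≡ s + (g + α + (β + γ)) + y
    ring = solve-∀
    move : ∀ x → _ → _
    move x ((y , (c , y′ , m , eqy) , x′ , (α , β , γ , mα , mβ , mγ , eq) , eq′) , holds) =
      (y′ , m , _ , (_ , β , γ , (c , α , mα , λ _ → refl) , mβ , mγ , λ _ → refl) , λ i →
        trans (eq′ i) (trans (cong₂ _+_ (eq i) (eqy i)) (ring (s i) (α i) (β i) (γ i) (c * g i) (y′ i)))) , holds
  ... | tri< lt _ _ = cover-⊆ move (classify s gs zs ps (g ∷ ns) as ags zz pp ((ag , _ , excess lt) ∷ nn))
    where
    ring : ∀ s α β γ g y → s + (α + (β + γ)) + (g + y) ≡ s + (α + (β + (g + γ))) + y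
    ring = solve-∀
    move : ∀ x → _ → _
    move x ((y , (c , y′ , m , eqy) , x′ , (α , β , γ , mα , mβ , mγ , eq) , eq′) , holds) =
      (y′ , m , _ , (α , β , _ , mα , mβ , (c , γ , mγ , λ _ → refl) , λ _ → refl) , λ i →
        trans (eq′ i) (trans (cong₂ _+_ (eq i) (eqy i)) (ring (s i) (α i) (β i) (γ i) (c * g i) (y′ i)))) , holds
  ... | tri> _ _ gt = cover-⊆ move (classify s gs zs (g ∷ ps) ns as ags zz ((ag , _ , excess gt) ∷ pp) nn)
    where
    ring : ∀ s α β γ g y → s + (α + (β + γ)) + (g + y) ≡ s + (α + (g + β + γ)) + y
    ring = solve-∀
    move : ∀ x → _ → _
    move x ((y , (c , y′ , m , eqy) , x′ , (α , β , γ , mα , mβ , mγ , eq) , eq′) , holds) =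
      (y′ , m , _ , (α , _ , γ , mα , (c , β , mβ , λ _ → refl) , mγ , λ _ → refl) , λ i →
        trans (eq′ i) (trans (cong₂ _+_ (eq i) (eqy i)) (ring (s i) (α i) (β i) (γ i) (c * g i) (y′ i)))) , holds

  eliminate : ∀ s gs → A s → All A₀ gs → Goal (_∈Λ (s , gs))
  eliminate s gs as ags = cover-⊆ start (classify s gs [] [] [] as ags [] [] [])
    where
    start : ∀ x → x ∈Λ (s , gs) × Holds x → _
    start x ((y , m , eq) , holds) =
      (y , m , s , ((λ _ → 0) , (λ _ → 0) , (λ _ → 0) , (λ _ → refl) , (λ _ → refl) , (λ _ → refl) ,
                    λ i → sym (+-identityʳ (s i))) , eq) , holds

-- Solving systems equation by equation

closed-× : ∀ {I} {A A₀ B B₀ : Asg I → Set} → Closed A A₀ → Closed B B₀ → Closed (λ x → A x × B x) (λ x → A₀ x × B₀ x)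
closed-× ca cb = record
  { shift = λ (p , q) (p₀ , q₀) → shift ca p p₀ , shift cb q q₀
  ; plus  = λ (p , q) (p₀ , q₀) → plus ca p p₀ , plus cb q q₀
  ; zer   = zer ca , zer cb
  }

cover-bind : ∀ {I} {A A₀ B B₀ X Y : Asg I → Set} → Cover A A₀ X →
  (∀ s gs → A s → All A₀ gs → Cover B B₀ (λ x → x ∈Λ (s , gs) × Y x)) → Cover B B₀ (λ x → X x × Y x)
cover-bind {B = B} {B₀} {X} {Y} (ls , good , complete) k = cover-⊆ (λ x (p , q) → complete x p , q) (go ls good)
  where
  go : ∀ ls → All _ ls → Cover B B₀ (λ x → Any (x ∈Λ_) ls × Y x)
  go []               []             = [] , [] , λ { x (() , _) }
  go ((s , gs) ∷ ls) ((as , ags) ∷ gd) = cover-⊆ split (cover-∪ (k s gs as ags) (go ls gd))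
    where
    split : ∀ x → Any (x ∈Λ_) ((s , gs) ∷ ls) × Y x → (x ∈Λ (s , gs) × Y x) ⊎ (Any (x ∈Λ_) ls × Y x)
    split x (here m  , y) = inj₁ (m , y)
    split x (there m , y) = inj₂ (m , y)

-- Solving is relative to an arbitrary closed pair: a conjunction is solved in sequence, with the
-- first conjunct absorbed into the pair before the second is treated.
Solvable : ∀ {I} → (Asg I → Set) → (Asg I → Set) → Set₁
Solvable B B₀ = ∀ {A A₀ X} → Closed A A₀ → Cover A A₀ X →
  Cover (λ x → A x × B x) (λ x → A₀ x × B₀ x) (λ x → X x × B x)

solvable : ∀ {I J} (S : Sys J) (ι : J → I) → Solvable (λ x → ⟦ S ⟧ (x ∘ ι)) (λ x → ⟦ S ⟧₀ (x ∘ ι))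
solvable-all : ∀ {I n} {B B₀ : Fin n → Asg I → Set} → (∀ i → Closed (B i) (B₀ i)) → (∀ i → Solvable (B i) (B₀ i)) →
  Solvable (λ x → ∀ i → B i x) (λ x → ∀ i → B₀ i x)

solvable (eqS f a g b) ι cl c = cover-bind c (eliminate cl (pullL ι f) (pullL ι g) a b)
solvable topS          ι cl c = cover-map (_, tt) (_, tt) (cover-⊆ (λ _ → proj₁) c)
solvable (andS S T)    ι cl c =
  cover-map (λ ((a , p) , q) → a , p , q) (λ ((a , p) , q) → a , p , q)
    (cover-⊆ (λ _ (x , p , q) → (x , p) , q)
      (solvable T ι (closed-× cl (⟦⟧-closed (viaS ι S))) (solvable S ι cl c)))
solvable (allS S)      ι cl c = solvable-all (λ i → ⟦⟧-closed (viaS ι (S i))) (λ i → solvable (S i) ι) cl c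
solvable (viaS κ S)    ι cl c = solvable S (ι ∘ κ) cl c

solvable-all {n = zero}  cls ss cl c = cover-map (_, λ ()) (_, λ ()) (cover-⊆ (λ _ → proj₁) c)
solvable-all {n = suc n} cls ss cl c =
  cover-map join join
    (cover-⊆ (λ _ (x , p) → (x , p zero) , p ∘ suc)
      (solvable-all (cls ∘ suc) (ss ∘ suc) (closed-× cl (cls zero)) (ss zero cl c)))
  where
  join : ∀ {P : Set} {Q : Fin (suc n) → Set} → (P × Q zero) × (∀ i → Q (suc i)) → P × (∀ i → Q i)
  join ((a , p) , q) = a , λ { zero → p ; (suc i) → q i }

-- Solvability and bounds on variables

record Enum (I : Set) : Set where
  field
    elems    : List I
    complete : ∀ i → i ∈ elems
    _≟ₑ_     : ∀ (i j : I) → Dec (i ≡ j)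

enum-Fin : ∀ n → Enum (Fin n)
enum-Fin n = record { elems = L.allFin n ; complete = ∈-allFin ; _≟ₑ_ = F._≟_ }

enum-⊎ : ∀ {I J} → Enum I → Enum J → Enum (I ⊎ J)
enum-⊎ e e′ = record
  { elems    = L.map inj₁ (elems e) ++ L.map inj₂ (elems e′)
  ; complete = λ { (inj₁ i) → ∈-++⁺ˡ (∈-map⁺ inj₁ (complete e i))
                 ; (inj₂ j) → ∈-++⁺ʳ _ (∈-map⁺ inj₂ (complete e′ j)) }
  ; _≟ₑ_     = Sum.≡-dec (_≟ₑ_ e) (_≟ₑ_ e′)
  }
  where open Enum

module _ {I : Set} (e : Enum I) where

  open Enum e

  unit : I → Asg I
  unit i j = if does (i ≟ₑ j) then 1 else 0

  units-cone : ∀ is (x : Asg I) → ∃ λ y → cone (L.map unit is) y ×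
               (∀ i → i ∈ is → y i ≡ x i) × (∀ i → ¬ i ∈ is → y i ≡ 0)
  units-cone []       x = (λ _ → 0) , (λ _ → refl) , (λ _ ()) , (λ _ _ → refl)
  units-cone (j ∷ js) x with units-cone js x | Any.any? (j ≟ₑ_) js
  -- The list may repeat indices; only the last occurrence of an index receives its coefficient.
  ... | y , m , on , off | yes j∈js = y , (0 , y , m , λ _ → refl) , on′ , λ i i∉ → off i (i∉ ∘ there)
    where
    on′ : ∀ i → i ∈ (j ∷ js) → y i ≡ x i
    on′ i (here refl) = on i j∈js
    on′ i (there i∈)  = on i i∈
  ... | y , m , on , off | no j∉js = z , (x j , y , m , λ _ → refl) , on′ , off′
    where
    z : Asg I
    z i = x j * unit j i + y i
    on′ : ∀ i → i ∈ (j ∷ js) → z i ≡ x i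
    on′ i i∈ with j ≟ₑ i | i∈
    ... | yes refl | _         = trans (cong₂ _+_ (*-identityʳ (x j)) (off j j∉js)) (+-identityʳ (x j))
    ... | no j≢i   | here refl = contradiction refl j≢i
    ... | no _     | there i∈′ = trans (cong (_+ y i) (*-zeroʳ (x j))) (on i i∈′)
    off′ : ∀ i → ¬ i ∈ (j ∷ js) → z i ≡ 0
    off′ i i∉ with j ≟ₑ i
    ... | yes refl = contradiction (here refl) i∉
    ... | no _     = trans (cong (_+ y i) (*-zeroʳ (x j))) (off i (i∉ ∘ there))

  cover-full : Cover {I} (λ _ → ⊤) (λ _ → ⊤) (λ _ → ⊤)
  cover-full = ((λ _ → 0) , L.map unit elems) ∷ [] , (tt , All.universal _ _) ∷ [] , λ x _ →
    let y , m , on , _ = units-cone elems x in here (y , m , λ i → sym (on i (complete i)))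

total : ∀ {I} → List (Asg I) → Asg I
total = L.foldr _⊞_ (λ _ → 0)

total-closed : ∀ {I} {A A₀ : Asg I → Set} → Closed A A₀ → ∀ {gs} → All A₀ gs → A₀ (total gs)
total-closed cl []         = zer cl
total-closed cl (ag ∷ ags) = plus cl ag (total-closed cl ags)

cone-vanishes : ∀ {I} (gs : List (Asg I)) {y i} → total gs i ≡ 0 → cone gs y → y i ≡ 0
cone-vanishes []       eq m = m _
cone-vanishes (g ∷ gs) {y} {i} eq (c , y′ , m , split) = trans (split i)
  (cong₂ _+_ (trans (cong (c *_) (m+n≡0⇒m≡0 (g i) eq)) (*-zeroʳ c)) (cone-vanishes gs (m+n≡0⇒n≡0 (g i) eq) m))

Bounded : ∀ {I} → (Asg I → Set) → I → Set
Bounded X i = ∃ λ B → ∀ x → X x → x i ≤ B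

-- `h` sums all periods of the cover. Where it vanishes every period vanishes, so each solution has
-- there the value of some base, and the sum of the bases is a bound.
solve : ∀ {I} → Enum I → (S : Sys I) →
  (∀ x → ¬ ⟦ S ⟧ x) ⊎ (∃ λ x → ∃ λ h → ⟦ S ⟧ x × ⟦ S ⟧₀ h × ∀ i → 0 < h i ⊎ Bounded ⟦ S ⟧ i)
solve {I} e S with cover-map proj₂ proj₂ (cover-⊆ (λ _ p → tt , p) (solvable S id trivial (cover-full e)))
  where
  trivial : Closed {I} (λ _ → ⊤) (λ _ → ⊤)
  trivial = record { shift = λ _ _ → tt ; plus = λ _ _ → tt ; zer = tt }
... | [] , [] , complete = inj₁ λ x p → case complete x p of λ ()
... | ls@((s , _) ∷ _) , good@((as , _) ∷ _) , complete =
  inj₂ (s , h , as , periods-closed good , λ i → case h i ≟ 0 of λ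
    { (no  h≢0) → inj₁ (n≢0⇒n>0 h≢0)
    ; (yes h≡0) → inj₂ (total (L.map proj₁ ls) i , λ x p → bound ls h≡0 (complete x p)) })
  where
  periods : List (LinearSet I) → Asg I
  periods ls = total (L.map (total ∘ proj₂) ls)
  h = periods ls
  periods-closed : ∀ {ls} → All (λ (s , gs) → ⟦ S ⟧ s × All ⟦ S ⟧₀ gs) ls → ⟦ S ⟧₀ (periods ls)
  periods-closed gd = total-closed (⟦⟧-closed S)
    (All.map⁺ (All.map (λ {l} p → total-closed (⟦⟧-closed S) {proj₂ l} (proj₂ p)) gd))
  bound : ∀ ls {i x} → periods ls i ≡ 0 → Any (x ∈Λ_) ls → x i ≤ total (L.map proj₁ ls) i
  bound ((s , gs) ∷ ls) {i} h≡0 (here (y , m , eq)) = ≤-trans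
    (≤-reflexive (trans (eq i) (trans (cong (s i +_) (cone-vanishes gs (m+n≡0⇒m≡0 (total gs i) h≡0) m)) (+-identityʳ (s i)))))
    (m≤m+n (s i) _)
  bound ((s , gs) ∷ ls) {i} h≡0 (there m) = ≤-trans (bound ls (m+n≡0⇒n≡0 (total gs i) h≡0) m) (m≤n+m _ (s i))

-- Firing words on a single coordinate

weight : {E : Set} → (E → ℕ) → List E → ℕ
weight f []      = 0
weight f (e ∷ w) = f e + weight f w

weight-++ : {E : Set} (f : E → ℕ) → ∀ u w → weight f (u ++ w) ≡ weight f u + weight f w
weight-++ f []      w = refl
weight-++ f (e ∷ u) w = trans (cong (f e +_) (weight-++ f u w)) (sym (+-assoc (f e) _ _))

pow : {E : Set} → ℕ → List E → List E
pow zero    w = []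
pow (suc m) w = w ++ pow m w

weight-pow : {E : Set} (f : E → ℕ) → ∀ m w → weight f (pow m w) ≡ m * weight f w
weight-pow f zero    w = refl
weight-pow f (suc m) w = trans (weight-++ f w (pow m w)) (cong (weight f w +_) (weight-pow f m w))

cascade : {E : Set} → ℕ → (u w σ v : List E) → List E
cascade m u w σ v = pow m u ++ (pow m w ++ (σ ++ pow m v))

weight-cascade : {E : Set} (f : E → ℕ) → ∀ m u w σ v →
  weight f (cascade m u w σ v) ≡ m * weight f u + (m * weight f w + (weight f σ + m * weight f v))
weight-cascade f m u w σ v = trans (weight-++ f (pow m u) _) (cong₂ _+_ (weight-pow f m u) (trans (weight-++ f (pow m w) _)
  (cong₂ _+_ (weight-pow f m w) (trans (weight-++ f σ _) (cong (weight f σ +_) (weight-pow f m v))))))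

weight-≤ : {E : Set} {f : E → ℕ} {W : ℕ} → (∀ e → f e ≤ W) → ∀ w → weight f w ≤ W * length w
weight-≤ {W = W} f≤W []      = z≤n
weight-≤ {W = W} f≤W (e ∷ w) = ≤-trans (+-mono-≤ (f≤W e) (weight-≤ f≤W w)) (≤-reflexive (sym (*-suc W (length w))))

-- A run of the net is a family of runs on single coordinates along a common word, which lets most
-- estimates be made in ℕ. `Low` and `Exceeds` use truncated subtraction and so make sense for words
-- that cannot fire.
module Coord {E : Set} (con pro : E → ℕ) where

  Fir : ℕ → List E → ℕ → Set
  Fir k []      k′ = k ≡ k′
  Fir k (e ∷ w) k′ = con e ≤ k × Fir (k ∸ con e + pro e) w k′

  Low : ℕ → ℕ → List E → Set
  Low B k []      = k < B
  Low B k (e ∷ w) = k < B × Low B (k ∸ con e + pro e) w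

  Exceeds : ℕ → ℕ → List E → Set
  Exceeds B k []      = B ≤ k
  Exceeds B k (e ∷ w) = B ≤ k ⊎ Exceeds B (k ∸ con e + pro e) w

  low⊎exceeds : ∀ B k w → Low B k w ⊎ Exceeds B k w
  low⊎exceeds B k [] with k <? B
  ... | yes k<B = inj₁ k<B
  ... | no  k≮B = inj₂ (≮⇒≥ k≮B)
  low⊎exceeds B k (e ∷ w) with k <? B | low⊎exceeds B (k ∸ con e + pro e) w
  ... | no  k≮B | _      = inj₂ (inj₁ (≮⇒≥ k≮B))
  ... | yes k<B | inj₁ l = inj₁ (k<B , l)
  ... | yes k<B | inj₂ x = inj₂ (inj₂ x)

  exceeds-mono : ∀ {B B′} → B′ ≤ B → ∀ k w → Exceeds B k w → Exceeds B′ k w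
  exceeds-mono B′≤B k []      B≤k        = ≤-trans B′≤B B≤k
  exceeds-mono B′≤B k (e ∷ w) (inj₁ B≤k) = inj₁ (≤-trans B′≤B B≤k)
  exceeds-mono B′≤B k (e ∷ w) (inj₂ x)   = inj₂ (exceeds-mono B′≤B _ w x)

  low-head : ∀ {B} k w → Low B k w → k < B
  low-head k []      l       = l
  low-head k (e ∷ w) (l , _) = l

  fir-++ : ∀ u {w k k₁ k′} → Fir k u k₁ → Fir k₁ w k′ → Fir k (u ++ w) k′
  fir-++ []      refl    g = g
  fir-++ (e ∷ u) (p , f) g = p , fir-++ u f g

  fir-split : ∀ u {w k k′} → Fir k (u ++ w) k′ → ∃ λ k₁ → Fir k u k₁ × Fir k₁ w k′
  fir-split []      f       = _ , refl , f
  fir-split (e ∷ u) (p , f) = let k₁ , g , h = fir-split u f in k₁ , (p , g) , h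

  low-split : ∀ {B} u {w k k₁} → Fir k u k₁ → Low B k (u ++ w) → Low B k u × Low B k₁ w
  low-split []      refl    l       = low-head _ _ l , l
  low-split (e ∷ u) (p , f) (b , l) = let l₁ , l₂ = low-split u f l in (b , l₁) , l₂

  low-end : ∀ {B} w {k k′} → Fir k w k′ → Low B k w → k′ < B
  low-end []      refl    l       = l
  low-end (e ∷ w) (_ , f) (_ , l) = low-end w f l

  fir-effect : ∀ w {k k′} → Fir k w k′ → k + weight pro w ≡ k′ + weight con w
  fir-effect []      refl = refl
  fir-effect (e ∷ w) {k} {k′} (p , f) = begin
    k + (pro e + weight pro w)                    ≡⟨ cong (_+ (pro e + weight pro w)) (m∸n+n≡m p) ⟨
    k ∸ con e + con e + (pro e + weight pro w)    ≡⟨ ring (k ∸ con e) (con e) (pro e) (weight pro w) ⟩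
    con e + (k ∸ con e + pro e + weight pro w)    ≡⟨ cong (con e +_) (fir-effect w f) ⟩
    con e + (k′ + weight con w)                   ≡⟨ ring′ (con e) k′ (weight con w) ⟩
    k′ + (con e + weight con w)                   ∎
    where
    open ≡-Reasoning
    ring : ∀ a b c d → a + b + (c + d) ≡ b + (a + c + d)
    ring = solve-∀
    ring′ : ∀ a b c → a + (b + c) ≡ b + (a + c)
    ring′ = solve-∀

  fir-shift : ∀ j w {k k′} → Fir k w k′ → Fir (k + j) w (k′ + j)
  fir-shift j []      refl    = refl
  fir-shift j (e ∷ w) {k} {k′} (p , f) = m≤n⇒m≤n+o j p ,
    subst (λ t → Fir t w (k′ + j)) eq (fir-shift j w f)
    where
    ring : ∀ a b c → a + b + c ≡ a + c + b
    ring = solve-∀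
    eq : k ∸ con e + pro e + j ≡ k + j ∸ con e + pro e
    eq = trans (ring (k ∸ con e) (pro e) j) (cong (_+ pro e) (sym (+-∸-comm j p)))

  fir-forward : ∀ r w {k} → weight con w + r ≤ k → ∃ λ k′ → Fir k w k′ × r ≤ k′
  fir-forward r []      {k} le = k , refl , le
  fir-forward r (e ∷ w) {k} le =
    let k′ , f , r≤ = fir-forward r w {k ∸ con e + pro e} (m≤n⇒m≤n+o (pro e)
                        (≤-trans (≤-reflexive (sym (m+n∸m≡n (con e) _)))
                                 (∸-monoˡ-≤ (con e) (≤-trans (≤-reflexive (sym (+-assoc (con e) _ r))) le))))
    in k′ , (m+n≤o⇒m≤o (con e) (m+n≤o⇒m≤o (con e + weight con w) le) , f) , r≤

  -- Mirror image of `fir-forward`: read backwards, a word takes away what it produces.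
  fir-backward : ∀ r w {k′} → weight pro w + r ≤ k′ → ∃ λ k → Fir k w k′ × r ≤ k
  fir-backward r []      {k′} le = k′ , refl , le
  fir-backward r (e ∷ w) {k′} le =
    let k₁ , f , le₁ = fir-backward (pro e + r) w {k′} (≤-trans (≤-reflexive (ring (weight pro w) (pro e) r)) le)
        k = k₁ ∸ pro e + con e
    in k , (m≤n+m (con e) _ ,
            subst (λ t → Fir t w k′)
              (sym (trans (cong (_+ pro e) (m+n∸n≡m (k₁ ∸ pro e) (con e))) (m∸n+n≡m (m+n≤o⇒m≤o (pro e) le₁)))) f) ,
       m≤n⇒m≤n+o (con e) (≤-trans (≤-reflexive (sym (m+n∸m≡n (pro e) r))) (∸-monoˡ-≤ (pro e) le₁))
    where
    ring : ∀ a b c → a + (b + c) ≡ b + a + c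
    ring = solve-∀

  fir-pump : ∀ m w {k δ} → Fir k w (k + δ) → Fir k (pow m w) (k + m * δ)
  fir-pump zero    w {k} f = sym (+-identityʳ k)
  fir-pump (suc m) w {k} {δ} f = fir-++ w f
    (subst (Fir (k + δ) (pow m w)) (ring k (m * δ) δ) (fir-shift δ (pow m w) (fir-pump m w f)))
    where
    ring : ∀ a b c → a + b + c ≡ a + (c + b)
    ring = solve-∀

  fir-drain : ∀ m w {k δ} → Fir (k + δ) w k → Fir (k + m * δ) (pow m w) k
  fir-drain zero    w {k} f = +-identityʳ k
  fir-drain (suc m) w {k} {δ} f = fir-++ w
    (subst (λ t → Fir t w (k + m * δ)) (+-assoc k δ (m * δ)) (fir-shift (m * δ) w f))
    (fir-drain m w f)

  -- The value is affine in the number of repetitions, hence at least the smaller of the two end values.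
  fir-between : ∀ m w {k k′} → weight con w ≤ k → weight con w ≤ k′ →
    k + m * weight pro w ≡ k′ + m * weight con w → Fir k (pow m w) k′
  fir-between zero    w le le′ eq = trans (sym (+-identityʳ _)) (trans eq (+-identityʳ _))
  fir-between (suc m) w {k} {k′} le le′ eq with fir-forward 0 w {k} (≤-trans (≤-reflexive (+-identityʳ _)) le)
  ... | k₁ , f , _ = fir-++ w f (fir-between m w le₁ le′ eq₁)
    where
    P = weight pro w
    C = weight con w
    eff : k + P ≡ k₁ + C
    eff = fir-effect w f
    ring : ∀ a b c → a + b + c ≡ a + c + b
    ring = solve-∀
    eq₁ : k₁ + m * P ≡ k′ + m * C
    eq₁ = +-cancelʳ-≡ C _ _ (begin
      k₁ + m * P + C   ≡⟨ ring k₁ (m * P) C ⟩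
      k₁ + C + m * P   ≡⟨ cong (_+ m * P) eff ⟨
      k + P + m * P    ≡⟨ +-assoc k P (m * P) ⟩
      k + (P + m * P)  ≡⟨ eq ⟩
      k′ + (C + m * C) ≡⟨ +-assoc k′ C (m * C) ⟨
      k′ + C + m * C   ≡⟨ ring k′ C (m * C) ⟩
      k′ + m * C + C   ∎)
      where open ≡-Reasoning
    -- If a round does not lose, the value is still at least `k`; if it does not gain, the remaining
    -- rounds only descend to `k′`.
    le₁ : C ≤ k₁
    le₁ with ≤-total C P
    ... | inj₁ C≤P = ≤-trans le (+-cancelʳ-≤ C k k₁ (≤-trans (+-monoʳ-≤ k C≤P) (≤-reflexive eff)))
    ... | inj₂ P≤C = ≤-trans le′ (+-cancelʳ-≤ (m * P) k′ k₁
                       (≤-trans (+-monoʳ-≤ k′ (*-monoʳ-≤ m P≤C)) (≤-reflexive (sym eq₁))))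

  -- Computing backwards from `B`, the word `σ` must start at `A′`. The total effect forces the
  -- `w`-block to lead from `A` to `A′`, and `m` is large enough for `w` to fire at both of these
  -- values, which is what `fir-between` requires.
  fir-cascade : ∀ m u w σ v {a b A B} → Fir a (pow m u) A → Fir B (pow m v) b → m ≤ A → m ≤ B →
    weight pro σ + (weight con w + weight con σ) ≤ m →
    a + weight pro (cascade m u w σ v) ≡ b + weight con (cascade m u w σ v) → Fir a (cascade m u w σ v) b
  fir-cascade m u w σ v {a} {b} {A} {B} fu fv m≤A m≤B large eff = fir-++ (pow m u) fu (fir-++ (pow m w) fw (fir-++ σ fσ fv))
    where
    Cu = weight con u
    Cv = weight con v
    Cw = weight con w
    Cσ = weight con σ
    Qu = weight pro u
    Qv = weight pro v
    Qw = weight pro w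
    Qσ = weight pro σ
    B₀ = B ∸ Qσ
    A′ = B₀ + Cσ
    Qσ≤B : Qσ ≤ B
    Qσ≤B = ≤-trans (m+n≤o⇒m≤o Qσ large) m≤B
    Cw≤B₀ : Cw ≤ B₀
    Cw≤B₀ = ≤-trans (≤-trans (m≤m+n Cw Cσ) (≤-reflexive (sym (m+n∸m≡n Qσ _)))) (∸-monoˡ-≤ Qσ (≤-trans large m≤B))
    eff-u : a + m * Qu ≡ A + m * Cu
    eff-u = trans (cong (a +_) (sym (weight-pow pro m u))) (trans (fir-effect (pow m u) fu) (cong (A +_) (weight-pow con m u)))
    eff-v : B + m * Qv ≡ b + m * Cv
    eff-v = trans (cong (B +_) (sym (weight-pow pro m v))) (trans (fir-effect (pow m v) fv) (cong (b +_) (weight-pow con m v)))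
    eff′ : a + (m * Qu + (m * Qw + (Qσ + m * Qv))) ≡ b + (m * Cu + (m * Cw + (Cσ + m * Cv)))
    eff′ = trans (cong (a +_) (sym (weight-cascade pro m u w σ v))) (trans eff (cong (b +_) (weight-cascade con m u w σ v)))
    ring₁ : ∀ a b c d e → a + b + (c + (d + e)) ≡ a + c + (b + (d + e))
    ring₁ = solve-∀
    ring₂ : ∀ b c d e f → b + (c + (d + (e + f))) ≡ b + f + (c + (d + e))
    ring₂ = solve-∀
    ring₃ : ∀ b q r c d e → b + q + r + (c + (d + e)) ≡ b + e + d + (c + (q + r))
    ring₃ = solve-∀
    eff-w : A + m * Qw ≡ A′ + m * Cw
    eff-w = +-cancelʳ-≡ (m * Cu + (Qσ + m * Qv)) _ _ (begin
      A + m * Qw + (m * Cu + (Qσ + m * Qv))               ≡⟨ ring₁ A (m * Qw) (m * Cu) Qσ (m * Qv) ⟩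
      A + m * Cu + (m * Qw + (Qσ + m * Qv))               ≡⟨ cong (_+ (m * Qw + (Qσ + m * Qv))) eff-u ⟨
      a + m * Qu + (m * Qw + (Qσ + m * Qv))               ≡⟨ +-assoc a (m * Qu) _ ⟩
      a + (m * Qu + (m * Qw + (Qσ + m * Qv)))             ≡⟨ eff′ ⟩
      b + (m * Cu + (m * Cw + (Cσ + m * Cv)))             ≡⟨ ring₂ b (m * Cu) (m * Cw) Cσ (m * Cv) ⟩
      b + m * Cv + (m * Cu + (m * Cw + Cσ))               ≡⟨ cong (_+ (m * Cu + (m * Cw + Cσ))) eff-v ⟨
      B + m * Qv + (m * Cu + (m * Cw + Cσ))               ≡⟨ cong (λ t → t + m * Qv + (m * Cu + (m * Cw + Cσ))) (sym (m∸n+n≡m Qσ≤B)) ⟩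
      B₀ + Qσ + m * Qv + (m * Cu + (m * Cw + Cσ))         ≡⟨ ring₃ B₀ Qσ (m * Qv) (m * Cu) (m * Cw) Cσ ⟩
      A′ + m * Cw + (m * Cu + (Qσ + m * Qv))              ∎)
      where open ≡-Reasoning
    fw : Fir A (pow m w) A′
    fw = fir-between m w (≤-trans (≤-trans (m≤m+n Cw Cσ) (m≤n+m _ Qσ)) (≤-trans large m≤A)) (m≤n⇒m≤n+o Cσ Cw≤B₀) eff-w
    fσ : Fir A′ σ B
    fσ with fir-forward 0 σ {A′} (≤-trans (≤-reflexive (+-identityʳ Cσ)) (m≤n+m Cσ B₀))
    ... | k , f , _ = subst (Fir A′ σ) (+-cancelʳ-≡ Cσ _ _ (trans (sym (fir-effect σ f))
            (trans (ring B₀ Cσ Qσ) (cong (_+ Cσ) (m∸n+n≡m Qσ≤B))))) f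
      where
      ring : ∀ a b c → a + b + c ≡ a + c + b
      ring = solve-∀

module _ {E : Set} {con pro : E → ℕ} where

  open Coord

  private
    undo : ∀ e k → con e ≤ k → k ∸ con e + pro e ∸ pro e + con e ≡ k
    undo e k le = trans (cong (_+ con e) (m+n∸n≡m (k ∸ con e) (pro e))) (m∸n+n≡m le)

  fir-reverse : ∀ w {k k′} → Fir con pro k w k′ → Fir pro con k′ (L.reverse w) k
  fir-reverse []      refl = refl
  fir-reverse (e ∷ w) {k} (p , f) = subst (λ w′ → Fir pro con _ w′ k) (sym (L.unfold-reverse e w))
    (fir-++ pro con (L.reverse w) (fir-reverse w f) (m≤n+m (pro e) (k ∸ con e) , undo e k p))

  low-reverse : ∀ {B} w {k k′} → Fir con pro k w k′ → Low pro con B k′ (L.reverse w) → Low con pro B k w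
  low-reverse []      refl    l = l
  low-reverse {B} (e ∷ w) {k} {k′} (p , f) l =
    let l₁ , l₂ , l₃ = low-split pro con (L.reverse w) (fir-reverse w f) (subst (Low pro con B k′) (L.unfold-reverse e w) l)
    in subst (_< B) (undo e k p) l₃ , low-reverse w f l₁

-- Shortening walks in a finite transition system

-- Nodes are compared by an equivalence because Rackoff's argument identifies markings that agree on
-- a selection of coordinates.
module Walks {X E : Set} (_~_ : X → X → Set)
  (~-refl : ∀ {x} → x ~ x) (~-sym : ∀ {x y} → x ~ y → y ~ x) (~-trans : ∀ {x y z} → x ~ y → y ~ z → x ~ z)
  (_~?_ : ∀ x y → Dec (x ~ y)) (en : X → E → Set) (nx : X → E → X)
  (en-resp : ∀ {x y} e → x ~ y → en x e → en y e) (nx-resp : ∀ {x y} e → x ~ y → nx x e ~ nx y e) where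

  Ok : X → List E → Set
  Ok x []       = ⊤
  Ok x (e ∷ es) = en x e × Ok (nx x e) es

  aft : X → List E → X
  aft x []       = x
  aft x (e ∷ es) = aft (nx x e) es

  -- The final node is left unconstrained: in Rackoff's argument the walk ends at the first marking
  -- outside the box.
  Sources : (X → Set) → X → List E → Set
  Sources Q x []       = ⊤
  Sources Q x (e ∷ es) = Q x × Sources Q (nx x e) es

  ok-resp : ∀ {x y} es → x ~ y → Ok x es → Ok y es
  ok-resp []       r ok       = tt
  ok-resp (e ∷ es) r (p , ok) = en-resp e r p , ok-resp es (nx-resp e r) ok

  aft-resp : ∀ {x y} es → x ~ y → aft x es ~ aft y es
  aft-resp []       r = r
  aft-resp (e ∷ es) r = aft-resp es (nx-resp e r)

  ok-++ : ∀ {x} es {es′} → Ok x es → Ok (aft x es) es′ → Ok x (es ++ es′)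
  ok-++ []       _        ok′ = ok′
  ok-++ (e ∷ es) (p , ok) ok′ = p , ok-++ es ok ok′

  aft-++ : ∀ {x} es {es′} → aft x (es ++ es′) ≡ aft (aft x es) es′
  aft-++ []       = refl
  aft-++ (e ∷ es) = aft-++ es

  last-visit : ∀ (Q : X → Set) x z es → Ok z es → Sources Q z es →
    let Q′ = λ y → Q y × ¬ (y ~ x) in
    Sources Q′ z es ⊎
    (∃ λ y → ∃ λ e → ∃ λ es′ → y ~ x × Ok y (e ∷ es′) × Sources Q′ (nx y e) es′ × aft y (e ∷ es′) ≡ aft z es)
  last-visit Q x z []       ok src = inj₁ tt
  last-visit Q x z (e ∷ es) (p , ok) (qz , src) with last-visit Q x (nx z e) es ok src | z ~? x
  ... | inj₂ found | _       = inj₂ found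
  ... | inj₁ src′  | yes z~x = inj₂ (z , e , es , z~x , (p , ok) , src′ , refl)
  ... | inj₁ src′  | no  z≁x = inj₁ ((qz , z≁x) , src′)

  sources-map : ∀ {Q Q′ : X → Set} → (∀ {x} → Q x → Q′ x) → ∀ {x} es → Sources Q x es → Sources Q′ x es
  sources-map f []       s       = tt
  sources-map f (e ∷ es) (p , s) = f p , sources-map f es s

  -- Jumping to the last visit of the current node and leaving it from there removes that node from
  -- the rest of the walk, so each listed node is left at most once.
  shorten : ∀ N (nodes : List X) → length nodes ≤ N → ∀ x es → Ok x es →
    Sources (λ y → Any (y ~_) nodes) x es → ∃ λ es′ → length es′ ≤ N × Ok x es′ × aft x es′ ~ aft x es
  shorten N nodes le x [] ok src = [] , z≤n , tt , ~-refl
  shorten zero [] le x (e ∷ es) ok (() , _)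
  shorten (suc N) nodes le x (e ∷ es) ok src with last-visit (λ y → Any (y ~_) nodes) x x (e ∷ es) ok src
  ... | inj₁ ((_ , x≁x) , _) = contradiction ~-refl x≁x
  ... | inj₂ (y , e′ , es′ , y~x , (p , ok′) , src′ , end) =
    e′ ∷ es″ , s≤s le″ , ok-resp (e′ ∷ es″) y~x (p , ok″) ,
    ~-trans (~-sym (aft-resp (e′ ∷ es″) y~x)) (~-trans end″ (subst (aft (nx y e′) es′ ~_) end ~-refl))
    where
    far? = λ z → ¬? (z ~? x)
    nodes′ = L.filter far? nodes
    smaller : length nodes′ < length nodes
    smaller = L.filter-notAll far? nodes (Any.map (λ x~z z≁x → z≁x (~-sym x~z)) (proj₁ src))
    keep : ∀ {z} → Any (z ~_) nodes × ¬ (z ~ x) → Any (z ~_) nodes′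
    keep (z∈ , z≁x) with find z∈
    ... | w , w∈ , z~w = lose (∈-filter⁺ far? w∈ (λ w~x → z≁x (~-trans z~w w~x))) z~w
    rec = shorten N nodes′ (≤-pred (≤-trans smaller le)) (nx y e′) es′ ok′ (sources-map keep es′ src′)
    es″ = proj₁ rec
    le″ = proj₁ (proj₂ rec)
    ok″ = proj₁ (proj₂ (proj₂ rec))
    end″ = proj₂ (proj₂ (proj₂ rec))

-- Covering in vector addition systems with states

search : ∀ {n} {Q : List (Fin n) → Set} → (∀ es → Dec (Q es)) → ∀ ℓ → Dec (∃ λ es → length es ≤ ℓ × Q es)
search {n} {Q} Q? zero    = map′ (λ q → [] , z≤n , q) (λ { ([] , _ , q) → q }) (Q? [])
search {n} {Q} Q? (suc ℓ) with Q? []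
... | yes q = yes ([] , z≤n , q)
... | no ¬q = map′ (λ (i , es , le , q) → i ∷ es , s≤s le , q)
                   (λ { ([] , _ , q) → contradiction q ¬q ; (i ∷ es , s≤s le , q) → i , es , le , q })
                   (F.any? (λ i → search (λ es → Q? (i ∷ es)) ℓ))

record Graph (d : ℕ) : Set where
  field
    size arcs : ℕ
    src tgt   : Fin arcs → Fin size
    con pro   : Fin arcs → Fin d → ℕ

  Path : Fin size → List (Fin arcs) → Fin size → Set
  Path v []       v′ = v ≡ v′
  Path v (e ∷ es) v′ = src e ≡ v × Path (tgt e) es v′

  open module C p = Coord (λ e → con e p) (λ e → pro e p) public using (Fir; Low; Exceeds)

  path-++ : ∀ es {es′ u v w} → Path u es v → Path v es′ w → Path u (es ++ es′) w
  path-++ []       refl    q = q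
  path-++ (e ∷ es) (s , p) q = s , path-++ es p q

  path-split : ∀ es {es′ u w} → Path u (es ++ es′) w → ∃ λ v → Path u es v × Path v es′ w
  path-split []       p       = _ , refl , p
  path-split (e ∷ es) (s , p) = let v , q , r = path-split es p in v , (s , q) , r

  path-pow : ∀ m {es v} → Path v es v → Path v (pow m es) v
  path-pow zero    p = refl
  path-pow (suc m) p = path-++ _ p (path-pow m p)

  open Walks {Fin size} {Fin arcs} _≡_ refl sym trans F._≟_ (λ v e → src e ≡ v) (λ v e → tgt e)
       (λ e eq s → trans s eq) (λ e _ → refl)

  path? : ∀ v v′ → Dec (∃ λ es → Path v es v′)
  path? v v′ = map′ (λ (es , _ , p) → es , p) short (search (λ es → dec v es) size)
    where
    dec : ∀ v es → Dec (Path v es v′)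
    dec v []       = v F.≟ v′
    dec v (e ∷ es) = (src e F.≟ v) ×-dec dec (tgt e) es
    ok : ∀ {u} es → Path u es v′ → Ok u es × aft u es ≡ v′
    ok []       refl    = tt , refl
    ok (e ∷ es) (s , p) = let o , a = ok es p in (s , o) , a
    path : ∀ {u} es → Ok u es → Path u es (aft u es)
    path []       _       = refl
    path (e ∷ es) (s , o) = s , path es o
    everywhere : ∀ u es → Sources (λ y → Any (y ≡_) (L.allFin size)) u es
    everywhere u []       = tt
    everywhere u (e ∷ es) = ∈-allFin u , everywhere (tgt e) es
    short : (∃ λ es → Path v es v′) → ∃ λ es → length es ≤ size × Path v es v′
    short (es , p) with ok es p
    ... | o , a with shorten size (L.allFin size) (≤-reflexive (L.length-tabulate {n = size} id)) v es o (everywhere v es)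
    ... | es′ , le , o′ , a′ = es′ , le , subst (Path v es′) (trans a′ a) (path es′ o′)

open Graph

-- Rackoff's bound on covering words

module Rackoff {d : ℕ} (G : Graph d) (B : ℕ) where

  module CG p = Coord (λ e → con G e p) (λ e → pro G e p)

  W : ℕ
  W = sum (λ e → sum (con G e))

  con≤W : ∀ p e → con G e p ≤ W
  con≤W p e = ≤-trans (≤-sum (con G e) p) (≤-sum (λ e → sum (con G e)) e)

  Conf : Set
  Conf = Fin (size G) × (Fin d → ℕ)

  Agree : ∀ {k} → (Fin k → Fin d) → (Fin d → ℕ) → (Fin d → ℕ) → Set
  Agree I m m′ = ∀ j → m (I j) ≡ m′ (I j)

  -- Only the coordinates listed by `I` can block a step or distinguish configurations; the others
  -- are updated by truncated subtraction and otherwise ignored.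
  module On {k : ℕ} (I : Fin k → Fin d) = Walks {Conf} {Fin (arcs G)}
    (λ (v , m) (v′ , m′) → v ≡ v′ × Agree I m m′)
    (refl , λ _ → refl) (λ (r , a) → sym r , sym ∘ a) (λ (r , a) (s , b) → trans r s , λ j → trans (a j) (b j))
    (λ (v , m) (v′ , m′) → (v F.≟ v′) ×-dec F.all? (λ j → m (I j) ≟ m′ (I j)))
    (λ (v , m) e → src G e ≡ v × (∀ j → con G e (I j) ≤ m (I j)))
    (λ (v , m) e → tgt G e , λ p → m p ∸ con G e p + pro G e p)
    (λ e (r , a) (s , le) → trans s r , λ j → ≤-trans (le j) (≤-reflexive (a j)))
    (λ e (r , a) → refl , λ j → cong (λ t → t ∸ con G e (I j) + pro G e (I j)) (a j))

  boxes# : ℕ → ℕ → ℕ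
  boxes# C zero    = 1
  boxes# C (suc k) = C * boxes# C k

  update : Fin d → ℕ → (Fin d → ℕ) → Fin d → ℕ
  update p c m p′ = if does (p F.≟ p′) then c else m p′

  layers : Fin d → ℕ → List (Fin d → ℕ) → List (Fin d → ℕ)
  layers p zero    ms = []
  layers p (suc C) ms = L.map (update p C) ms ++ layers p C ms

  boxes : ∀ C k → (Fin k → Fin d) → List (Fin d → ℕ)
  boxes C zero    I = (λ _ → 0) ∷ []
  boxes C (suc k) I = layers (I zero) C (boxes C k (I ∘ suc))

  length-layers : ∀ p C ms → length (layers p C ms) ≡ C * length ms
  length-layers p zero    ms = refl
  length-layers p (suc C) ms = trans (L.length-++ (L.map (update p C) ms))
    (cong₂ _+_ (L.length-map _ ms) (length-layers p C ms))

  length-boxes : ∀ C k I → length (boxes C k I) ≡ boxes# C k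
  length-boxes C zero    I = refl
  length-boxes C (suc k) I = trans (length-layers (I zero) C (boxes C k (I ∘ suc))) (cong (C *_) (length-boxes C k (I ∘ suc)))

  ∈-layers : ∀ p C {ms c m} → c < C → m ∈ ms → update p c m ∈ layers p C ms
  ∈-layers p (suc C) c<1+C m∈ with m≤n⇒m<n∨m≡n c<1+C
  ... | inj₁ (s≤s c<C) = ∈-++⁺ʳ _ (∈-layers p C c<C m∈)
  ... | inj₂ refl      = ∈-++⁺ˡ (∈-map⁺ (update p C) m∈)

  ∈-boxes : ∀ C k I m → (∀ j → m (I j) < C) → ∃ λ m′ → m′ ∈ boxes C k I × Agree I m m′
  ∈-boxes C zero    I m lt = (λ _ → 0) , here refl , λ ()
  ∈-boxes C (suc k) I m lt with ∈-boxes C k (I ∘ suc) m (lt ∘ suc)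
  ... | m′ , m′∈ , agree = _ , ∈-layers (I zero) C (lt zero) m′∈ , at
    where
    at : ∀ j → m (I j) ≡ update (I zero) (m (I zero)) m′ (I j)
    at j with I zero F.≟ I j
    at j       | yes eq = cong m (sym eq)
    at zero    | no neq = contradiction refl neq
    at (suc j) | no neq = agree j

  nodes : ∀ C k → (Fin k → Fin d) → List Conf
  nodes C k I = L.cartesianProduct (L.allFin (size G)) (boxes C k I)

  length-product : ∀ {A A′ : Set} (xs : List A) (ys : List A′) → length (L.cartesianProduct xs ys) ≡ length xs * length ys
  length-product []       ys = refl
  length-product (x ∷ xs) ys = trans (L.length-++ (L.map (x ,_) ys)) (cong₂ _+_ (L.length-map _ ys) (length-product xs ys))

  length-nodes : ∀ C k I → length (nodes C k I) ≡ size G * boxes# C k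
  length-nodes C k I = trans (length-product (L.allFin (size G)) (boxes C k I))
    (cong₂ _*_ (L.length-tabulate {n = size G} id) (length-boxes C k I))

  ∈-nodes : ∀ C k I {v m} → (∀ j → m (I j) < C) → Any (λ (v′ , m′) → v ≡ v′ × Agree I m m′) (nodes C k I)
  ∈-nodes C k I {v} {m} lt with ∈-boxes C k I m lt
  ... | m′ , m′∈ , agree = lose (∈-cartesianProduct⁺ (∈-allFin v) m′∈) (refl , agree)

  -- Rackoff's bounds: a coordinate that has reached cap (suc k) stays above B during the len k steps that
  -- bring the remaining k coordinates to B.
  cap len : ℕ → ℕ
  cap zero    = 0
  cap (suc k) = W * len k + B + cap k
  len zero    = 0
  len (suc k) = size G * boxes# (cap (suc k)) (suc k) + len k

  module _ {k : ℕ} (I : Fin (suc k) → Fin d) (C : ℕ) where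

    open On I

    -- Before the cut all coordinates are below `C`, so every coordinate that reaches `C` does so in
    -- the second part. This preserves the hypothesis for the recursion.
    first-exceeding : ∀ x es → Ok x es → (∀ j → CG.Exceeds (I j) C (proj₂ x (I j)) es) →
      ∃ λ es₁ → ∃ λ es₂ → Ok x es₁ × Sources (λ (v , m) → ∀ j → m (I j) < C) x es₁ ×
      (∃ λ j → C ≤ proj₂ (aft x es₁) (I j)) × Ok (aft x es₁) es₂ ×
      (∀ j → CG.Exceeds (I j) C (proj₂ (aft x es₁) (I j)) es₂)
    first-exceeding x es ok ex with F.any? (λ j → C ≤? proj₂ x (I j))
    ... | yes (j , le) = [] , es , tt , tt , (j , le) , ok , ex
    first-exceeding x []       ok ex | no none = contradiction (zero , ex zero) none
    first-exceeding x (e ∷ es) (p , ok) ex | no none =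
      let es₁ , es₂ , ok₁ , low , top , ok₂ , ex₂ =
            first-exceeding _ es ok (λ j → [ (λ le → contradiction (j , le) none) , id ]′ (ex j))
      in e ∷ es₁ , es₂ , (p , ok₁) , ((λ j → ≰⇒> (λ le → none (j , le))) , low) , top , ok₂ , ex₂

    -- One step consumes at most `W`, so the stock of coordinate `j` outlasts a word that was found
    -- while ignoring `j`.
    ok-extend : ∀ j x es {r} → On.Ok (I ∘ punchIn j) x es → W * length es + r ≤ proj₂ x (I j) →
      Ok x es × r ≤ proj₂ (aft x es) (I j) × aft x es ≡ On.aft (I ∘ punchIn j) x es
    ok-extend j x []       {r} ok le = tt , ≤-trans (m≤n+m r _) le , refl
    ok-extend j (v , m) (e ∷ es) {r} ((s , en) , ok) le =
      let ok′ , r≤ , eq = ok-extend j _ es ok le′ in ((s , en′) , ok′) , r≤ , eq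
      where
      p = I j
      first : con G e p + (W * length es + r) ≤ m p
      first = ≤-trans (+-monoˡ-≤ _ (con≤W p e))
        (≤-trans (≤-reflexive (trans (sym (+-assoc W _ r)) (cong (_+ r) (sym (*-suc W (length es)))))) le)
      le′ : W * length es + r ≤ m p ∸ con G e p + pro G e p
      le′ = m≤n⇒m≤n+o (pro G e p) (≤-trans (≤-reflexive (sym (m+n∸m≡n (con G e p) _))) (∸-monoˡ-≤ (con G e p) first))
      en′ : ∀ j′ → con G e (I j′) ≤ m (I j′)
      en′ j′ with j F.≟ j′
      ... | yes refl = m+n≤o⇒m≤o (con G e p) first
      ... | no  j≢j′ = subst (λ t → con G e (I t) ≤ m (I t)) (F.punchIn-punchOut j≢j′) (en (punchOut j≢j′))

  ok-forget : ∀ {k k′} (I : Fin k → Fin d) (κ : Fin k′ → Fin k) x es → On.Ok I x es → On.Ok (I ∘ κ) x es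
  ok-forget I κ x []       ok              = tt
  ok-forget I κ x (e ∷ es) ((s , en) , ok) = (s , en ∘ κ) , ok-forget I κ _ es ok

  -- Coordinates may reach the cap at different times; the conclusion is that a short word has all
  -- of them large at once. The part before the first excess is shortened inside a finite box;
  -- afterwards the coordinate `j` that reached the cap is dropped, and its stock pays for the
  -- recursively found rest.
  rackoff : ∀ k (I : Fin k → Fin d) x es → On.Ok I x es → (∀ j → CG.Exceeds (I j) (cap k) (proj₂ x (I j)) es) →
    ∃ λ es′ → length es′ ≤ len k × On.Ok I x es′ × (∀ j → B ≤ proj₂ (On.aft I x es′) (I j))
  rackoff zero    I x es ok ex = [] , z≤n , tt , λ ()
  rackoff (suc k) I x es ok ex with first-exceeding I (cap (suc k)) x es ok ex
  ... | es₁ , es₂ , ok₁ , low , (j , top) , ok₂ , ex₂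
    with On.shorten I (size G * boxes# (cap (suc k)) (suc k)) (nodes (cap (suc k)) (suc k) I)
           (≤-reflexive (length-nodes (cap (suc k)) (suc k) I)) x es₁ ok₁
           (On.sources-map I (λ {y} → ∈-nodes (cap (suc k)) (suc k) I {proj₁ y} {proj₂ y}) es₁ low)
       | rackoff k (I ∘ punchIn j) (On.aft I x es₁) es₂ (ok-forget I (punchIn j) _ es₂ ok₂)
           (λ j′ → CG.exceeds-mono (I (punchIn j j′)) (m≤n+m (cap k) _) _ es₂ (ex₂ (punchIn j j′)))
  ... | es₁′ , le₁ , ok₁′ , sim | es₂′ , le₂ , ok₂′ , top₂
    with ok-extend I (cap (suc k)) j (On.aft I x es₁) es₂′ ok₂′
           (≤-trans (+-monoˡ-≤ B (*-monoʳ-≤ W le₂)) (≤-trans (m≤m+n _ (cap k)) top))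
  ... | ok₃ , top₃ , eq =
    es₁′ ++ es₂′ , ≤-trans (≤-reflexive (L.length-++ es₁′)) (+-mono-≤ le₁ le₂) ,
    On.ok-++ I es₁′ ok₁′ (On.ok-resp I es₂′ (sym (proj₁ sim) , sym ∘ proj₂ sim) ok₃) , high
    where
    high₃ : ∀ j′ → B ≤ proj₂ (On.aft I (On.aft I x es₁) es₂′) (I j′)
    high₃ j′ with j F.≟ j′
    ... | yes refl = top₃
    ... | no  j≢j′ = subst (λ t → B ≤ proj₂ (On.aft I (On.aft I x es₁) es₂′) (I t)) (F.punchIn-punchOut j≢j′)
                       (subst (λ y → B ≤ proj₂ y (I (punchIn j (punchOut j≢j′)))) (sym eq) (top₂ (punchOut j≢j′)))
    high : ∀ j′ → B ≤ proj₂ (On.aft I x (es₁′ ++ es₂′)) (I j′)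
    high j′ = subst (λ y → B ≤ proj₂ y (I j′)) (sym (On.aft-++ I es₁′))
      (≤-trans (high₃ j′) (≤-reflexive (sym (proj₂ (On.aft-resp I es₂′ sim) j′))))

  module _ {k : ℕ} (I : Fin k → Fin d) where

    open On I

    ok⇒path : ∀ x es → Ok x es → Path G (proj₁ x) es (proj₁ (aft x es))
    ok⇒path x []       ok             = refl
    ok⇒path x (e ∷ es) ((s , _) , ok) = s , ok⇒path _ es ok

    ok⇒fir : ∀ x es → Ok x es → ∀ j → Fir G (I j) (proj₂ x (I j)) es (proj₂ (aft x es) (I j))
    ok⇒fir x []       ok              j = refl
    ok⇒fir x (e ∷ es) ((_ , en) , ok) j = en j , ok⇒fir _ es ok j

    fir⇒ok : ∀ v m es {v′} → Path G v es v′ → (∀ j → ∃ λ k → Fir G (I j) (m (I j)) es k) → Ok (v , m) es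
    fir⇒ok v m []       p       f = tt
    fir⇒ok v m (e ∷ es) (s , p) f =
      (s , λ j → proj₁ (proj₂ (f j))) , fir⇒ok _ _ es p (λ j → proj₁ (f j) , proj₂ (proj₂ (f j)))

-- Pumping or a bounded coordinate

module _ {d k : ℕ} (G : Graph d) (s : Fin (size G)) (κ : Fin d → ℕ) (I : Fin k → Fin d)
  (D : ℕ) (return : ∀ es v → Path G s es v → ∃ λ es′ → length es′ ≤ D × Path G v es′ s) where

  private
    W = Rackoff.W G 0
    -- `W * D` pays for the way back to `s`, and what remains exceeds every start value. `W` comes
    -- from the instance at 0 since it does not depend on the bound.
    B = W * D + suc (sum (κ ∘ I))

  open Rackoff G B hiding (W)
  open On I using (Ok; aft; ok-resp)

  Pumpable : Set
  Pumpable = ∃ λ u → Path G s u s × (∀ j → ∃ λ δ → Fir G (I j) (κ (I j)) u (κ (I j) + suc δ))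

  LowCoordinate : ℕ → Set
  LowCoordinate C = ∀ (m : Fin d → ℕ) es v → (∀ j → m (I j) ≡ κ (I j)) → Path G s es v →
    (∀ j → ∃ λ k′ → Fir G (I j) (m (I j)) es k′) → ∃ λ j → Low G (I j) C (m (I j)) es

  -- A covering word of length at most `len k`, closed by a return path, pumps. If there is none,
  -- the contrapositive of `rackoff` says that on every run from these values some coordinate never
  -- reaches `cap k`.
  pump : Pumpable ⊎ ∃ LowCoordinate
  pump with search covers? (len k)
    where
    ok? : ∀ x es → Dec (Ok x es)
    ok? x []             = yes tt
    ok? x@(v , m) (e ∷ es) = ((src G e F.≟ v) ×-dec F.all? (λ j → con G e (I j) ≤? m (I j))) ×-dec ok? _ es
    covers? : ∀ es → Dec (Ok (s , κ) es × (∀ j → B ≤ proj₂ (aft (s , κ) es) (I j)))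
    covers? es = ok? (s , κ) es ×-dec F.all? (λ j → B ≤? proj₂ (aft (s , κ) es) (I j))
  ... | yes (es , _ , ok , high) with return es _ (ok⇒path I (s , κ) es ok)
  ... | es′ , le , p = inj₁ (es ++ es′ , path-++ G es (ok⇒path I (s , κ) es ok) p , gain)
    where
    gain : ∀ j → ∃ λ δ → Fir G (I j) (κ (I j)) (es ++ es′) (κ (I j) + suc δ)
    gain j with CG.fir-forward (I j) (suc (κ (I j))) es′ {proj₂ (aft (s , κ) es) (I j)}
                  (≤-trans (+-mono-≤ (≤-trans (weight-≤ (con≤W (I j)) es′) (*-monoʳ-≤ W le)) (s≤s (≤-sum (κ ∘ I) j))) (high j))
    ... | k′ , f , lt = k′ ∸ suc (κ (I j)) , subst (Fir G (I j) (κ (I j)) (es ++ es′))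
            (trans (sym (m+[n∸m]≡n lt)) (sym (+-suc _ _))) (CG.fir-++ (I j) es (ok⇒fir I (s , κ) es ok j) f)
  pump | no none = inj₂ (cap k , low)
    where
    low : LowCoordinate (cap k)
    low m es v agree p f with F.any? low?
      where
      low? : ∀ j → Dec (Low G (I j) (cap k) (m (I j)) es)
      low? j = dec _ es
        where
        dec : ∀ c w → Dec (Low G (I j) (cap k) c w)
        dec c []      = c <? cap k
        dec c (e ∷ w) = (c <? cap k) ×-dec dec _ w
    ... | yes found = found
    ... | no  high  with rackoff k I (s , κ) es (ok-resp {s , m} {s , κ} es (refl , agree) (fir⇒ok I s m es p f)) exceeds
      where
      exceeds : ∀ j → CG.Exceeds (I j) (cap k) (κ (I j)) es
      exceeds j = subst (λ c → CG.Exceeds (I j) (cap k) c es) (agree j)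
        ([ (λ l → contradiction (j , l) high) , id ]′ (CG.low⊎exceeds (I j) (cap k) (m (I j)) es))
    ... | es′ , le , ok , top = contradiction (es′ , le , ok , top) none

-- Flows and Eulerian paths

δ : ∀ {n} → Fin n → Fin n → ℕ
δ i j = if does (i F.≟ j) then 1 else 0

δ-refl : ∀ {n} (i : Fin n) → δ i i ≡ 1
δ-refl i with i F.≟ i
... | yes _   = refl
... | no  i≢i = contradiction refl i≢i

δ-≢ : ∀ {n} {i j : Fin n} → i ≢ j → δ i j ≡ 0
δ-≢ {i = i} {j} i≢j with i F.≟ j
... | yes i≡j = contradiction i≡j i≢j
... | no  _   = refl

δ-suc : ∀ {n} (i j : Fin n) → δ (suc i) (suc j) ≡ δ i j
δ-suc i j with i F.≟ j
... | yes _ = refl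
... | no  _ = refl

δ-pos : ∀ {n} {i j : Fin n} → 0 < δ i j → i ≡ j
δ-pos {i = i} {j} lt with i F.≟ j
... | yes eq = eq

sum-δ : ∀ {n} (i : Fin n) (f : Fin n → ℕ) → sum (λ j → δ i j * f j) ≡ f i
sum-δ {suc n} zero f = trans (cong₂ _+_ (+-identityʳ (f zero)) (sum-zero {f = λ j → δ zero (suc j) * f (suc j)} (λ j → refl))) (+-identityʳ _)
sum-δ {suc n} (suc i) f = trans (sum-cong-≗ (λ j → cong (_* f (suc j)) (δ-suc i j))) (sum-δ i (f ∘ suc))

cnt : ∀ {n} → List (Fin n) → Fin n → ℕ
cnt es e = weight (λ i → δ i e) es

weight-cnt : ∀ {n} (f : Fin n → ℕ) es → weight f es ≡ sum (λ e → cnt es e * f e)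
weight-cnt {n} f []   = sym (sum-zero {n} {λ e → 0} (λ _ → refl))
weight-cnt f (i ∷ es) = sym (begin
  sum (λ e → (δ i e + cnt es e) * f e)                         ≡⟨ sum-cong-≗ (λ e → *-distribʳ-+ (f e) (δ i e) (cnt es e)) ⟩
  sum (λ e → δ i e * f e + cnt es e * f e)                     ≡⟨ ∑-distrib-+ (λ e → δ i e * f e) (λ e → cnt es e * f e) ⟩
  sum (λ e → δ i e * f e) + sum (λ e → cnt es e * f e)         ≡⟨ cong₂ _+_ (sum-δ i f) (sym (weight-cnt f es)) ⟩
  f i + weight f es                                            ∎)
  where open ≡-Reasoning

cnt-split : ∀ {n} es (e : Fin n) → 0 < cnt es e → ∃ λ es₁ → ∃ λ es₂ → es ≡ es₁ ++ e ∷ es₂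
cnt-split (i ∷ es) e lt with i F.≟ e
... | yes refl = [] , es , refl
... | no  _    = let es₁ , es₂ , eq = cnt-split es e lt in i ∷ es₁ , es₂ , cong (i ∷_) eq

remove-unit : ∀ {n} (c : Fin n → ℕ) e → 0 < c e → ∃ λ c′ → (∀ i → c i ≡ δ e i + c′ i) × sum c′ < sum c
remove-unit c e 0<ce = (λ i → c i ∸ δ e i) , (λ i → sym (m+[n∸m]≡n (unit≤ i))) ,
  sum-mono-< (λ i → m∸n≤m (c i) (δ e i)) e
    (subst (λ t → c e ∸ t < c e) (sym (δ-refl e)) (∸-monoʳ-< (s≤s z≤n) 0<ce))
  where
  unit≤ : ∀ i → δ e i ≤ c i
  unit≤ i with e F.≟ i
  ... | yes refl = 0<ce
  ... | no  _    = z≤n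

module Flows {d : ℕ} (G : Graph d) where

  into outof : (Fin (arcs G) → ℕ) → Fin (size G) → ℕ
  into  c v = sum (λ e → c e * δ (tgt G e) v)
  outof c v = sum (λ e → c e * δ (src G e) v)

  -- Kirchhoff's law for one unit sent from `s` to `t`, free of subtraction.
  record Flow (c : Fin (arcs G) → ℕ) (s t : Fin (size G)) : Set where
    constructor flow
    field balance : ∀ v → into c v + δ s v ≡ outof c v + δ t v

  record Circulation (c : Fin (arcs G) → ℕ) : Set where
    constructor circ
    field balance : ∀ v → into c v ≡ outof c v

  open Flow
  open Circulation

  sum-⊞ : ∀ {n} (a b f : Fin n → ℕ) → sum (λ e → (a ⊞ b) e * f e) ≡ sum (λ e → a e * f e) + sum (λ e → b e * f e)
  sum-⊞ a b f = trans (sum-cong-≗ (λ e → *-distribʳ-+ (f e) (a e) (b e))) (∑-distrib-+ (λ e → a e * f e) (λ e → b e * f e))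

  flow-cong : ∀ {c c′ s t} → c ≗ c′ → Flow c s t → Flow c′ s t
  flow-cong {c} {c′} {s} {t} eq φ = flow λ v → trans (cong (_+ δ s v) (sum-cong-≗ (λ e → cong (_* δ (tgt G e) v) (sym (eq e)))))
    (trans (balance φ v) (cong (_+ δ t v) (sum-cong-≗ (λ e → cong (_* δ (src G e) v) (eq e)))))

  flow-⊞ : ∀ a b {s u t} → Flow a s u → Flow b u t → Flow (a ⊞ b) s t
  flow-⊞ a b {s} {u} {t} α β = flow λ v → begin
    into (a ⊞ b) v + δ s v          ≡⟨ cong (_+ δ s v) (sum-⊞ a b _) ⟩
    into a v + into b v + δ s v     ≡⟨ ring (into a v) (into b v) (δ s v) ⟩
    into b v + (into a v + δ s v)   ≡⟨ cong (into b v +_) (balance α v) ⟩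
    into b v + (outof a v + δ u v)  ≡⟨ ring (outof a v) (into b v) (δ u v) ⟨
    outof a v + into b v + δ u v    ≡⟨ +-assoc (outof a v) _ _ ⟩
    outof a v + (into b v + δ u v)  ≡⟨ cong (outof a v +_) (balance β v) ⟩
    outof a v + (outof b v + δ t v) ≡⟨ +-assoc (outof a v) _ _ ⟨
    outof a v + outof b v + δ t v   ≡⟨ cong (_+ δ t v) (sum-⊞ a b _) ⟨
    outof (a ⊞ b) v + δ t v         ∎
    where
    open ≡-Reasoning
    ring : ∀ a b c → a + b + c ≡ b + (a + c)
    ring = solve-∀

  flow-∖ : ∀ a b {s u t} → Flow (a ⊞ b) s t → Flow a s u → Flow b u t
  flow-∖ a b {s} {u} {t} φ α = flow λ v → +-cancelˡ-≡ (outof a v) _ _ (begin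
    outof a v + (into b v + δ u v)  ≡⟨ ring (outof a v) (into b v) (δ u v) ⟩
    into b v + (outof a v + δ u v)  ≡⟨ cong (into b v +_) (balance α v) ⟨
    into b v + (into a v + δ s v)   ≡⟨ ring′ (into b v) (into a v) (δ s v) ⟩
    into a v + into b v + δ s v     ≡⟨ cong (_+ δ s v) (sum-⊞ a b _) ⟨
    into (a ⊞ b) v + δ s v          ≡⟨ balance φ v ⟩
    outof (a ⊞ b) v + δ t v         ≡⟨ cong (_+ δ t v) (sum-⊞ a b _) ⟩
    outof a v + outof b v + δ t v   ≡⟨ +-assoc (outof a v) _ _ ⟩
    outof a v + (outof b v + δ t v) ∎)
    where
    open ≡-Reasoning
    ring : ∀ a b c → a + (b + c) ≡ b + (a + c)
    ring = solve-∀
    ring′ : ∀ a b c → a + (b + c) ≡ b + a + c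
    ring′ = solve-∀

  circulation⇒flow : ∀ {c} → Circulation c → ∀ v → Flow c v v
  circulation⇒flow κ u = flow λ v → cong (_+ δ u v) (balance κ v)

  flow⇒circulation : ∀ {c} u → Flow c u u → Circulation c
  flow⇒circulation u φ = circ λ v → +-cancelʳ-≡ (δ u v) _ _ (balance φ v)

  path⇒flow : ∀ es {s t} → Path G s es t → Flow (cnt es) s t
  path⇒flow es {s} {t} p = flow λ v → trans (cong (_+ δ s v) (sym (weight-cnt _ es))) (trans (go v es p) (cong (_+ δ t v) (weight-cnt _ es)))
    where
    ring : ∀ a b c → a + b + c ≡ c + (b + a)
    ring = solve-∀
    go : ∀ v es {s} → Path G s es t → weight (λ e → δ (tgt G e) v) es + δ s v ≡ weight (λ e → δ (src G e) v) es + δ t v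
    go v []       refl       = refl
    go v (e ∷ es) (refl , p) = trans (ring (δ (tgt G e) v) _ (δ (src G e) v))
      (trans (cong (δ (src G e) v +_) (go v es p)) (sym (+-assoc (δ (src G e) v) _ _)))

  -- At a vertex other than `t` the balance forces an arc with positive count to leave; removing
  -- that arc leaves a flow from its target and lowers the sum. The rest `r` consists of what was
  -- not met before reaching `t`.
  walk : ∀ N c {s t} → sum c ≤ N → Flow c s t →
    ∃ λ π → ∃ λ r → Path G s π t × (∀ e → c e ≡ cnt π e + r e) × sum r ≤ sum c
  walk N c {s} {t} le φ with s F.≟ t
  ... | yes refl = [] , c , refl , (λ _ → refl) , ≤-refl
  ... | no  s≢t  with sum-pos (λ e → c e * δ (src G e) s) leaves
    where
    leaves : 0 < outof c s
    leaves = ≤-trans (m≤n+m 1 (into c s)) (≤-reflexive (trans (cong (into c s +_) (sym (δ-refl s)))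
      (trans (balance φ s) (trans (cong (outof c s +_) (δ-≢ (s≢t ∘ sym))) (+-identityʳ _)))))
  ... | e , lt with c e in eq
  ...   | zero  = contradiction lt λ ()
  ...   | suc k with remove-unit c e (subst (0 <_) (sym eq) (s≤s z≤n))
  walk zero    c {s} {t} le φ | no s≢t | e , lt | suc k | c′ , split , smaller = contradiction (≤-trans smaller le) λ ()
  walk (suc N) c {s} {t} le φ | no s≢t | e , lt | suc k | c′ , split , smaller
    with src≡s ← δ-pos {i = src G e} {s} (n≢0⇒n>0 (λ z → contradiction (≤-trans lt (≤-reflexive (trans (cong (suc k *_) z) (*-zeroʳ (suc k))))) λ ()))
    with walk N c′ {tgt G e} {t} (≤-pred (≤-trans smaller le))
           (flow-∖ (δ e) c′ (flow-cong split φ) (flow-cong (λ i → +-identityʳ (δ e i)) (path⇒flow (e ∷ []) (src≡s , refl))))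
  ... | π , r , p , split′ , le′ = e ∷ π , r , (src≡s , p) ,
        (λ i → trans (split i) (trans (cong (δ e i +_) (split′ i)) (sym (+-assoc (δ e i) _ _)))) ,
        ≤-trans le′ (<⇒≤ smaller)

  -- Without one copy of `e`, the circulation is a flow from the target of `e` back to its source,
  -- and `walk` turns this into a path.
  circuit : ∀ c → Circulation c → ∀ e → 0 < c e →
    ∃ λ π → ∃ λ r → Path G (tgt G e) π (src G e) × (∀ i → c i ≡ cnt (e ∷ π) i + r i) × sum r < sum c
  circuit c κ e lt with remove-unit c e lt
  ... | c′ , split , smaller
    with walk (sum c′) c′ {tgt G e} {src G e} ≤-refl
           (flow-∖ (δ e) c′ (flow-cong split (circulation⇒flow κ (src G e)))
                            (flow-cong (λ i → +-identityʳ (δ e i)) (path⇒flow (e ∷ []) (refl , refl))))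
  ... | π , r , p , split′ , le = π , r , p ,
        (λ i → trans (split i) (trans (cong (δ e i +_) (split′ i)) (sym (+-assoc (δ e i) _ _)))) ,
        <-≤-trans (s≤s le) smaller

  -- The circulation r is consumed circuit by circuit, each spliced into the path at an arc it shares with it.
  euler : ∀ N ρ r {s t} → sum r ≤ N → Path G s ρ t → (∀ e → 0 < cnt ρ e) → Circulation r →
    ∃ λ ρ′ → Path G s ρ′ t × (∀ e → cnt ρ′ e ≡ cnt ρ e + r e)
  euler N ρ r le p visits κ with F.any? (λ e → 0 <? r e)
  ... | no none = ρ , p , λ e → sym (trans (cong (cnt ρ e +_) (n≤0⇒n≡0 (≮⇒≥ (λ lt → none (e , lt))))) (+-identityʳ _))
  ... | yes (e , lt) with circuit r κ e lt | cnt-split ρ e (visits e)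
  euler zero    ρ r le p visits κ | yes (e , lt) | π , r′ , q , split , smaller | _ =
    contradiction (≤-trans smaller le) λ ()
  euler (suc N) ρ r {s} {t} le p visits κ | yes (e , lt) | π , r′ , q , split , smaller | ρ₁ , ρ₂ , refl
    with path-split G ρ₁ p
  ... | v , p₁ , refl , p₂
    with euler N (ρ₁ ++ (e ∷ π) ++ (e ∷ ρ₂)) r′ (≤-pred (≤-trans smaller le))
           (path-++ G ρ₁ p₁ (path-++ G (e ∷ π) (refl , q) (refl , p₂)))
           (λ i → ≤-trans (visits i) (≤-trans (m≤n+m _ (cnt (e ∷ π) i)) (≤-reflexive (sym (count i)))))
           (flow⇒circulation (src G e) (flow-∖ (cnt (e ∷ π)) r′ (flow-cong split (circulation⇒flow κ (src G e)))
                                          (path⇒flow (e ∷ π) (refl , q))))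
    where
    ring : ∀ a b c → a + (b + c) ≡ b + (a + c)
    ring = solve-∀
    count : ∀ i → cnt (ρ₁ ++ (e ∷ π) ++ (e ∷ ρ₂)) i ≡ cnt (e ∷ π) i + cnt (ρ₁ ++ e ∷ ρ₂) i
    count i = trans (weight-++ _ ρ₁ _) (trans (cong (cnt ρ₁ i +_) (weight-++ _ (e ∷ π) (e ∷ ρ₂)))
      (trans (ring (cnt ρ₁ i) (cnt (e ∷ π) i) _) (cong (cnt (e ∷ π) i +_) (sym (weight-++ _ ρ₁ (e ∷ ρ₂))))))
  ... | ρ′ , p′ , total′ = ρ′ , p′ , λ i → trans (total′ i) (trans (cong (_+ r′ i) (count i))
        (trans (ring (cnt (e ∷ π) i) _ (r′ i)) (cong (cnt (ρ₁ ++ e ∷ ρ₂) i +_) (sym (split i)))))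
    where
    ring : ∀ a b c → a + b + c ≡ b + (a + c)
    ring = solve-∀
    count : ∀ i → cnt (ρ₁ ++ (e ∷ π) ++ (e ∷ ρ₂)) i ≡ cnt (e ∷ π) i + cnt (ρ₁ ++ e ∷ ρ₂) i
    count i = trans (weight-++ _ ρ₁ _) (trans (cong (cnt ρ₁ i +_) (weight-++ _ (e ∷ π) (e ∷ ρ₂)))
      (trans (ring′ (cnt ρ₁ i) (cnt (e ∷ π) i) _) (cong (cnt (e ∷ π) i +_) (sym (weight-++ _ ρ₁ (e ∷ ρ₂))))))
      where
      ring′ : ∀ a b c → a + (b + c) ≡ b + (a + c)
      ring′ = solve-∀

  module _ (c : Fin (arcs G) → ℕ) (κ : Circulation c) (positive : ∀ e → 0 < c e) where

    -- Under a positive circulation every arc lies on a circuit, so each step of a path can be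
    -- undone. This stands in for strong connectivity.
    go-back : ∀ es {s v} → Path G s es v → ∃ λ es′ → Path G v es′ s
    go-back []       refl       = [] , refl
    go-back (e ∷ es) (refl , p) =
      let es₁ , p₁ = go-back es p
          π , _ , q , _ = circuit c κ e (positive e)
      in es₁ ++ π , path-++ G es₁ p₁ q

    return-within : ∀ s → ∃ λ D → ∀ es v → Path G s es v → ∃ λ es′ → length es′ ≤ D × Path G v es′ s
    return-within s = sum (cost ∘ back?) , λ es v p →
      let es′ , le , q = cheapest (back? v) (go-back es p) in es′ , ≤-trans le (≤-sum (cost ∘ back?) v) , q
      where
      back? : ∀ v → Dec (∃ λ es → Path G v es s)
      back? v = path? G v s
      cost : ∀ {v} → Dec (∃ λ es → Path G v es s) → ℕ
      cost (yes (es , _)) = length es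
      cost (no _)         = 0
      cheapest : ∀ {v} (b : Dec (∃ λ es → Path G v es s)) → (∃ λ es → Path G v es s) →
                 ∃ λ es → length es ≤ cost b × Path G v es s
      cheapest (yes (es , p)) _ = es , ≤-refl , p
      cheapest (no ¬p)        p = contradiction p ¬p

    -- Supplies the path that `euler` needs: a circuit can be spliced in only at a shared arc, hence
    -- every arc has to occur.
    tour : ∀ s → (∀ e → ∃ λ es → Path G s es (src G e)) → ∃ λ γ → Path G s γ s × (∀ e → 0 < cnt γ e)
    tour s reach = let γ , p , visits = over (L.allFin (arcs G)) in γ , p , λ e → visits e (∈-allFin e)
      where
      over : ∀ es → ∃ λ γ → Path G s γ s × (∀ e → e ∈ es → 0 < cnt γ e)
      over []       = [] , refl , λ _ ()
      over (e ∷ es) with over es | reach e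
      ... | γ , p , visits | π , q with go-back (π ++ e ∷ []) (path-++ G π q (refl , refl))
      ... | β , q′ = (π ++ e ∷ β) ++ γ , path-++ G (π ++ e ∷ β) (path-++ G π q (refl , q′)) p , visits′
        where
        visits′ : ∀ i → i ∈ (e ∷ es) → 0 < cnt ((π ++ e ∷ β) ++ γ) i
        visits′ i i∈ = ≤-trans (at i∈) (≤-reflexive (sym (trans (weight-++ _ (π ++ e ∷ β) γ)
          (cong (_+ cnt γ i) (weight-++ _ π (e ∷ β))))))
          where
          at : i ∈ (e ∷ es) → 0 < cnt π i + (δ e i + cnt β i) + cnt γ i
          at (here refl) = m≤n⇒m≤n+o (cnt γ i) (m≤n⇒m≤o+n (cnt π i) (m≤n⇒m≤n+o (cnt β i) (≤-reflexive (sym (δ-refl e)))))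
          at (there i∈′) = m≤n⇒m≤o+n (cnt π i + (δ e i + cnt β i)) (visits i i∈′)

reverseG : ∀ {d} → Graph d → Graph d
reverseG G = record { size = size G ; arcs = arcs G ; src = tgt G ; tgt = src G ; con = pro G ; pro = con G }

path-reverse : ∀ {d} (G : Graph d) es {u v} → Path G u es v → Path (reverseG G) v (L.reverse es) u
path-reverse G []       refl       = refl
path-reverse G (e ∷ es) (refl , p) = subst (λ w → Path (reverseG G) _ w _) (sym (L.unfold-reverse e es))
  (path-++ (reverseG G) (L.reverse es) (path-reverse G es p) (refl , refl))

-- Sequences of components

-- Along every path of the graph the rigid coordinates are determined by the current vertex; nothing in
-- entry or exit leaves the coordinate unconstrained there.
record Comp (d : ℕ) : Set where
  field
    graph      : Graph d
    rigid      : Fin d → Bool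
    value      : Fin (size graph) → Fin d → ℕ
    coherent   : ∀ e p → rigid p ≡ true → con graph e p ≤ value (src graph e) p ×
                 value (src graph e) p ∸ con graph e p + pro graph e p ≡ value (tgt graph e) p
    start end  : Fin (size graph)
    entry exit : Fin d → Maybe ℕ

  rigid-fir : ∀ es {u v p} → rigid p ≡ true → Path graph u es v → Fir graph p (value u p) es (value v p)
  rigid-fir []       r refl       = refl
  rigid-fir (e ∷ es) {v = v} {p = p} r (refl , q) = let le , eq = coherent e p r in
    le , subst (λ k → Fir graph p k es (value v p)) (sym eq) (rigid-fir es r q)

open Comp

Fits : Maybe ℕ → ℕ → Set
Fits nothing  k = ⊤
Fits (just j) k = k ≡ j

record CRun {d} (c : Comp d) (m m′ : Fin d → ℕ) (es : List (Fin (arcs (graph c)))) : Set where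
  field
    path       : Path (graph c) (start c) es (end c)
    fires      : ∀ p → Fir (graph c) p (m p) es (m′ p)
    fits-entry : ∀ p → Fits (entry c p) (m p)
    fits-exit  : ∀ p → Fits (exit c p) (m′ p)
    fits-rigid : ∀ p → rigid c p ≡ true → m p ≡ value c (start c) p

open CRun

-- A link removes `α` and adds `β`, as a single firing would. In `Run` the remainder `z` common to
-- both sides expresses this by two additions.
data Chain (d : ℕ) : Set where
  one  : Comp d → Chain d
  cons : Comp d → (α β : Fin d → ℕ) → Chain d → Chain d

Run : ∀ {d} → Chain d → (m m′ : Fin d → ℕ) → Set
Run (one c)        m m′ = ∃ (CRun c m m′)
Run {d} (cons c α β ξ) m m′ = ∃ λ (m₁ : Fin d → ℕ) → ∃ λ (z : Fin d → ℕ) → ∃ λ (m₂ : Fin d → ℕ) →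
  ∃ (CRun c m m₁) × (∀ p → m₁ p ≡ z p + α p) × (∀ p → m₂ p ≡ z p + β p) × Run ξ m₂ m′

CVar : ∀ {d} → Comp d → Set
CVar {d} c = Fin d ⊎ (Fin d ⊎ Fin (arcs (graph c)))

pattern vin p  = inj₁ p
pattern vout p = inj₂ (inj₁ p)
pattern varc e = inj₂ (inj₂ e)

Var : ∀ {d} → Chain d → Set
Var     (one c)        = CVar c
Var {d} (cons c α β ξ) = CVar c ⊎ (Fin d ⊎ Var ξ)

enum-Var : ∀ {d} (ξ : Chain d) → Enum (Var ξ)
enum-CVar : ∀ {d} (c : Comp d) → Enum (CVar c)
enum-CVar c = enum-⊎ (enum-Fin _) (enum-⊎ (enum-Fin _) (enum-Fin _))
enum-Var (one c)        = enum-CVar c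
enum-Var (cons c α β ξ) = enum-⊎ (enum-CVar c) (enum-⊎ (enum-Fin _) (enum-Var ξ))

first-in : ∀ {d} (ξ : Chain d) → Fin d → Var ξ
first-in (one c)        p = vin p
first-in (cons c α β ξ) p = inj₁ (vin p)

fitS : ∀ {I} → Maybe ℕ → I → Sys I
fitS nothing  i = topS
fitS (just k) i = eqS (varL i) 0 zeroL k

rigidS : ∀ {I} → Bool → I → ℕ → Sys I
rigidS false i k = topS
rigidS true  i k = eqS (varL i) 0 zeroL k

module _ {d} (c : Comp d) where

  private G = graph c

  effectS : Fin d → Sys (CVar c)
  effectS p = eqS (varL (vin p) ⊕ weighL varc (λ e → pro G e p)) 0 (varL (vout p) ⊕ weighL varc (λ e → con G e p)) 0

  flowS : Fin (size G) → Sys (CVar c)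
  flowS v = eqS (weighL varc (λ e → δ (tgt G e) v)) (δ (start c) v) (weighL varc (λ e → δ (src G e) v)) (δ (end c) v)

  -- State equation, flow balance and prescribed values. Rigidity is imposed only at the entry,
  -- because coherence carries it along the path.
  csys : Sys (CVar c)
  csys = andS (allS effectS) (andS (allS flowS) (andS (allS (λ p → fitS (entry c p) (vin p)))
    (andS (allS (λ p → fitS (exit c p) (vout p))) (allS (λ p → rigidS (rigid c p) (vin p) (value c (start c) p))))))

  casg : (m m′ : Fin d → ℕ) → List (Fin (arcs G)) → Asg (CVar c)
  casg m m′ es (vin p)  = m p
  casg m m′ es (vout p) = m′ p
  casg m m′ es (varc e) = cnt es e

sys : ∀ {d} (ξ : Chain d) → Sys (Var ξ)
sys (one c)        = csys c
sys (cons c α β ξ) = andS (viaS inj₁ (csys c))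
  (andS (allS (λ p → eqS (varL (inj₁ (vout p))) 0 (varL (inj₂ (inj₁ p))) (α p)))
  (andS (allS (λ p → eqS (varL (inj₂ (inj₂ (first-in ξ p)))) 0 (varL (inj₂ (inj₁ p))) (β p)))
        (viaS (λ i → inj₂ (inj₂ i)) (sys ξ))))

asg : ∀ {d} (ξ : Chain d) {m m′} → Run ξ m m′ → Asg (Var ξ)
asg (one c)        {m} {m′} (es , _)                          i               = casg c m m′ es i
asg (cons c α β ξ) {m}      (m₁ , z , m₂ , (es , _) , _ , _ , r) (inj₁ i)        = casg c m m₁ es i
asg (cons c α β ξ)          (m₁ , z , m₂ , _ , _ , _ , r)        (inj₂ (inj₁ p)) = z p
asg (cons c α β ξ)          (m₁ , z , m₂ , _ , _ , _ , r)        (inj₂ (inj₂ i)) = asg ξ r i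

asg-first : ∀ {d} (ξ : Chain d) {m m′} (r : Run ξ m m′) p → asg ξ r (first-in ξ p) ≡ m p
asg-first (one c)        r p = refl
asg-first (cons c α β ξ) r p = refl

crun⇒csys : ∀ {d} (c : Comp d) {m m′ es} → CRun c m m′ es → ⟦ csys c ⟧ (casg c m m′ es)
crun⇒csys c {m} {m′} {es} r = effect , (λ v → Flows.Flow.balance (Flows.path⇒flow G es (path r)) v) ,
  (λ p → fit (entry c p) (fits-entry r p)) , (λ p → fit (exit c p) (fits-exit r p)) , λ p → rig (rigid c p) {vin p} (fits-rigid r p)
  where
  G = graph c
  effect : ∀ p → m p + sum (λ e → cnt es e * pro G e p) + 0 ≡ m′ p + sum (λ e → cnt es e * con G e p) + 0
  effect p = cong (_+ 0) (trans (cong (m p +_) (sym (weight-cnt (λ e → pro G e p) es)))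
    (trans (Coord.fir-effect _ _ es (fires r p)) (cong (m′ p +_) (weight-cnt (λ e → con G e p) es))))
  fit : ∀ f {i} → Fits f (casg c m m′ es i) → ⟦ fitS f i ⟧ (casg c m m′ es)
  fit nothing  _  = tt
  fit (just k) eq = trans (+-identityʳ _) eq
  rig : ∀ b {i k} → (b ≡ true → casg c m m′ es i ≡ k) → ⟦ rigidS b i k ⟧ (casg c m m′ es)
  rig false _  = tt
  rig true  eq = trans (+-identityʳ _) (eq refl)

run⇒sys : ∀ {d} (ξ : Chain d) {m m′} (r : Run ξ m m′) → ⟦ sys ξ ⟧ (asg ξ r)
run⇒sys (one c)        (es , r) = crun⇒csys c r
run⇒sys (cons c α β ξ) (m₁ , z , m₂ , (es , q) , link₁ , link₂ , r) =
  crun⇒csys c q , (λ p → trans (+-identityʳ _) (link₁ p)) ,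
  (λ p → trans (+-identityʳ _) (trans (asg-first ξ r p) (link₂ p))) , run⇒sys ξ r

-- The termination order

Rank : Set
Rank = ℕ × ℕ × ℕ

_⊏_ : Rank → Rank → Set
_⊏_ = ×-Lex _≡_ _<_ (×-Lex _≡_ _<_ _<_)

⊏-wellFounded : WellFounded _⊏_
⊏-wellFounded = ×-wellFounded <-wellFounded (×-wellFounded <-wellFounded <-wellFounded)

-- The one-step multiset order, kept on lists because the position in the chain matters.
data _≺_ : List Rank → List Rank → Set where
  here  : ∀ {x xs ys} → All (_⊏ x) ys → (ys ++ xs) ≺ (x ∷ xs)
  there : ∀ {x xs xs′} → xs′ ≺ xs → (x ∷ xs′) ≺ (x ∷ xs)

-- Induction on the head rank and, within it, on the tail: replacing the head puts finitely many
-- smaller heads in front of the same tail.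
≺-wellFounded : WellFounded _≺_
≺-wellFounded []       = acc λ ()
≺-wellFounded (x ∷ xs) = add (⊏-wellFounded x) (≺-wellFounded xs)
  where
  add   : ∀ {x xs} → Acc _⊏_ x → Acc _≺_ xs → Acc _≺_ (x ∷ xs)
  below : ∀ {x xs} → Acc _⊏_ x → Acc _≺_ xs → ∀ {zs} → zs ≺ (x ∷ xs) → Acc _≺_ zs
  adds  : ∀ {x ys xs} → Acc _⊏_ x → All (_⊏ x) ys → Acc _≺_ xs → Acc _≺_ (ys ++ xs)
  add ax axs = acc (below ax axs)
  below ax axs       (here lts) = adds ax lts axs
  below ax (acc rxs) (there lt) = add ax (rxs lt)
  adds ax       []         axs = axs
  adds (acc rx) (lt ∷ lts) axs = add (rx lt) (adds (acc rx) lts axs)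

flag : Bool → ℕ
flag true  = 0
flag false = 1

open-ended : Maybe ℕ → ℕ
open-ended nothing  = 1
open-ended (just _) = 0

-- The order of the entries reflects what each refinement spoils: making a coordinate rigid may
-- multiply the arcs, removing an arc creates open values at the new links, and fixing a value
-- changes nothing else.
rank : ∀ {d} → Comp d → Rank
rank c = sum (flag ∘ rigid c) , arcs (graph c) , sum (λ p → open-ended (entry c p) + open-ended (exit c p))

ranks : ∀ {d} → Chain d → List Rank
ranks (one c)        = rank c ∷ []
ranks (cons c α β ξ) = rank c ∷ ranks ξ

-- Refinements of a component

-- `Q` is a bound known for the runs of interest. Only completeness may rely on it; soundness must
-- not, or the alternatives could add runs.
record Refinement {d} (c : Comp d) (Q : (m m′ : Fin d → ℕ) → List (Fin (arcs (graph c))) → Set) : Set where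
  field
    alts     : List (Chain d)
    smaller  : All (λ ξ → All (_⊏ rank c) (ranks ξ)) alts
    sound    : All (λ ξ → ∀ m m′ → Run ξ m m′ → ∃ (CRun c m m′)) alts
    complete : ∀ m m′ es → CRun c m m′ es → Q m m′ es → Any (λ ξ → Run ξ m m′) alts

open Refinement

module _ {d} {c : Comp d} where

  refine-⊆ : ∀ {Q Q′ : (m m′ : Fin d → ℕ) → List (Fin (arcs (graph c))) → Set} →
    (∀ m m′ es → CRun c m m′ es → Q′ m m′ es → Q m m′ es) → Refinement c Q → Refinement c Q′
  refine-⊆ imp r = record
    { alts     = alts r
    ; smaller  = smaller r
    ; sound    = sound r
    ; complete = λ m m′ es run q → complete r m m′ es run (imp m m′ es run q)
    }

  refine-⋃ : ∀ {k} {Q : Fin k → (m m′ : Fin d → ℕ) → List (Fin (arcs (graph c))) → Set} →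
    (∀ j → Refinement c (Q j)) → Refinement c (λ m m′ es → ∃ λ j → Q j m m′ es)
  refine-⋃ {zero}  r = record { alts = [] ; smaller = [] ; sound = [] ; complete = λ { m m′ es run (() , _) } }
  refine-⋃ {suc k} r = let rs = refine-⋃ (r ∘ suc) in record
    { alts     = alts (r zero) ++ alts rs
    ; smaller  = All.++⁺ (smaller (r zero)) (smaller rs)
    ; sound    = All.++⁺ (sound (r zero)) (sound rs)
    ; complete = λ { m m′ es run (zero  , q) → Any.++⁺ˡ (complete (r zero) m m′ es run q)
                   ; m m′ es run (suc j , q) → Any.++⁺ʳ (alts (r zero)) (complete rs m m′ es run (j , q)) }
    }

module _ {E E′ : Set} {con pro : E → ℕ} (π : E′ → E) where

  fir-map : ∀ w {k k′} → Coord.Fir (con ∘ π) (pro ∘ π) k w k′ → Coord.Fir con pro k (L.map π w) k′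
  fir-map []      refl    = refl
  fir-map (e ∷ w) (p , f) = p , fir-map w f

  fir-unmap : ∀ w {k k′} → Coord.Fir con pro k (L.map π w) k′ → Coord.Fir (con ∘ π) (pro ∘ π) k w k′
  fir-unmap []      refl    = refl
  fir-unmap (e ∷ w) (p , f) = p , fir-unmap w f

fir-unique : ∀ {E : Set} {con pro : E → ℕ} w {k k₁ k₂} → Coord.Fir con pro k w k₁ → Coord.Fir con pro k w k₂ → k₁ ≡ k₂
fir-unique []      refl    refl    = refl
fir-unique (e ∷ w) (_ , f) (_ , g) = fir-unique w f g

-- Unrolling arcs, fixing values, making coordinates rigid

module _ {d} (c : Comp d) where

  private G = graph c

  restrictG : ∀ {n} → (Fin n → Fin (arcs G)) → Graph d
  restrictG {n} π = record
    { size = size G ; arcs = n ; src = src G ∘ π ; tgt = tgt G ∘ π ; con = con G ∘ π ; pro = pro G ∘ π }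

  restrict : ∀ {n} → (Fin n → Fin (arcs G)) → (s t : Fin (size G)) → (f f′ : Fin d → Maybe ℕ) → Comp d
  restrict π s t f f′ = record
    { graph    = restrictG π
    ; rigid    = rigid c
    ; value    = value c
    ; coherent = coherent c ∘ π
    ; start    = s
    ; end      = t
    ; entry    = f
    ; exit     = f′
    }

  enter : Fin (size G) → (Fin d → Maybe ℕ) → Comp d
  enter s f = record c { start = s ; entry = f }

  module _ {n} (π : Fin n → Fin (arcs G)) where

    restrict-path : ∀ es {s t} → Path (restrictG π) s es t → Path G s (L.map π es) t
    restrict-path []       refl    = refl
    restrict-path (e ∷ es) (r , p) = r , restrict-path es p

    unrestrict-path : ∀ es {s t} → Path G s (L.map π es) t → Path (restrictG π) s es t
    unrestrict-path []       refl    = refl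
    unrestrict-path (e ∷ es) (r , p) = r , unrestrict-path es p

  module Unroll (e : Fin (arcs G)) where

    other? = λ i → ¬? (e F.≟ i)

    kept : List (Fin (arcs G))
    kept = L.filter other? (L.allFin (arcs G))

    π : Fin (length kept) → Fin (arcs G)
    π = L.lookup kept

    fewer : length kept < arcs G
    fewer = ≤-trans (L.filter-notAll other? (L.allFin (arcs G)) (lose (∈-allFin e) (λ ne → ne refl)))
                    (≤-reflexive (L.length-tabulate {n = arcs G} id))

    -- An arc used at most `B` times cuts a run into at most `B + 1` segments that avoid it. Each
    -- use becomes a link, and the values next to it are left open.
    unroll unroll⁺ : ℕ → Fin (size G) → (Fin d → Maybe ℕ) → List (Chain d)
    unroll B s f = one (restrict π s (end c) f (exit c)) ∷ unroll⁺ B s f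
    unroll⁺ zero    s f = []
    unroll⁺ (suc B) s f = L.map (cons (restrict π s (src G e) f (λ _ → nothing)) (con G e) (pro G e))
                                (unroll B (tgt G e) (λ _ → nothing))

    unroll-smaller : ∀ B s f → All (λ ξ → All (_⊏ rank c) (ranks ξ)) (unroll B s f)
    unroll-smaller zero    s f = (inj₂ (refl , inj₁ fewer) ∷ []) ∷ []
    unroll-smaller (suc B) s f = (inj₂ (refl , inj₁ fewer) ∷ []) ∷
      All.map⁺ (All.map (inj₂ (refl , inj₁ fewer) ∷_) (unroll-smaller B (tgt G e) (λ _ → nothing)))

    unroll-sound : ∀ B s f → All (λ ξ → ∀ m m′ → Run ξ m m′ → ∃ (CRun (enter s f) m m′)) (unroll B s f)
    unroll-sound B s f = last ∷ rest B
      where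
      last : ∀ m m′ → _ → ∃ (CRun (enter s f) m m′)
      last m m′ (es , r) = L.map π es , record
        { path       = restrict-path π es (path r)
        ; fires      = λ p → fir-map π es (fires r p)
        ; fits-entry = fits-entry r
        ; fits-exit  = fits-exit r
        ; fits-rigid = fits-rigid r
        }
      rest : ∀ B → All (λ ξ → ∀ m m′ → Run ξ m m′ → ∃ (CRun (enter s f) m m′)) (unroll⁺ B s f)
      rest zero    = []
      rest (suc B) = All.map⁺ (All.map join (unroll-sound B (tgt G e) (λ _ → nothing)))
        where
        join : ∀ {ξ} → (∀ m m′ → Run ξ m m′ → ∃ (CRun (enter (tgt G e) (λ _ → nothing)) m m′)) →
               ∀ m m′ → Run (cons (restrict π s (src G e) f (λ _ → nothing)) (con G e) (pro G e) ξ) m m′ →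
               ∃ (CRun (enter s f) m m′)
        join ih m m′ (m₁ , z , m₂ , (es₁ , r₁) , link₁ , link₂ , run) with ih m₂ m′ run
        ... | es₂ , r₂ = L.map π es₁ ++ e ∷ es₂ , record
          { path       = path-++ G (L.map π es₁) (restrict-path π es₁ (path r₁)) (refl , path r₂)
          ; fires      = λ p → Coord.fir-++ _ _ (L.map π es₁) (fir-map π es₁ (fires r₁ p))
              (≤-trans (m≤n+m (con G e p) (z p)) (≤-reflexive (sym (link₁ p))) ,
               subst (λ k → Fir G p k es₂ (m′ p))
                 (trans (link₂ p) (cong (_+ pro G e p) (sym (trans (cong (_∸ con G e p) (link₁ p)) (m+n∸n≡m (z p) (con G e p))))))
                 (fires r₂ p))
          ; fits-entry = fits-entry r₁
          ; fits-exit  = fits-exit r₂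
          ; fits-rigid = fits-rigid r₁
          }

    first-use : ∀ es → (∃ λ es′ → es ≡ L.map π es′) ⊎ (∃ λ es₁ → ∃ λ es₂ → es ≡ L.map π es₁ ++ e ∷ es₂)
    first-use []       = inj₁ ([] , refl)
    first-use (i ∷ es) with e F.≟ i
    ... | yes refl = inj₂ ([] , es , refl)
    ... | no  e≢i  = found (∈-filter⁺ other? (∈-allFin i) e≢i) (first-use es)
      where
      found : i ∈ kept → _ → _
      found i∈ (inj₁ (es′ , eq))       = inj₁ (Any.index i∈ ∷ es′ , cong₂ _∷_ (Any.lookup-index i∈) eq)
      found i∈ (inj₂ (es₁ , es₂ , eq)) = inj₂ (Any.index i∈ ∷ es₁ , es₂ , cong₂ _∷_ (Any.lookup-index i∈) eq)

    used : ∀ es₁ es₂ → suc (cnt es₂ e) ≤ cnt (L.map π es₁ ++ e ∷ es₂) e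
    used es₁ es₂ = ≤-trans (≤-reflexive (cong (_+ cnt es₂ e) (sym (δ-refl e))))
      (≤-trans (m≤n+m _ (cnt (L.map π es₁) e)) (≤-reflexive (sym (weight-++ _ (L.map π es₁) (e ∷ es₂)))))

    unroll-complete : ∀ B s f m m′ es → CRun (enter s f) m m′ es → cnt es e ≤ B → Any (λ ξ → Run ξ m m′) (unroll B s f)
    unroll-complete B s f m m′ es r le with first-use es
    ... | inj₁ (es′ , refl) = here (es′ , record
          { path       = unrestrict-path π es′ (path r)
          ; fires      = λ p → fir-unmap π es′ (fires r p)
          ; fits-entry = fits-entry r
          ; fits-exit  = fits-exit r
          ; fits-rigid = fits-rigid r
          })
    unroll-complete zero    s f m m′ es r le | inj₂ (es₁ , es₂ , refl) = contradiction (≤-trans (used es₁ es₂) le) λ ()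
    unroll-complete (suc B) s f m m′ es r le | inj₂ (es₁ , es₂ , refl) with path-split G (L.map π es₁) (path r)
    ... | v , p₁ , refl , p₂ = there (Any.map⁺ (Any.map
          (λ run → m₁ , z , m₂ , (es₁ , record
             { path       = unrestrict-path π es₁ p₁
             ; fires      = λ p → fir-unmap π es₁ (proj₁ (proj₂ (cut p)))
             ; fits-entry = fits-entry r
             ; fits-exit  = λ _ → tt
             ; fits-rigid = fits-rigid r
             }) , (λ p → sym (m∸n+n≡m (proj₁ (proj₂ (proj₂ (cut p)))))) , (λ p → refl) , run)
          (unroll-complete B (tgt G e) (λ _ → nothing) m₂ m′ es₂ (record
             { path       = p₂
             ; fires      = λ p → proj₂ (proj₂ (proj₂ (cut p)))
             ; fits-entry = λ _ → tt
             ; fits-exit  = fits-exit r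
             ; fits-rigid = λ p rp → trans (cong (λ k → k ∸ con G e p + pro G e p) (at-src p rp)) (proj₂ (coherent c e p rp))
             }) (≤-pred (≤-trans (used es₁ es₂) le)))))
      where
      cut : ∀ p → ∃ λ k → Fir G p (m p) (L.map π es₁) k × Fir G p k (e ∷ es₂) (m′ p)
      cut p = Coord.fir-split _ _ (L.map π es₁) (fires r p)
      m₁ z m₂ : Fin d → ℕ
      m₁ p = proj₁ (cut p)
      z p  = m₁ p ∸ con G e p
      m₂ p = z p + pro G e p
      at-src : ∀ p → rigid c p ≡ true → m₁ p ≡ value c (src G e) p
      at-src p rp = fir-unique (L.map π es₁) (proj₁ (proj₂ (cut p)))
        (subst (λ k → Fir G p k (L.map π es₁) (value c (src G e) p)) (sym (fits-rigid r p rp)) (rigid-fir c (L.map π es₁) rp p₁))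

  unroll-arc : ∀ e B → Refinement c (λ m m′ es → cnt es e ≤ B)
  unroll-arc e B = record
    { alts     = unroll B (start c) (entry c)
    ; smaller  = unroll-smaller B (start c) (entry c)
    ; sound    = unroll-sound B (start c) (entry c)
    ; complete = unroll-complete B (start c) (entry c)
    }
    where open Unroll e

  assign : Fin d → ℕ → (Fin d → Maybe ℕ) → Fin d → Maybe ℕ
  assign p k f p′ = if does (p F.≟ p′) then just k else f p′

  module _ (p : Fin d) (k : ℕ) (f : Fin d → Maybe ℕ) where

    assign-narrows : ∀ p′ → open-ended (assign p k f p′) ≤ open-ended (f p′)
    assign-narrows p′ with p F.≟ p′
    ... | yes _ = z≤n
    ... | no  _ = ≤-refl

    assign-at : f p ≡ nothing → open-ended (assign p k f p) < open-ended (f p)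
    assign-at eq rewrite eq with p F.≟ p
    ... | yes _   = s≤s z≤n
    ... | no  p≢p = contradiction refl p≢p

    assign-fits : ∀ {m : Fin d → ℕ} → m p ≡ k → (∀ p′ → Fits (f p′) (m p′)) → ∀ p′ → Fits (assign p k f p′) (m p′)
    assign-fits eq fits p′ with p F.≟ p′
    ... | yes refl = eq
    ... | no  _    = fits p′

    fits-assign : ∀ {m : Fin d → ℕ} → f p ≡ nothing → (∀ p′ → Fits (assign p k f p′) (m p′)) → ∀ p′ → Fits (f p′) (m p′)
    fits-assign eq fits p′ with p F.≟ p′ | fits p′
    ... | yes refl | _  rewrite eq = tt
    ... | no  _    | ft = ft

  fix-entry : ∀ p B → entry c p ≡ nothing → Refinement c (λ m m′ es → m p ≤ B)
  fix-entry p B eq = record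
    { alts     = L.map (one ∘ fixed) (L.upTo (suc B))
    ; smaller  = All.map⁺ (All.universal (λ k → inj₂ (refl , inj₂ (refl ,
        sum-mono-< (λ p′ → +-monoˡ-≤ _ (assign-narrows p k (entry c) p′)) p (+-monoˡ-< _ (assign-at p k (entry c) eq)))) ∷ []) _)
    ; sound    = All.map⁺ (All.universal (λ k m m′ (es , r) → es , record
        { path       = path r
        ; fires      = fires r
        ; fits-entry = fits-assign p k (entry c) eq (fits-entry r)
        ; fits-exit  = fits-exit r
        ; fits-rigid = fits-rigid r
        }) _)
    ; complete = λ m m′ es r le → Any.map⁺ (lose (∈-upTo⁺ (s≤s le)) (es , record
        { path       = path r
        ; fires      = fires r
        ; fits-entry = assign-fits p (m p) (entry c) refl (fits-entry r)
        ; fits-exit  = fits-exit r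
        ; fits-rigid = fits-rigid r
        }))
    }
    where
    fixed : ℕ → Comp d
    fixed k = record c { entry = assign p k (entry c) }

  fix-exit : ∀ p B → exit c p ≡ nothing → Refinement c (λ m m′ es → m′ p ≤ B)
  fix-exit p B eq = record
    { alts     = L.map (one ∘ fixed) (L.upTo (suc B))
    ; smaller  = All.map⁺ (All.universal (λ k → inj₂ (refl , inj₂ (refl ,
        sum-mono-< (λ p′ → +-monoʳ-≤ (open-ended (entry c p′)) (assign-narrows p k (exit c) p′)) p
                   (+-monoʳ-< (open-ended (entry c p)) (assign-at p k (exit c) eq)))) ∷ []) _)
    ; sound    = All.map⁺ (All.universal (λ k m m′ (es , r) → es , record
        { path       = path r
        ; fires      = fires r
        ; fits-entry = fits-entry r
        ; fits-exit  = fits-assign p k (exit c) eq (fits-exit r)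
        ; fits-rigid = fits-rigid r
        }) _)
    ; complete = λ m m′ es r le → Any.map⁺ (lose (∈-upTo⁺ (s≤s le)) (es , record
        { path       = path r
        ; fires      = fires r
        ; fits-entry = fits-entry r
        ; fits-exit  = assign-fits p (m′ p) (exit c) refl (fits-exit r)
        ; fits-rigid = fits-rigid r
        }))
    }
    where
    fixed : ℕ → Comp d
    fixed k = record c { exit = assign p k (exit c) }

  -- A coordinate that stays below `B` is moved into the finite control: vertices are paired with
  -- its value, and only arcs that update it correctly are kept.
  module Rigidify (p : Fin d) (B : ℕ) where

    Arc : Set
    Arc = Fin (arcs G) × Fin B × Fin B

    Consistent : Arc → Set
    Consistent (e , b , b′) = con G e p ≤ toℕ b × toℕ b ∸ con G e p + pro G e p ≡ toℕ b′

    consistent? : ∀ a → Dec (Consistent a)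
    consistent? (e , b , b′) = (con G e p ≤? toℕ b) ×-dec (toℕ b ∸ con G e p + pro G e p ≟ toℕ b′)

    arcList : List Arc
    arcList = L.filter consistent? (L.cartesianProduct (L.allFin (arcs G)) (L.cartesianProduct (L.allFin B) (L.allFin B)))

    arc : Fin (length arcList) → Arc
    arc = L.lookup arcList

    consistent : ∀ i → Consistent (arc i)
    consistent i = proj₂ (∈-filter⁻ consistent? {xs = L.cartesianProduct (L.allFin (arcs G)) (L.cartesianProduct (L.allFin B) (L.allFin B))} (∈-lookup i))

    π : Fin (length arcList) → Fin (arcs G)
    π = proj₁ ∘ arc

    ρ : Fin (size G * B) → Fin (size G)
    ρ = proj₁ ∘ remQuot {size G} B

    level : Fin (size G * B) → Fin B
    level = proj₂ ∘ remQuot {size G} B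

    ρ-combine : ∀ (v : Fin (size G)) (b : Fin B) → ρ (combine v b) ≡ v
    ρ-combine v b = cong proj₁ (F.remQuot-combine v b)

    level-combine : ∀ (v : Fin (size G)) (b : Fin B) → level (combine v b) ≡ b
    level-combine v b = cong proj₂ (F.remQuot-combine v b)

    G′ : Graph d
    G′ = record
      { size = size G * B
      ; arcs = length arcList
      ; src  = λ i → combine (src G (π i)) (proj₁ (proj₂ (arc i)))
      ; tgt  = λ i → combine (tgt G (π i)) (proj₂ (proj₂ (arc i)))
      ; con  = con G ∘ π
      ; pro  = pro G ∘ π
      }

    rigid′ : Fin d → Bool
    rigid′ p′ = if does (p F.≟ p′) then true else rigid c p′

    value′ : Fin (size G * B) → Fin d → ℕ
    value′ v p′ = if does (p F.≟ p′) then toℕ (level v) else value c (ρ v) p′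

    coherent′ : ∀ i p′ → rigid′ p′ ≡ true → con G′ i p′ ≤ value′ (src G′ i) p′ ×
                value′ (src G′ i) p′ ∸ con G′ i p′ + pro G′ i p′ ≡ value′ (tgt G′ i) p′
    coherent′ i p′ r with p F.≟ p′
    ... | yes refl = subst₂ (λ a b → con G (π i) p ≤ toℕ a × toℕ a ∸ con G (π i) p + pro G (π i) p ≡ toℕ b)
                       (sym (level-combine (src G (π i)) _)) (sym (level-combine (tgt G (π i)) _)) (consistent i)
    ... | no  _    = subst₂ (λ u v → con G (π i) p′ ≤ value c u p′ × value c u p′ ∸ con G (π i) p′ + pro G (π i) p′ ≡ value c v p′)
                       (sym (ρ-combine (src G (π i)) _)) (sym (ρ-combine (tgt G (π i)) _)) (coherent c (π i) p′ r)

    between : Fin B × Fin B → Comp d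
    between (b , b′) = record
      { graph = G′ ; rigid = rigid′ ; value = value′ ; coherent = coherent′
      ; start = combine (start c) b ; end = combine (end c) b′ ; entry = entry c ; exit = exit c }

    lower-path : ∀ es {u v} → Path G′ u es v → Path G (ρ u) (L.map π es) (ρ v)
    lower-path []       refl       = refl
    lower-path (i ∷ es) (refl , q) = sym (ρ-combine (src G (π i)) _) ,
      subst (λ u → Path G u (L.map π es) _) (ρ-combine (tgt G (π i)) _) (lower-path es q)

    lift-path : ∀ es {u v k k′} (b b′ : Fin B) → Path G u es v → Fir G p k es k′ → Low G p B k es →
      toℕ b ≡ k → toℕ b′ ≡ k′ → ∃ λ es′ → es ≡ L.map π es′ × Path G′ (combine u b) es′ (combine v b′)
    lift-path []       {u} b b′ refl       refl     l       eq eq′ =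
      [] , refl , cong (combine u) (F.toℕ-injective (trans eq (sym eq′)))
    lift-path (e ∷ es) {u} b b′ (refl , q) (le , f) (_ , l) refl eq′
      with lift-path es (fromℕ< (Coord.low-head _ _ _ es l)) b′ q f l (F.toℕ-fromℕ< _) eq′
    ... | es′ , refl , q′ = i ∷ es′ , cong (_∷ L.map π es′) (cong proj₁ at) ,
          cong (λ a → combine (src G (proj₁ a)) (proj₁ (proj₂ a))) (sym at) ,
          subst (λ a → Path G′ (combine (tgt G (proj₁ a)) (proj₂ (proj₂ a))) es′ _) at q′
      where
      b₁ = fromℕ< (Coord.low-head _ _ _ es l)
      a∈ : (e , b , b₁) ∈ arcList
      a∈ = ∈-filter⁺ consistent? (∈-cartesianProduct⁺ (∈-allFin e) (∈-cartesianProduct⁺ (∈-allFin b) (∈-allFin b₁)))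
                     (le , sym (F.toℕ-fromℕ< _))
      i  = Any.index a∈
      at : (e , b , b₁) ≡ arc i
      at = Any.lookup-index a∈

  rigidify : ∀ p B → rigid c p ≡ false → Refinement c (λ m m′ es → Low G p B (m p) es)
  rigidify p B eq = record
    { alts     = L.map (one ∘ between) ends
    ; smaller  = All.map⁺ (All.universal (λ _ → inj₁ (sum-mono-< flags p flag-p) ∷ []) _)
    ; sound    = All.map⁺ (All.universal (λ { (b , b′) m m′ (es , r) → L.map π es , record
        { path       = subst₂ (λ u v → Path G u (L.map π es) v) (ρ-combine (start c) b) (ρ-combine (end c) b′)
                         (lower-path es (path r))
        ; fires      = λ p′ → fir-map π es (fires r p′)
        ; fits-entry = fits-entry r
        ; fits-exit  = fits-exit r
        ; fits-rigid = λ p′ r′ → lower-rigid b p′ r′ (fits-rigid r p′)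
        } }) _)
    ; complete = λ m m′ es r l →
        let b  = fromℕ< (Coord.low-head _ _ _ es l)
            b′ = fromℕ< (Coord.low-end _ _ es (fires r p) l)
            b≡ = F.toℕ-fromℕ< (Coord.low-head _ _ _ es l)
            b′≡ = F.toℕ-fromℕ< (Coord.low-end _ _ es (fires r p) l)
        in Any.map⁺ (lose (∈-cartesianProduct⁺ (∈-allFin b) (∈-allFin b′)) (lift-run b b′ b≡ b′≡ r l))
    }
    where
    open Rigidify p B
    -- The levels at the two ends are not known in advance, so every pair gives an alternative.
    ends = L.cartesianProduct (L.allFin B) (L.allFin B)
    flags : ∀ p′ → flag (rigid′ p′) ≤ flag (rigid c p′)
    flags p′ with p F.≟ p′
    ... | yes _ = z≤n
    ... | no  _ = ≤-refl
    flag-p : flag (rigid′ p) < flag (rigid c p)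
    flag-p rewrite eq with p F.≟ p
    ... | yes _   = s≤s z≤n
    ... | no  p≢p = contradiction refl p≢p
    lower-rigid : ∀ b p′ {k} → rigid c p′ ≡ true → (rigid′ p′ ≡ true → k ≡ value′ (combine (start c) b) p′) →
                  k ≡ value c (start c) p′
    lower-rigid b p′ r fits with p F.≟ p′
    ... | yes refl = contradiction (trans (sym r) eq) λ ()
    ... | no  _    = trans (fits r) (cong (λ v → value c v p′) (ρ-combine (start c) b))
    lift-run : ∀ b b′ {m m′ es} → toℕ b ≡ m p → toℕ b′ ≡ m′ p → CRun c m m′ es → Low G p B (m p) es →
               ∃ (CRun (between (b , b′)) m m′)
    lift-run b b′ {m} {m′} {es} b≡ b′≡ r l with lift-path es b b′ (path r) (fires r p) l b≡ b′≡
    ... | es′ , refl , q = es′ , record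
      { path       = q
      ; fires      = λ p′ → fir-unmap π es′ (fires r p′)
      ; fits-entry = fits-entry r
      ; fits-exit  = fits-exit r
      ; fits-rigid = lift-rigid
      }
      where
      lift-rigid : ∀ p′ → rigid′ p′ ≡ true → m p′ ≡ value′ (combine (start c) b) p′
      lift-rigid p′ r′ with p F.≟ p′
      ... | yes refl = trans (sym b≡) (cong toℕ (sym (level-combine (start c) b)))
      ... | no  _    = trans (fits-rigid r p′ r′) (cong (λ v → value c v p′) (sym (ρ-combine (start c) b)))

-- Perfect components

-- Kosaraju's condition, relative to the homogeneous solution `h`. The words of `up` and `down` need
-- to fire only at the non-rigid prescribed coordinates, but one word must pump all of them
-- together.
record Perfect {d} (c : Comp d) (h : Asg (CVar c)) : Set where
  private G = graph c
  field
    arcs⁺  : ∀ e → 0 < h (varc e)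
    entry⁺ : ∀ p → rigid c p ≡ false → entry c p ≡ nothing → 0 < h (vin p)
    exit⁺  : ∀ p → rigid c p ≡ false → exit c p ≡ nothing → 0 < h (vout p)
    reach  : ∀ e → ∃ λ es → Path G (start c) es (src G e)
    up     : ∃ λ u → Path G (start c) u (start c) ×
             (∀ p k → rigid c p ≡ false → entry c p ≡ just k → ∃ λ γ → Fir G p k u (k + suc γ))
    down   : ∃ λ v → Path G (end c) v (end c) ×
             (∀ p k → rigid c p ≡ false → exit c p ≡ just k → ∃ λ γ → Fir G p (k + suc γ) v k)

open Perfect

forall-or : ∀ {n} {P : Fin n → Set} {Q : Set} → (∀ i → P i ⊎ Q) → (∀ i → P i) ⊎ Q
forall-or {zero}  f = inj₁ λ ()
forall-or {suc n} f with f zero | forall-or (f ∘ suc)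
... | inj₂ q | _       = inj₂ q
... | inj₁ p | inj₂ q  = inj₂ q
... | inj₁ p | inj₁ ps = inj₁ λ { zero → p ; (suc i) → ps i }

from-just : Maybe ℕ → ℕ
from-just nothing  = 0
from-just (just k) = k

module _ {d} (c : Comp d) where

  private G = graph c

  -- Rigid coordinates return to the same value on a closed path, and open ones get large values
  -- from the homogeneous solution; only the remaining ones need pumping.
  module Pinned (f : Fin d → Maybe ℕ) where

    is-pinned : Fin d → Bool
    is-pinned p with rigid c p | f p
    ... | false | just _ = true
    ... | _     | _      = false

    pinned⇒ : ∀ p → is-pinned p ≡ true → rigid c p ≡ false × f p ≡ just (from-just (f p))
    pinned⇒ p eq with rigid c p | f p
    ... | false | just _ = refl , refl

    pinned⇐ : ∀ p {k} → rigid c p ≡ false → f p ≡ just k → is-pinned p ≡ true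
    pinned⇐ p r e rewrite r | e = refl

    pinned? = λ p → is-pinned p B.≟ true

    pins : List (Fin d)
    pins = L.filter pinned? (L.allFin d)

    pin : Fin (length pins) → Fin d
    pin = L.lookup pins

    pin-pinned : ∀ j → rigid c (pin j) ≡ false × f (pin j) ≡ just (from-just (f (pin j)))
    pin-pinned j = pinned⇒ (pin j) (proj₂ (∈-filter⁻ pinned? {xs = L.allFin d} (∈-lookup j)))

    pin-onto : ∀ p {k} → rigid c p ≡ false → f p ≡ just k → ∃ λ j → p ≡ pin j
    pin-onto p r e = let p∈ = ∈-filter⁺ pinned? (∈-allFin p) (pinned⇐ p r e) in Any.index p∈ , Any.lookup-index p∈

    fits-pin : ∀ {m : Fin d → ℕ} → (∀ p → Fits (f p) (m p)) → ∀ j → m (pin j) ≡ from-just (f (pin j))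
    fits-pin {m} fits j = subst (λ g → Fits g (m (pin j))) (proj₂ (pin-pinned j)) (fits (pin j))

  -- `T` stands for the solutions of the whole chain restricted to this component; the bounds hold
  -- for these, not necessarily for all solutions of `csys c`.
  module Examine (h : Asg (CVar c)) (κ : Flows.Circulation G (λ e → h (varc e))) (T : Asg (CVar c) → Set)
    (dec : ∀ i → 0 < h i ⊎ Bounded T i) where

    Refined : Set
    Refined = Refinement c (λ m m′ es → T (casg c m m′ es))

    all-arcs : (∀ e → 0 < h (varc e)) ⊎ Refined
    all-arcs = forall-or λ e → Sum.map₂ (λ (B , bound) → refine-⊆ (λ m m′ es _ t → bound _ t) (unroll-arc c e B)) (dec (varc e))

    all-entries : (∀ p → rigid c p ≡ false → entry c p ≡ nothing → 0 < h (vin p)) ⊎ Refined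
    all-entries = forall-or λ p → one-entry p (entry c p) refl
      where
      one-entry : ∀ p f → entry c p ≡ f → (rigid c p ≡ false → entry c p ≡ nothing → 0 < h (vin p)) ⊎ Refined
      one-entry p (just k) eq = inj₁ λ _ eq′ → case trans (sym eq) eq′ of λ ()
      one-entry p nothing  eq with dec (vin p)
      ... | inj₁ lt          = inj₁ λ _ _ → lt
      ... | inj₂ (B , bound) = inj₂ (refine-⊆ (λ m m′ es _ t → bound _ t) (fix-entry c p B eq))

    all-exits : (∀ p → rigid c p ≡ false → exit c p ≡ nothing → 0 < h (vout p)) ⊎ Refined
    all-exits = forall-or λ p → one-exit p (exit c p) refl
      where
      one-exit : ∀ p f → exit c p ≡ f → (rigid c p ≡ false → exit c p ≡ nothing → 0 < h (vout p)) ⊎ Refined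
      one-exit p (just k) eq = inj₁ λ _ eq′ → case trans (sym eq) eq′ of λ ()
      one-exit p nothing  eq with dec (vout p)
      ... | inj₁ lt          = inj₁ λ _ _ → lt
      ... | inj₂ (B , bound) = inj₂ (refine-⊆ (λ m m′ es _ t → bound _ t) (fix-exit c p B eq))

    -- An arc out of reach of the start can still carry circulation. No run uses it, so unrolling
    -- with bound 0 deletes it.
    all-reached : (∀ e → ∃ λ es → Path G (start c) es (src G e)) ⊎ Refined
    all-reached = forall-or reached
      where
      reached : ∀ e → (∃ λ es → Path G (start c) es (src G e)) ⊎ Refined
      reached e with path? G (start c) (src G e)
      ... | yes found = inj₁ found
      ... | no  none  = inj₂ (refine-⊆ (λ m m′ es r _ → ≮⇒≥ (λ lt → none (prefix es (path r) lt))) (unroll-arc c e 0))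
        where
        prefix : ∀ es {v} → Path G (start c) es v → 0 < cnt es e → ∃ λ es → Path G (start c) es (src G e)
        prefix es p lt with cnt-split es e lt
        ... | es₁ , es₂ , refl with path-split G es₁ p
        ... | v , p₁ , refl , _ = es₁ , p₁

    module _ (arcs-positive : ∀ e → 0 < h (varc e)) where

      -- When pumping fails, the coordinate that stays low may vary from run to run, hence the union
      -- over all pinned coordinates.
      pump-up : (∃ λ u → Path G (start c) u (start c) ×
                (∀ p k → rigid c p ≡ false → entry c p ≡ just k → ∃ λ γ → Fir G p k u (k + suc γ))) ⊎ Refined
      pump-up with Flows.return-within G _ κ arcs-positive (start c)
      ... | D , return with pump G (start c) (from-just ∘ entry c) (Pinned.pin (entry c)) D return
      ... | inj₁ (u , p , gain) = inj₁ (u , p , λ p k r e → gain′ p k r e)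
        where
        open Pinned (entry c)
        gain′ : ∀ p k → rigid c p ≡ false → entry c p ≡ just k → ∃ λ γ → Fir G p k u (k + suc γ)
        gain′ p k r e with pin-onto p r e
        ... | j , refl = subst (λ k → ∃ λ γ → Fir G p k u (k + suc γ)) (cong from-just e) (gain j)
      ... | inj₂ (C , low) = inj₂ (refine-⊆
              (λ m m′ es r _ → low m es (end c) (fits-pin (fits-entry r)) (path r) (λ j → _ , fires r (pin j)))
              (refine-⋃ (λ j → rigidify c (pin j) C (proj₁ (pin-pinned j)))))
        where open Pinned (entry c)

      -- Reversing the graph exchanges consumption and production and keeps the circulation, so
      -- decreasing at the exit becomes increasing at the start.
      pump-down : (∃ λ v → Path G (end c) v (end c) ×
                  (∀ p k → rigid c p ≡ false → exit c p ≡ just k → ∃ λ γ → Fir G p (k + suc γ) v k)) ⊎ Refined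
      pump-down with Flows.return-within (reverseG G) _ (Flows.circ (λ v → sym (Flows.Circulation.balance κ v))) arcs-positive (end c)
      ... | D , return with pump (reverseG G) (end c) (from-just ∘ exit c) (Pinned.pin (exit c)) D return
      ... | inj₁ (u , p , gain) = inj₁ (L.reverse u , path-reverse (reverseG G) u p , λ p k r e → gain′ p k r e)
        where
        open Pinned (exit c)
        gain′ : ∀ p k → rigid c p ≡ false → exit c p ≡ just k → ∃ λ γ → Fir G p (k + suc γ) (L.reverse u) k
        gain′ p k r e with pin-onto p r e
        ... | j , refl = subst (λ k → ∃ λ γ → Fir G p (k + suc γ) (L.reverse u) k) (cong from-just e)
                           (let γ , f = gain j in γ , fir-reverse u f)
      ... | inj₂ (C , low) = inj₂ (refine-⊆
              (λ m m′ es r _ → let j , l = low m′ (L.reverse es) (start c) (fits-pin (fits-exit r)) (path-reverse G es (path r))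
                                                 (λ j → _ , fir-reverse es (fires r (pin j)))
                               in j , low-reverse es (fires r (pin j)) l)
              (refine-⋃ (λ j → rigidify c (pin j) C (proj₁ (pin-pinned j)))))
        where open Pinned (exit c)

    examine : Perfect c h ⊎ Refined
    examine with all-arcs
    ... | inj₂ r = inj₂ r
    ... | inj₁ a with all-entries | all-exits | all-reached | pump-up a | pump-down a
    ... | inj₂ r | _      | _      | _      | _      = inj₂ r
    ... | inj₁ _ | inj₂ r | _      | _      | _      = inj₂ r
    ... | inj₁ _ | inj₁ _ | inj₂ r | _      | _      = inj₂ r
    ... | inj₁ _ | inj₁ _ | inj₁ _ | inj₂ r | _      = inj₂ r
    ... | inj₁ _ | inj₁ _ | inj₁ _ | inj₁ _ | inj₂ r = inj₂ r
    ... | inj₁ i | inj₁ o | inj₁ f | inj₁ u | inj₁ v =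
          inj₁ (record { arcs⁺ = a ; entry⁺ = i ; exit⁺ = o ; reach = f ; up = u ; down = v })

-- Perfectness and refinement of chains

Perfects : ∀ {d} (ξ : Chain d) → Asg (Var ξ) → Set
Perfects (one c)        h = Perfect c h
Perfects (cons c α β ξ) h = Perfect c (h ∘ inj₁) × Perfects ξ (λ i → h (inj₂ (inj₂ i)))

record ChainRefinement {d} (ξ : Chain d) (T : Asg (Var ξ) → Set) : Set where
  field
    variants : List (Chain d)
    lesser   : All (λ ξ′ → ranks ξ′ ≺ ranks ξ) variants
    faithful : All (λ ξ′ → ∀ m m′ → Run ξ′ m m′ → Run ξ m m′) variants
    exhaustive : ∀ m m′ (r : Run ξ m m′) → T (asg ξ r) → Any (λ ξ′ → Run ξ′ m m′) variants

append : ∀ {d} → Chain d → (α β : Fin d → ℕ) → Chain d → Chain d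
append (one c)          α β ξ = cons c α β ξ
append (cons c α′ β′ ζ) α β ξ = cons c α′ β′ (append ζ α β ξ)

ranks-append : ∀ {d} (ζ : Chain d) {α β} ξ → ranks (append ζ α β ξ) ≡ ranks ζ ++ ranks ξ
ranks-append (one c)          ξ = refl
ranks-append (cons c α′ β′ ζ) ξ = cong (rank c ∷_) (ranks-append ζ ξ)

module _ {d} {α β : Fin d → ℕ} {ξ : Chain d} where

  Linked : Chain d → (m m′ : Fin d → ℕ) → Set
  Linked ζ m m′ = ∃ λ (m₁ : Fin d → ℕ) → ∃ λ (z : Fin d → ℕ) → ∃ λ (m₂ : Fin d → ℕ) →
    Run ζ m m₁ × (∀ p → m₁ p ≡ z p + α p) × (∀ p → m₂ p ≡ z p + β p) × Run ξ m₂ m′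

  append-run : ∀ ζ {m m′} → Linked ζ m m′ → Run (append ζ α β ξ) m m′
  append-run (one c)          linked = linked
  append-run (cons c α′ β′ ζ) (m₁ , z , m₂ , (n₁ , y , n₂ , r , l₁ , l₂ , s) , k₁ , k₂ , t) =
    n₁ , y , n₂ , r , l₁ , l₂ , append-run ζ (m₁ , z , m₂ , s , k₁ , k₂ , t)

  run-append : ∀ ζ {m m′} → Run (append ζ α β ξ) m m′ → Linked ζ m m′
  run-append (one c)          linked = linked
  run-append (cons c α′ β′ ζ) (n₁ , y , n₂ , r , l₁ , l₂ , s) =
    let m₁ , z , m₂ , s′ , k₁ , k₂ , t = run-append ζ s in m₁ , z , m₂ , (n₁ , y , n₂ , r , l₁ , l₂ , s′) , k₁ , k₂ , t

-- The first imperfect component is replaced by its alternatives, spliced in place. For each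
-- component the predicate `T` is projected to its variables, so the bounds of the whole chain
-- remain available.
examine-chain : ∀ {d} (ξ : Chain d) (h : Asg (Var ξ)) → ⟦ sys ξ ⟧₀ h → (T : Asg (Var ξ) → Set) →
  (∀ i → 0 < h i ⊎ Bounded T i) → Perfects ξ h ⊎ ChainRefinement ξ T
examine-chain (one c) h hom T dec with Examine.examine c h (Flows.circ (proj₁ (proj₂ hom))) T dec
... | inj₁ p = inj₁ p
... | inj₂ r = inj₂ (record
  { variants = alts r
  ; lesser   = All.map (λ {ζ} lt → subst (_≺ (rank c ∷ [])) (L.++-identityʳ (ranks ζ)) (here lt)) (smaller r)
  ; faithful = sound r
  ; exhaustive = λ m m′ (es , run) t → complete r m m′ es run t
  })
examine-chain (cons c α β ξ) h hom T dec
  with Examine.examine c (h ∘ inj₁) (Flows.circ (proj₁ (proj₂ (proj₁ hom)))) (λ y → ∃ λ x → T x × (∀ i → x (inj₁ i) ≡ y i))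
         (λ i → Sum.map₂ (λ (B , bound) → B , λ { y (x , t , eq) → subst (_≤ B) (eq i) (bound x t) }) (dec (inj₁ i)))
... | inj₂ r = inj₂ (record
  { variants = L.map (λ ζ → append ζ α β ξ) (alts r)
  ; lesser   = All.map⁺ (All.map (λ {ζ} lt → subst (_≺ ranks (cons c α β ξ)) (sym (ranks-append ζ ξ)) (here lt)) (smaller r))
  ; faithful = All.map⁺ (All.map (λ {ζ} snd m m′ run → let m₁ , z , m₂ , s , rest = run-append ζ run in
                                   m₁ , z , m₂ , snd m m₁ s , rest) (sound r))
  ; exhaustive = λ { m m′ run@(m₁ , z , m₂ , (es , q) , rest) t → Any.map⁺ (Any.map (λ {ζ} s → append-run ζ (m₁ , z , m₂ , s , rest))
                     (complete r m m₁ es q (asg (cons c α β ξ) run , t , λ _ → refl))) }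
  })
... | inj₁ p
  with examine-chain ξ (λ i → h (inj₂ (inj₂ i))) (proj₂ (proj₂ (proj₂ hom)))
         (λ y → ∃ λ x → T x × (∀ i → x (inj₂ (inj₂ i)) ≡ y i))
         (λ i → Sum.map₂ (λ (B , bound) → B , λ { y (x , t , eq) → subst (_≤ B) (eq i) (bound x t) }) (dec (inj₂ (inj₂ i))))
... | inj₁ ps = inj₁ (p , ps)
... | inj₂ r  = inj₂ (record
  { variants = L.map (cons c α β) (variants r)
  ; lesser   = All.map⁺ (All.map there (lesser r))
  ; faithful = All.map⁺ (All.map (λ { snd m m′ (m₁ , z , m₂ , q , l₁ , l₂ , s) → m₁ , z , m₂ , q , l₁ , l₂ , snd m₂ m′ s })
                                 (faithful r))
  ; exhaustive = λ { m m′ run@(m₁ , z , m₂ , q , l₁ , l₂ , s) t → Any.map⁺ (Any.map (λ s′ → m₁ , z , m₂ , q , l₁ , l₂ , s′)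
                     (exhaustive r m₂ m′ s (asg (cons c α β ξ) run , t , λ _ → refl))) }
  })
  where open ChainRefinement

-- Perfect chains have runs

fits-sound : ∀ {I} f (i : I) (x : Asg I) → ⟦ fitS f i ⟧ x → Fits f (x i)
fits-sound nothing  i x _  = tt
fits-sound (just k) i x eq = trans (sym (+-identityʳ _)) eq

rigid-sound : ∀ {I} b (i : I) k (x : Asg I) → ⟦ rigidS b i k ⟧ x → b ≡ true → x i ≡ k
rigid-sound true i k x eq _ = trans (sym (+-identityʳ _)) eq

module Balance {d} (G : Graph d) where

  open Flows G

  circ-∖ : ∀ a b {s} → Circulation (a ⊞ b) → Flow a s s → Circulation b
  circ-∖ a b {s} κ φ = flow⇒circulation s (flow-∖ a b (circulation⇒flow κ s) φ)

  circ-⊞ : ∀ a b {s} → Flow a s s → Circulation b → Circulation (a ⊞ b)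
  circ-⊞ a b {s} φ κ = flow⇒circulation s (flow-⊞ a b φ (circulation⇒flow κ s))

  module _ {s t} (u v γ : List (Fin (arcs G))) (u-path : Path G s u s) (v-path : Path G t v t) (γ-path : Path G s γ s)
    (γ-visits : ∀ e → 0 < cnt γ e) (g : Fin (arcs G) → ℕ) (g-circ : Circulation g)
    (g-large : ∀ e → cnt u e + (cnt v e + cnt γ e) ≤ g e) where

    private
      room : Fin (arcs G) → ℕ
      room e = g e ∸ (cnt u e + (cnt v e + cnt γ e))

      room-split : ∀ e → g e ≡ cnt u e + (cnt v e + (cnt γ e + room e))
      room-split e = trans (sym (m+[n∸m]≡n (g-large e)))
        (trans (+-assoc (cnt u e) _ _) (cong (cnt u e +_) (+-assoc (cnt v e) _ _)))

      room-circ : Circulation room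
      room-circ = circ-∖ (cnt γ) room (circ-∖ (cnt v) (cnt γ ⊞ room) (circ-∖ (cnt u) (cnt v ⊞ (cnt γ ⊞ room))
        (flow⇒circulation s (flow-cong room-split (circulation⇒flow g-circ s)))
        (path⇒flow u u-path)) (path⇒flow v v-path)) (path⇒flow γ γ-path)

    -- After removing `u` and `v`, the circulation still contains the tour `γ`, which meets every
    -- arc; all that is left can be spliced into it to form one closed path.
    loop : ∃ λ w → Path G s w s × (∀ e → g e ≡ cnt u e + (cnt v e + cnt w e))
    loop = let w , p , count = euler (sum room) γ room ≤-refl γ-path γ-visits room-circ
           in w , p , λ e → trans (room-split e) (cong (λ t → cnt u e + (cnt v e + t)) (sym (count e)))

    -- A path for `x` alone could miss circuits of `x` that are disconnected from it. Adding `g`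
    -- brings in the tour `γ`, which connects everything.
    crossing : ∀ x → Flow x s t → ∃ λ σ → Path G s σ t × (∀ e → cnt σ e ≡ x e + g e)
    crossing x φ with walk (sum x) x ≤-refl φ
    ... | π , r , p , split , _ =
      let σ , q , count = euler (sum (r ⊞ rest)) (γ ++ π) (r ⊞ rest) ≤-refl (path-++ G γ γ-path p)
            (λ e → ≤-trans (γ-visits e) (≤-trans (m≤m+n _ _) (≤-reflexive (sym (weight-++ _ γ π)))))
            (circ-⊞ r rest (flow-∖ (cnt π) r (flow-cong split φ) (path⇒flow π p)) rest-circ)
      in σ , q , λ e → trans (count e) (trans (cong (_+ (r e + rest e)) (weight-++ (λ i → δ i e) γ π))
           (trans (ring (cnt γ e) (cnt π e) (r e) (cnt u e) (cnt v e) (room e)) (sym (cong₂ _+_ (split e) (room-split e)))))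
      where
      rest : Fin (arcs G) → ℕ
      rest e = cnt u e + (cnt v e + room e)
      rest-circ : Circulation rest
      rest-circ = circ-⊞ (cnt u) (cnt v ⊞ room) (path⇒flow u u-path) (circ-⊞ (cnt v) room (path⇒flow v v-path) room-circ)
      ring : ∀ γ π r u v o → γ + π + (r + (u + (v + o))) ≡ π + r + (u + (v + (γ + o)))
      ring = solve-∀

module _ {d} (c : Comp d) where

  private G = graph c

  conW proW : Fin d → List (Fin (arcs G)) → ℕ
  conW p = weight (λ e → con G e p)
  proW p = weight (λ e → pro G e p)

  Ascends : (g : Asg (CVar c)) → List (Fin (arcs G)) → Fin d → Set
  Ascends g u p = (entry c p ≡ nothing → suc (conW p u) ≤ g (vin p)) ×
                  (∀ k → entry c p ≡ just k → ∃ λ j → Fir G p k u (k + suc j))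

  Descends : (g : Asg (CVar c)) → List (Fin (arcs G)) → Fin d → Set
  Descends g v p = (exit c p ≡ nothing → suc (proW p v) ≤ g (vout p)) ×
                   (∀ k → exit c p ≡ just k → ∃ λ j → Fir G p (k + suc j) v k)

-- The run is uᵐ wᵐ σ vᵐ, where u pumps up, v pumps down, σ realizes the solution y, and the loop w makes
-- u, v and w together realize the homogeneous solution g.
module Assemble {d} (c : Comp d) (u v w σ : List (Fin (arcs (graph c))))
  (u-path : Path (graph c) (start c) u (start c)) (v-path : Path (graph c) (end c) v (end c))
  (w-path : Path (graph c) (start c) w (start c)) (σ-path : Path (graph c) (start c) σ (end c))
  (y g : Asg (CVar c)) (y-sol : ⟦ csys c ⟧ y) (g-hom : ⟦ csys c ⟧₀ g)
  (uvw : ∀ e → g (varc e) ≡ cnt u e + (cnt v e + cnt w e)) (σ-count : ∀ e → cnt σ e ≡ y (varc e))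
  (ascends : ∀ p → rigid c p ≡ false → Ascends c g u p) (descends : ∀ p → rigid c p ≡ false → Descends c g v p)
  (m : ℕ) (m-large : ∀ p → proW c p σ + (conW c p w + conW c p σ) ≤ m) where

  private G = graph c

  X : Asg (CVar c)
  X = y ⊞ (m ⊡ g)

  X-sol : ⟦ csys c ⟧ X
  X-sol = shift (⟦⟧-closed (csys c)) {y} {m ⊡ g} y-sol (times (⟦⟧-closed (csys c)) m g-hom)

  es : List (Fin (arcs G))
  es = cascade m u w σ v

  es-path : Path G (start c) es (end c)
  es-path = path-++ G (pow m u) (path-pow G m u-path)
    (path-++ G (pow m w) (path-pow G m w-path)
    (path-++ G σ σ-path (path-pow G m v-path)))

  es-count : ∀ e → cnt es e ≡ X (varc e)
  es-count e = trans (weight-cascade _ m u w σ v) (trans (ring m (cnt u e) (cnt w e) (cnt σ e) (cnt v e))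
    (sym (cong₂ _+_ (sym (σ-count e)) (cong (m *_) (uvw e)))))
    where
    ring : ∀ m u w s v → m * u + (m * w + (s + m * v)) ≡ s + m * (u + (v + w))
    ring = solve-∀

  effect : ∀ p → X (vin p) + proW c p es ≡ X (vout p) + conW c p es
  effect p = trans (cong (X (vin p) +_) (sums (λ e → pro G e p))) (trans (sym (+-identityʳ _))
    (trans (proj₁ X-sol p) (trans (+-identityʳ _) (cong (X (vout p) +_) (sym (sums (λ e → con G e p)))))))
    where
    sums : ∀ f → weight f es ≡ sum (λ e → X (varc e) * f e)
    sums f = trans (weight-cnt f es) (sum-cong-≗ (λ e → cong (_* f e) (es-count e)))

  fire-rigid : ∀ p → rigid c p ≡ true → Fir G p (X (vin p)) es (X (vout p))
  fire-rigid p r = subst₂ (λ k k′ → Fir G p k es k′) (sym at-start) at-end (rigid-fir c es r es-path)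
    where
    at-start : X (vin p) ≡ value c (start c) p
    at-start = rigid-sound (rigid c p) (vin p) _ X (proj₂ (proj₂ (proj₂ (proj₂ X-sol))) p) r
    at-end : value c (end c) p ≡ X (vout p)
    at-end = +-cancelʳ-≡ (conW c p es) _ _ (trans (sym (Coord.fir-effect _ _ es (rigid-fir c es r es-path)))
      (trans (cong (_+ proW c p es) (sym at-start)) (effect p)))

  -- Of the `suc W` units contributed per repetition, `W` pay for the word and one is saved, so `m`
  -- remain at the end.
  enough : ∀ {k W} i → suc W ≤ g i → k ≡ X i → m * W + m ≤ k
  enough {W = W} i lt refl = ≤-trans (≤-reflexive (trans (+-comm (m * W) m) (sym (*-suc m W))))
    (≤-trans (*-monoʳ-≤ m lt) (m≤n+m _ (y i)))

  constant : ∀ {k} i → ⟦ fitS (just k) i ⟧ y → ⟦ fitS (just k) i ⟧₀ g → X i ≡ k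
  constant {k} i eq eq₀ = trans (cong₂ _+_ (fits-sound (just k) i y eq) (trans (cong (m *_) eq₀) (*-zeroʳ m))) (+-identityʳ k)

  module _ (p : Fin d) (nr : rigid c p ≡ false) where

    open Coord (λ e → con G e p) (λ e → pro G e p) hiding (Fir; Low; Exceeds)

    ascend : ∃ λ A → Fir G p (X (vin p)) (pow m u) A × m ≤ A
    ascend = go (entry c p) refl (proj₁ (proj₂ (proj₂ y-sol)) p) (proj₁ (proj₂ (proj₂ g-hom)) p)
      where
      go : ∀ f → entry c p ≡ f → ⟦ fitS f (vin p) ⟧ y → ⟦ fitS f (vin p) ⟧₀ g → ∃ λ A → Fir G p (X (vin p)) (pow m u) A × m ≤ A
      go nothing eq _ _ = fir-forward m (pow m u) (≤-trans (≤-reflexive (cong (_+ m) (weight-pow _ m u)))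
        (enough (vin p) (proj₁ (ascends p nr) eq) refl))
      go (just k) eq s s₀ with proj₂ (ascends p nr) k eq
      ... | j , f = k + m * suc j , subst (λ t → Fir G p t (pow m u) (k + m * suc j)) (sym (constant (vin p) s s₀)) (fir-pump m u f) ,
            ≤-trans (m≤m*n m (suc j)) (m≤n+m _ k)

    descend : ∃ λ B → Fir G p B (pow m v) (X (vout p)) × m ≤ B
    descend = go (exit c p) refl (proj₁ (proj₂ (proj₂ (proj₂ y-sol))) p) (proj₁ (proj₂ (proj₂ (proj₂ g-hom))) p)
      where
      go : ∀ f → exit c p ≡ f → ⟦ fitS f (vout p) ⟧ y → ⟦ fitS f (vout p) ⟧₀ g → ∃ λ B → Fir G p B (pow m v) (X (vout p)) × m ≤ B
      go nothing eq _ _ = fir-backward m (pow m v) (≤-trans (≤-reflexive (cong (_+ m) (weight-pow _ m v)))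
        (enough (vout p) (proj₁ (descends p nr) eq) refl))
      go (just k) eq s s₀ with proj₂ (descends p nr) k eq
      ... | j , f = k + m * suc j , subst (Fir G p (k + m * suc j) (pow m v)) (sym (constant (vout p) s s₀)) (fir-drain m v f) ,
            ≤-trans (m≤m*n m (suc j)) (m≤n+m _ k)

    fire-flexible : Fir G p (X (vin p)) es (X (vout p))
    fire-flexible = let A , fu , m≤A = ascend ; B , fv , m≤B = descend in
      fir-cascade m u w σ v fu fv m≤A m≤B (m-large p) (effect p)

  realized : CRun c (λ p → X (vin p)) (λ p → X (vout p)) es
  realized = record
    { path       = es-path
    ; fires      = fire
    ; fits-entry = λ p → fits-sound (entry c p) (vin p) X (proj₁ (proj₂ (proj₂ X-sol)) p)
    ; fits-exit  = λ p → fits-sound (exit c p) (vout p) X (proj₁ (proj₂ (proj₂ (proj₂ X-sol))) p)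
    ; fits-rigid = λ p → rigid-sound (rigid c p) (vin p) _ X (proj₂ (proj₂ (proj₂ (proj₂ X-sol))) p)
    }
    where
    fire : ∀ p → Fir G p (X (vin p)) es (X (vout p))
    fire p with rigid c p in eq
    ... | true  = fire-rigid p eq
    ... | false = fire-flexible p eq

-- `N` makes `N ⊡ h` contain the pumping words and the tour, and `m` is the number of repetitions.
-- They are separate because the words `w` and `σ`, which determine how large `m` must be, depend on
-- `N`.
scaled : ∀ {I} → (x h : Asg I) (N m : ℕ) → Asg I
scaled x h N m = (x ⊞ (N ⊡ h)) ⊞ (m ⊡ (N ⊡ h))

module _ {d} (c : Comp d) (h : Asg (CVar c)) (hom : ⟦ csys c ⟧₀ h) where

  private G = graph c

  -- Stated for all values above thresholds, so that one `N` and one `m` serve every component of a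
  -- chain.
  Realizable : Set
  Realizable = ∃ λ K → ∀ N → K ≤ N → ∀ x → ⟦ csys c ⟧ x → ∃ λ M → ∀ m → M ≤ m →
    ∃ (CRun c (λ p → scaled x h N m (vin p)) (λ p → scaled x h N m (vout p)))

  realize-comp : Perfect c h → Realizable
  realize-comp P = pumped (up P) (down P) (Flows.tour G _ (Flows.circ (proj₁ (proj₂ hom))) (arcs⁺ P) (start c) (reach P))
    where
    pumped : (∃ λ u → Path G (start c) u (start c) × _) → (∃ λ v → Path G (end c) v (end c) × _) →
             (∃ λ γ → Path G (start c) γ (start c) × (∀ e → 0 < cnt γ e)) → Realizable
    pumped (u , u-path , gain) (v , v-path , loss) (γ , γ-path , visits) = K , large
      where
      K : ℕ
      -- The first sum makes each arc count of `N ⊡ h` cover `u`, `v` and `γ`; the second makes open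
      -- entry and exit values exceed what `u` consumes and `v` produces.
      K = sum (λ e → cnt u e + (cnt v e + cnt γ e)) + sum (λ p → suc (conW c p u) + suc (proW c p v))
      large : ∀ N → K ≤ N → ∀ x → ⟦ csys c ⟧ x → ∃ λ M → ∀ m → M ≤ m →
              ∃ (CRun c (λ p → scaled x h N m (vin p)) (λ p → scaled x h N m (vout p)))
      large N K≤N x sol =
        assemble (Balance.loop G u v γ u-path v-path γ-path visits (λ e → g (varc e)) (Flows.circ (proj₁ (proj₂ g-hom))) g-large)
                 (Balance.crossing G u v γ u-path v-path γ-path visits (λ e → g (varc e)) (Flows.circ (proj₁ (proj₂ g-hom)))
                    g-large (λ e → x (varc e)) (Flows.flow (proj₁ (proj₂ sol))))
        where
        g : Asg (CVar c)
        g = N ⊡ h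
        g-hom : ⟦ csys c ⟧₀ g
        g-hom = times (⟦⟧-closed (csys c)) N hom
        grow : ∀ {n} → 0 < n → K ≤ N * n
        grow lt = ≤-trans K≤N (≤-trans (≤-reflexive (sym (*-identityʳ N))) (*-monoʳ-≤ N lt))
        g-large : ∀ e → cnt u e + (cnt v e + cnt γ e) ≤ g (varc e)
        g-large e = ≤-trans (≤-trans (≤-sum (λ e → cnt u e + (cnt v e + cnt γ e)) e) (m≤m+n _ _)) (grow (arcs⁺ P e))
        bound : ∀ p {n} → 0 < n → suc (conW c p u) + suc (proW c p v) ≤ N * n
        bound p lt = ≤-trans (≤-trans (≤-sum (λ p → suc (conW c p u) + suc (proW c p v)) p) (m≤n+m _ _)) (grow lt)
        assemble : (∃ λ w → Path G (start c) w (start c) × (∀ e → g (varc e) ≡ cnt u e + (cnt v e + cnt w e))) →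
                   (∃ λ σ → Path G (start c) σ (end c) × (∀ e → cnt σ e ≡ x (varc e) + g (varc e))) →
                   ∃ λ M → ∀ m → M ≤ m → ∃ (CRun c (λ p → scaled x h N m (vin p)) (λ p → scaled x h N m (vout p)))
        assemble (w , w-path , uvw) (σ , σ-path , σ-count) = M , λ m M≤m → cascade m u w σ v ,
          Assemble.realized c u v w σ u-path v-path w-path σ-path (x ⊞ g) g
            (shift (⟦⟧-closed (csys c)) {x} {g} sol g-hom) g-hom uvw σ-count
            (λ p nr → (λ eq → ≤-trans (m≤m+n _ _) (bound p (entry⁺ P p nr eq))) , λ k → gain p k nr)
            (λ p nr → (λ eq → ≤-trans (m≤n+m _ (suc (conW c p u))) (bound p (exit⁺ P p nr eq))) , λ k → loss p k nr)
            m (λ p → ≤-trans (≤-sum (λ p → proW c p σ + (conW c p w + conW c p σ)) p) M≤m)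
          where
          M : ℕ
          M = sum (λ p → proW c p σ + (conW c p w + conW c p σ))

scaled-sol : ∀ {I} (S : Sys I) {x h} N m → ⟦ S ⟧ x → ⟦ S ⟧₀ h → ⟦ S ⟧ (scaled x h N m)
scaled-sol S {x} {h} N m sol hom = shift cl {x ⊞ (N ⊡ h)} {m ⊡ (N ⊡ h)} (shift cl {x} {N ⊡ h} sol (times cl N hom))
                                         (times cl m (times cl N hom))
  where cl = ⟦⟧-closed S

join-run : ∀ {d} (c : Comp d) (α β : Fin d → ℕ) (ξ : Chain d) (x : Asg (Var (cons c α β ξ))) →
  ⟦ sys (cons c α β ξ) ⟧ x → ∃ (CRun c (λ p → x (inj₁ (vin p))) (λ p → x (inj₁ (vout p)))) →
  ∀ {m′} → Run ξ (λ p → x (inj₂ (inj₂ (first-in ξ p)))) m′ → Run (cons c α β ξ) (λ p → x (inj₁ (vin p))) m′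
join-run c α β ξ x (_ , link₁ , link₂ , _) r s =
  (λ p → x (inj₁ (vout p))) , (λ p → x (inj₂ (inj₁ p))) , (λ p → x (inj₂ (inj₂ (first-in ξ p)))) , r ,
  (λ p → trans (sym (+-identityʳ _)) (link₁ p)) , (λ p → trans (sym (+-identityʳ _)) (link₂ p)) , s

module _ {d} (ξ : Chain d) (h : Asg (Var ξ)) where

  RealizableChain : Set
  RealizableChain = ∃ λ K → ∀ N → K ≤ N → ∀ x → ⟦ sys ξ ⟧ x → ∃ λ M → ∀ m → M ≤ m →
    ∃ λ m′ → Run ξ (λ p → scaled x h N m (first-in ξ p)) m′

realize-cons : ∀ {d} (c : Comp d) (α β : Fin d → ℕ) (ξ : Chain d) (h : Asg (Var (cons c α β ξ))) →
  (hom : ⟦ sys (cons c α β ξ) ⟧₀ h) → Realizable c (h ∘ inj₁) (proj₁ hom) →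
  RealizableChain ξ (λ i → h (inj₂ (inj₂ i))) → RealizableChain (cons c α β ξ) h
realize-cons c α β ξ h hom (K₁ , real₁) (K₂ , real₂) = K₁ + K₂ , λ N K≤N x sol →
  both N x sol (real₁ N (≤-trans (m≤m+n K₁ K₂) K≤N) (x ∘ inj₁) (proj₁ sol))
               (real₂ N (≤-trans (m≤n+m K₂ K₁) K≤N) (λ i → x (inj₂ (inj₂ i))) (proj₂ (proj₂ (proj₂ sol))))
  where
  both : ∀ N x → ⟦ sys (cons c α β ξ) ⟧ x →
    (∃ λ M → ∀ m → M ≤ m → ∃ (CRun c (λ p → scaled x h N m (inj₁ (vin p))) (λ p → scaled x h N m (inj₁ (vout p))))) →
    (∃ λ M → ∀ m → M ≤ m → ∃ λ m′ → Run ξ (λ p → scaled x h N m (inj₂ (inj₂ (first-in ξ p)))) m′) →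
    ∃ λ M → ∀ m → M ≤ m → ∃ λ m′ → Run (cons c α β ξ) (λ p → scaled x h N m (inj₁ (vin p))) m′
  both N x sol (M₁ , run₁) (M₂ , run₂) = M₁ + M₂ , λ m M≤m →
    let m′ , r = run₂ m (≤-trans (m≤n+m M₂ M₁) M≤m) in
    m′ , join-run c α β ξ (scaled x h N m) (scaled-sol (sys (cons c α β ξ)) {x} {h} N m sol hom) (run₁ m (≤-trans (m≤m+n M₁ M₂) M≤m)) r

realize : ∀ {d} (ξ : Chain d) (h : Asg (Var ξ)) → ⟦ sys ξ ⟧₀ h → Perfects ξ h → RealizableChain ξ h
realize (one c) h hom P = let K , real = realize-comp c h hom P in K , λ N K≤N x sol →
  let M , run = real N K≤N x sol in M , λ m M≤m → (λ p → scaled x h N m (vout p)) , run m M≤m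
realize (cons c α β ξ) h hom (P , Ps) = realize-cons c α β ξ h hom (realize-comp c (h ∘ inj₁) (proj₁ hom) P)
  (realize ξ (λ i → h (inj₂ (inj₂ i))) (proj₂ (proj₂ (proj₂ hom))) Ps)

-- Deciding whether a chain has a run

HasRun : ∀ {d} → Chain d → Set
HasRun {d} ξ = ∃ λ (m : Fin d → ℕ) → ∃ λ (m′ : Fin d → ℕ) → Run ξ m m′

realizable⇒run : ∀ {d} (ξ : Chain d) h x → ⟦ sys ξ ⟧ x → RealizableChain ξ h → HasRun ξ
realizable⇒run ξ h x sol (K , real) = let M , run = real K ≤-refl x sol in _ , run M ≤-refl

run? : ∀ {d} (ξ : Chain d) → Acc _≺_ (ranks ξ) → Dec (HasRun ξ)
run? {d} ξ (acc rs) = solved (solve (enum-Var ξ) (sys ξ))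
  where
  any-run : ∀ ζs → All (λ ζ → ranks ζ ≺ ranks ξ) ζs → Dec (Any HasRun ζs)
  any-run []       []         = no λ ()
  any-run (ζ ∷ ζs) (lt ∷ lts) = map′ [ here , there ]′ (λ { (here r) → inj₁ r ; (there r) → inj₂ r }) (run? ζ (rs lt) ⊎-dec any-run ζs lts)
  examined : ∀ x h → ⟦ sys ξ ⟧ x → ⟦ sys ξ ⟧₀ h → Perfects ξ h ⊎ ChainRefinement ξ ⟦ sys ξ ⟧ → Dec (HasRun ξ)
  examined x h sol hom (inj₁ P) = yes (realizable⇒run ξ h x sol (realize ξ h hom P))
  examined x h sol hom (inj₂ r) = map′ forward backward (any-run variants lesser)
    where
    open ChainRefinement r
    forward : Any HasRun variants → HasRun ξ
    forward found = let ζ , ζ∈ , m , m′ , run = find found in m , m′ , All.lookup faithful ζ∈ m m′ run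
    backward : HasRun ξ → Any HasRun variants
    backward (m , m′ , run) = Any.map (λ r → m , m′ , r) (exhaustive m m′ run (run⇒sys ξ run))
  solved : (∀ x → ¬ ⟦ sys ξ ⟧ x) ⊎ (∃ λ x → ∃ λ h → ⟦ sys ξ ⟧ x × ⟦ sys ξ ⟧₀ h × ∀ i → 0 < h i ⊎ Bounded ⟦ sys ξ ⟧ i) →
           Dec (HasRun ξ)
  solved (inj₁ none)                     = no λ (m , m′ , r) → none (asg ξ r) (run⇒sys ξ r)
  solved (inj₂ (x , h , sol , hom , dec)) = examined x h sol hom (examine-chain ξ h hom ⟦ sys ξ ⟧ dec)

-- Markings up to a threshold

exists-vec? : ∀ {n} d {P : Vec (Fin n) d → Set} → (∀ v → Dec (P v)) → Dec (∃ P)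
exists-vec? zero    P? = map′ ([] ,_) (λ { ([] , p) → p }) (P? [])
exists-vec? (suc d) P? = map′ (λ (i , v , p) → i ∷ v , p) (λ { (i ∷ v , p) → i , v , p })
  (F.any? (λ i → exists-vec? d (λ v → P? (i ∷ v))))

module _ (S : Net) where

  private
    con′ pro′ : Trans S → Fin (nP S) → ℕ
    con′ e p = lookup (pre S e) p
    pro′ e p = lookup (post S e) p

    fire-at : ∀ e M p → lookup (fireMarking S e M) p ≡ lookup M p ∸ con′ e p + pro′ e p
    fire-at e M p = V.lookup∘tabulate _ p

    con≤1 : ∀ e p → con′ e p ≤ 1
    con≤1 e p = ≤-trans (≤-reflexive (V.lookup∘tabulate _ p)) (χ≤1 (inF S e p))
      where
      χ≤1 : ∀ b → χ b ≤ 1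
      χ≤1 true  = s≤s z≤n
      χ≤1 false = z≤n

  fires⇒fir : ∀ {M w M′} → Fires S M w M′ → ∀ p → Coord.Fir (λ e → con′ e p) (λ e → pro′ e p) (lookup M p) w (lookup M′ p)
  fires⇒fir fires-ε                          p = refl
  fires⇒fir (fires-∷ {M} {a = e} (en , refl) f) p =
    en p , subst (λ k → Coord.Fir _ _ k _ _) (fire-at e M p) (fires⇒fir f p)

  fir⇒fires : ∀ w M (m′ : Fin (nP S) → ℕ) → (∀ p → Coord.Fir (λ e → con′ e p) (λ e → pro′ e p) (lookup M p) w (m′ p)) →
              ∃ λ M′ → Fires S M w M′ × (∀ p → lookup M′ p ≡ m′ p)
  fir⇒fires []      M m′ f = M , fires-ε , f
  fir⇒fires (e ∷ w) M m′ f =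
    let M′ , g , eq = fir⇒fires w (fireMarking S e M) m′
                        (λ p → subst (λ k → Coord.Fir _ _ k w (m′ p)) (sym (fire-at e M p)) (proj₂ (f p)))
    in M′ , fires-∷ (proj₁ ∘ f , refl) g , eq

  enabled? : ∀ e M → Dec (Enabled S e M)
  enabled? e M = F.all? (λ p → lookup (pre S e) p ≤? lookup M p)

  firable? : ∀ M w → Dec (Firable S M w)
  firable? M []      = yes (M , fires-ε)
  firable? M (e ∷ w) = map′ (λ (en , M′ , f) → M′ , fires-∷ (en , refl) f)
                            (λ { (M′ , fires-∷ (en , refl) f) → en , M′ , f })
                            (enabled? e M ×-dec firable? (fireMarking S e M) w)

  AgreeUpTo : ℕ → Marking S → Marking S → Set
  AgreeUpTo K M M′ = ∀ p → lookup M p ≡ lookup M′ p ⊎ (K ≤ lookup M p × K ≤ lookup M′ p)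

  agree-sym : ∀ {K} M M′ → AgreeUpTo K M M′ → AgreeUpTo K M′ M
  agree-sym M M′ ag p = Sum.map sym (λ (l , l′) → l′ , l) (ag p)

  enabled-agree : ∀ {K} e M M′ → AgreeUpTo (suc K) M M′ → Enabled S e M → Enabled S e M′
  enabled-agree e M M′ ag en p with ag p
  ... | inj₁ eq       = ≤-trans (en p) (≤-reflexive eq)
  ... | inj₂ (_ , le) = ≤-trans (con≤1 e p) (≤-trans (s≤s z≤n) le)

  fire-agree : ∀ {K} e M M′ → AgreeUpTo (suc K) M M′ → AgreeUpTo K (fireMarking S e M) (fireMarking S e M′)
  fire-agree {K} e M M′ ag p with ag p
  ... | inj₁ eq        = inj₁ (trans (fire-at e M p) (trans (cong (λ k → k ∸ con′ e p + pro′ e p) eq) (sym (fire-at e M′ p))))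
  ... | inj₂ (le , le′) = inj₂ (above M le , above M′ le′)
    where
    above : ∀ M → suc K ≤ lookup M p → K ≤ lookup (fireMarking S e M) p
    above M le = ≤-trans (m≤n⇒m≤n+o (pro′ e p) (∸-mono le (con≤1 e p))) (≤-reflexive (sym (fire-at e M p)))

  -- A firing takes at most one token from each place and so costs one unit of the threshold.
  firable-agree : ∀ w {K} M M′ → length w ≤ K → AgreeUpTo K M M′ → Firable S M w → Firable S M′ w
  firable-agree []      M M′ le       ag _ = M′ , fires-ε
  firable-agree (e ∷ w) M M′ (s≤s le) ag (_ , fires-∷ (en , refl) f) =
    let M″ , g = firable-agree w (fireMarking S e M) (fireMarking S e M′) le (fire-agree e M M′ ag) (_ , f)
    in M″ , fires-∷ (enabled-agree e M M′ ag en , refl) g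

  module _ (a b : Trans S) (k : ℕ) where

    Nonpersistent : Marking S → Set
    Nonpersistent M = Enabled S a M × Enabled S b M ×
      ¬ (∃ λ (w : List (Trans S)) → length w ≤ k × Firable S M (a ∷ (w ++ (b ∷ []))))

    nonpersistent? : ∀ M → Dec (Nonpersistent M)
    nonpersistent? M = enabled? a M ×-dec enabled? b M ×-dec ¬? (search (λ w → firable? M (a ∷ (w ++ (b ∷ [])))) k)

    -- The longest word to be compared is `a w b` with `w` of length `k`, which explains the
    -- threshold `2 + k`.
    nonpersistent-agree : ∀ M M′ → AgreeUpTo (2 + k) M M′ → Nonpersistent M → Nonpersistent M′
    nonpersistent-agree M M′ ag (ea , eb , none) = enabled-agree a M M′ ag ea , enabled-agree b M M′ ag eb ,
      λ (w , le , f) → none (w , le , firable-agree (a ∷ (w ++ (b ∷ []))) M′ M (s≤s (short w le)) (agree-sym M M′ ag) f)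
      where
      short : ∀ w → length w ≤ k → length (w ++ (b ∷ [])) ≤ suc k
      short w le = ≤-trans (≤-reflexive (trans (L.length-++ w) (+-comm (length w) 1))) (s≤s le)

  -- The runs of the chain correspond to the reachable markings v + z with z p = 0 wherever v p < K.
  module _ (K : ℕ) (v : Fin (nP S) → ℕ) where

    firing : Comp (nP S)
    firing = record
      { graph    = record { size = 1 ; arcs = nT S ; src = λ _ → zero ; tgt = λ _ → zero ; con = con′ ; pro = pro′ }
      ; rigid    = λ _ → false
      ; value    = λ _ _ → 0
      ; coherent = λ _ _ ()
      ; start    = zero
      ; end      = zero
      ; entry    = λ p → just (lookup (M₀ S) p)
      ; exit     = λ _ → nothing
      }

    surplus : Fin (nP S) → Maybe ℕ
    surplus p with v p <? K
    ... | yes _ = just 0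
    ... | no  _ = nothing

    -- Values can be prescribed at entries and exits but not for the remainder of a link. This
    -- component without arcs exposes the remainder, so that it can be required to be 0.
    stop : Comp (nP S)
    stop = record
      { graph    = record { size = 1 ; arcs = 0 ; src = λ () ; tgt = λ () ; con = λ () ; pro = λ () }
      ; rigid    = λ _ → false
      ; value    = λ _ _ → 0
      ; coherent = λ ()
      ; start    = zero
      ; end      = zero
      ; entry    = λ _ → nothing
      ; exit     = surplus
      }

    class : Chain (nP S)
    class = cons firing v (λ _ → 0) (one stop)

    run⇒reachable : HasRun class → ∃ λ M → Reachable S M × (∀ p → v p ≡ lookup M p ⊎ (K ≤ v p × K ≤ lookup M p))
    run⇒reachable (m , m′ , m₁ , z , m₂ , (w , r) , m₁≡ , m₂≡ , ([] , r′)) =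
      let M , f , M≡ = fir⇒fires w (M₀ S) m₁ (λ p → subst (λ k → Coord.Fir _ _ k w (m₁ p)) (fits-entry r p) (fires r p))
      in M , (w , f) , λ p → compare p (trans (M≡ p) (m₁≡ p))
                              (trans (sym (fires r′ p)) (trans (m₂≡ p) (+-identityʳ (z p)))) (fits-exit r′ p)
      where
      compare : ∀ p {j} → j ≡ z p + v p → m′ p ≡ z p → Fits (surplus p) (m′ p) → v p ≡ j ⊎ (K ≤ v p × K ≤ j)
      compare p refl eq fits with v p <? K
      ... | yes _   = inj₁ (cong (_+ v p) (trans (sym fits) eq))
      ... | no  v≮K = inj₂ (≮⇒≥ v≮K , m≤n⇒m≤o+n (z p) (≮⇒≥ v≮K))

    reachable⇒run : ∀ M → Reachable S M → (∀ p → v p ≤ lookup M p) → (∀ p → v p < K → v p ≡ lookup M p) → HasRun class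
    reachable⇒run M (w , f) below exact = lookup (M₀ S) , z , lookup M , z , z , (w , record
        { path       = loops w
        ; fires      = fires⇒fir f
        ; fits-entry = λ _ → refl
        ; fits-exit  = λ _ → tt
        ; fits-rigid = λ _ ()
        }) , (λ p → sym (m∸n+n≡m (below p))) , (λ p → sym (+-identityʳ (z p))) , ([] , record
        { path       = refl
        ; fires      = λ _ → refl
        ; fits-entry = λ _ → tt
        ; fits-exit  = exits
        ; fits-rigid = λ _ ()
        })
      where
      z : Fin (nP S) → ℕ
      z p = lookup M p ∸ v p
      loops : ∀ w → Path (graph firing) zero w zero
      loops []      = refl
      loops (e ∷ w) = refl , loops w
      exits : ∀ p → Fits (surplus p) (z p)
      exits p with v p <? K
      ... | yes v<K = trans (cong (_∸ v p) (sym (exact p v<K))) (n∸n≡0 (v p))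
      ... | no  _   = tt

theorem8 : (S : Net) → (a b : Trans S) → b ≢ a → (k : ℕ) →
    Dec (∃ λ (M : Marking S) → Reachable S M × Enabled S a M × Enabled S b M ×
    ¬ (∃ λ (w : List (Trans S)) → length w ≤ k × Firable S M (a ∷ (w ++ (b ∷ [])))))
theorem8 S a b _ k = map′ witness classify-marking
  (exists-vec? (nP S) (λ v → nonpersistent? S a b k (marking v) ×-dec
                             run? (class S K (toℕ ∘ lookup v)) (≺-wellFounded (ranks (class S K (toℕ ∘ lookup v))))))
  where
  K = 2 + k
  -- The entry `K` represents every value from `K` on, hence `suc K` classes for each place.
  marking : Vec (Fin (suc K)) (nP S) → Marking S
  marking v = tabulate (toℕ ∘ lookup v)
  at : ∀ v p → lookup (marking v) p ≡ toℕ (lookup v p)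
  at v p = V.lookup∘tabulate _ p
  witness : (∃ λ v → Nonpersistent S a b k (marking v) × HasRun (class S K (toℕ ∘ lookup v))) →
          ∃ λ M → Reachable S M × Nonpersistent S a b k M
  witness (v , np , run) =
    let M , r , agree = run⇒reachable S K (toℕ ∘ lookup v) run
    in M , r , nonpersistent-agree S a b k (marking v) M (λ p → subst (λ j → j ≡ lookup M p ⊎ (K ≤ j × K ≤ lookup M p))
                 (sym (at v p)) (agree p)) np
  classify-marking : (∃ λ M → Reachable S M × Nonpersistent S a b k M) →
                     ∃ λ v → Nonpersistent S a b k (marking v) × HasRun (class S K (toℕ ∘ lookup v))
  classify-marking (M , r , np) = v , nonpersistent-agree S a b k M (marking v) agree np ,
    reachable⇒run S K (toℕ ∘ lookup v) M r (λ p → ≤-trans (≤-reflexive (v≡ p)) (m⊓n≤m _ K)) exact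
    where
    v : Vec (Fin (suc K)) (nP S)
    v = tabulate (λ p → fromℕ< (s≤s (m⊓n≤n (lookup M p) K)))
    v≡ : ∀ p → toℕ (lookup v p) ≡ lookup M p ⊓ K
    v≡ p = trans (cong toℕ (V.lookup∘tabulate _ p)) (F.toℕ-fromℕ< _)
    exact : ∀ p → toℕ (lookup v p) < K → toℕ (lookup v p) ≡ lookup M p
    exact p lt with ≤-total (lookup M p) K
    ... | inj₁ M≤K = trans (v≡ p) (m≤n⇒m⊓n≡m M≤K)
    ... | inj₂ K≤M = contradiction (trans (v≡ p) (m≥n⇒m⊓n≡n K≤M)) (<⇒≢ lt)
    agree : AgreeUpTo S K M (marking v)
    agree p with ≤-total (lookup M p) K
    ... | inj₁ M≤K = inj₁ (sym (trans (at v p) (trans (v≡ p) (m≤n⇒m⊓n≡m M≤K))))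
    ... | inj₂ K≤M = inj₂ (K≤M , ≤-reflexive (sym (trans (at v p) (trans (v≡ p) (m≥n⇒m⊓n≡n K≤M)))))
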